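{- Let $A$ be a symmetric $n\times n$ integer matrix with all diagonal entries even, and let $q=q_A$ be its associated quadratic form. Then: (a) For any normal form $N(r,s,t,p,m)$ of $A$ one has $m=\dim(\overline V_{000})$, $p\equiv \dim(\overline V_0/\overline V_{000}) \pmod 2$, and, if $q(\overline V_0)=\{0\}$, $r\equiv \mathrm{Arf}(q)\pmod 2$. (b) For fixed $n$ and fixed $\dim(\overline V_{000})$, the parameters $p,r,s,t,m$ of the normal forms are determined by the isomorphism class of $q$ up to the congruences in (a); in particular, for the minimal non-negative values of $p$ and $r$ the normal form is unique. Explicitly: if $q(\overline V_0)=\{0\}$, then $A$ has exactly one normal form with $r\in\{0,1\}$ (and this normal form is determined by $n$, $\dim\overline V_{000}$ and the isomorphism class of $q$); if $q(\overline V_0)=\mathbb F_2$, then $A$ has exactly one normal form with $p\in\{1,2\}$ and $r=0$ (likewise determined by $n$, $\dim\overline V_{000}$ and the isomorphism class of $q$).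
   Context: Let $V=\mathbb Z^n$, $\overline V=\mathbb Z^n/2\mathbb Z^n$ (an $\mathbb F_2$-vector space), and $(v,w)=v^TAw$ for $v,w\in V$. Since the diagonal of $A$ is even, $(v,v)$ is even for all $v$; the quadratic form $q=q_A:\overline V\to\mathbb F_2$ is $q(v)=(v,v)/2 \bmod 2$ (depending only on the coset of $v$), and it satisfies $q(u+v)=q(u)+q(v)+\Omega(u,v)$ where $\Omega(v,w)=(v,w)\bmod 2$ is alternating bilinear. Define $V_0=\{v\in V:(v,w)\equiv 0 \pmod 2\ \forall w\in V\}$, $V_{00}=\{v\in V_0:(v,v)\equiv 0\pmod 4\}$, $V_{000}=\{v\in V_0:(v,w)\equiv 0\pmod 4\ \forall w\in V\}$, and the $\mathbb F_2$-spaces $\overline V_0=V_0/2V$, $\overline V_{00}=V_{00}/2V$, $\overline V_{000}=(V_{000}+2V)/2V$; $\overline V_0$ is the kernel of $\Omega$. Arf invariant: choose a basis $e_1,f_1,\dots,e_k,f_k,h_1,\dots,h_l$ of $\overline V$ with $\Omega(e_i,f_j)=\delta_{ij}$ and all other values of $\Omega$ on pairs of basis vectors equal to $0$; if $q(\overline V_0)=\{0\}$, $\mathrm{Arf}(q)=\sum_i q(e_i)q(f_i)\in\mathbb F_2$ (independent of the choice). Quadratic forms $q,q'$ on $\overline V$ are isomorphic if there is a linear isomorphism $T$ with $q(T(x))=q'(x)$ for all $x$. A normal form of $A$ is a matrix $N(r,s,t,p,m)=\mathrm{diag}\big(r\begin{pmatrix}2&1\\1&2\end{pmatrix}, s\begin{pmatrix}0&1\\1&0\end{pmatrix},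 t\begin{pmatrix}0&2\\2&0\end{pmatrix}, p(2), m(0)\big)$ (block diagonal with $r$, $s$, $t$, $p$, $m$ copies of the indicated blocks) such that $P^TAP\pmod 4 = N(r,s,t,p,m)$ for some integer matrix $P$ with $\det P=\pm1$; here $\pmod 4$ means entrywise reduction into $\{0,1,2,3\}$. -}

module Defs where

open import Data.Nat as ℕ using (ℕ; zero; suc; _≤_; _%_; _≡ᵇ_)
open import Data.Integer as ℤ using (ℤ; +_; _+_; _*_; -_)
open import Data.Integer.DivMod using (_%ℕ_; _/ℕ_)
open import Data.Integer.Divisibility using (_∣_)
open import Data.Fin using (Fin; zero; suc; toℕ; splitAt; cast; punchIn)
open import Data.Sum using (_⊎_; inj₁; inj₂)
open import Data.Product using (Σ; _×_; _,_; ∃; ∃-syntax)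
open import Data.Bool using (Bool; true; false; _xor_; _∧_; if_then_else_)
open import Relation.Binary.PropositionalEquality using (_≡_; _≢_; sym)

Mat : ℕ → Set
Mat n = Fin n → Fin n → ℤ

Vecℤ : ℕ → Set
Vecℤ n = Fin n → ℤ

∑ : ∀ {n} → (Fin n → ℤ) → ℤ
∑ {zero}  f = + 0
∑ {suc n} f = f zero + ∑ (λ i → f (suc i))

_ᵀ : ∀ {n} → Mat n → Mat n
(M ᵀ) i j = M j i

infixl 7 _·_
_·_ : ∀ {n} → Mat n → Mat n → Mat n
(M · N) i j = ∑ λ k → M i k * N k j

minor : ∀ {n} → Fin (suc n) → Mat (suc n) → Mat n
minor j M a b = M (suc a) (punchIn j b)

sgn : ∀ {n} → Fin n → ℤ
sgn j = if (toℕ j % 2) ≡ᵇ 0 then + 1 else - (+ 1)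

det : ∀ {n} → Mat n → ℤ
det {zero}  M = + 1
det {suc n} M = ∑ λ j → sgn j * M zero j * det (minor j M)

Symmetric : ∀ {n} → Mat n → Set
Symmetric A = ∀ i j → A i j ≡ A j i

EvenDiagonal : ∀ {n} → Mat n → Set
EvenDiagonal A = ∀ i → + 2 ∣ A i i

⟨_⟩ : ∀ {n} → Mat n → Vecℤ n → Vecℤ n → ℤ
⟨ A ⟩ v w = ∑ λ i → ∑ λ j → v i * A i j * w j

empty : Mat 0
empty ()

_⊕_ : ∀ {a b} → Mat a → Mat b → Mat (a ℕ.+ b)
_⊕_ {a} M N i j with splitAt a i | splitAt a j
... | inj₁ x | inj₁ y = M x y
... | inj₂ x | inj₂ y = N x y
... | inj₁ _ | inj₂ _ = + 0
... | inj₂ _ | inj₁ _ = + 0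

rep : ∀ {k} (c : ℕ) → Mat k → Mat (c ℕ.* k)
rep zero    B = empty
rep (suc c) B = B ⊕ rep c B

mat2 : ℤ → ℤ → ℤ → ℤ → Mat 2
mat2 a b c d zero    zero    = a
mat2 a b c d zero    (suc _) = b
mat2 a b c d (suc _) zero    = c
mat2 a b c d (suc _) (suc _) = d

mat1 : ℤ → Mat 1
mat1 a _ _ = a

H₂ U₁ U₂ : Mat 2
H₂ = mat2 (+ 2) (+ 1) (+ 1) (+ 2)
U₁ = mat2 (+ 0) (+ 1) (+ 1) (+ 0)
U₂ = mat2 (+ 0) (+ 2) (+ 2) (+ 0)

nfSize : ℕ → ℕ → ℕ → ℕ → ℕ → ℕ
nfSize r s t p m = r ℕ.* 2 ℕ.+ (s ℕ.* 2 ℕ.+ (t ℕ.* 2 ℕ.+ (p ℕ.* 1 ℕ.+ m ℕ.* 1)))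

N : (r s t p m : ℕ) → Mat (nfSize r s t p m)
N r s t p m = rep r H₂ ⊕ (rep s U₁ ⊕ (rep t U₂ ⊕ (rep p (mat1 (+ 2)) ⊕ rep m (mat1 (+ 0)))))

IsNormalForm : ∀ {n} → Mat n → (r s t p m : ℕ) → Set
IsNormalForm {n} A r s t p m =
  Σ (nfSize r s t p m ≡ n) λ eq →
  Σ (Mat n) λ P →
    (det P ≡ + 1 ⊎ det P ≡ - (+ 1)) ×
    (∀ i j → + (((P ᵀ) · A · P) i j %ℕ 4)
               ≡ N r s t p m (cast (sym eq) i) (cast (sym eq) j))

F₂ : Set
F₂ = Bool

V̄ : ℕ → Set
V̄ n = Fin n → F₂

parity : ℤ → F₂
parity z = (ℤ.∣ z ∣ % 2) ≡ᵇ 1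

red : ∀ {n} → Vecℤ n → V̄ n
red v i = parity (v i)

lift : ∀ {n} → V̄ n → Vecℤ n
lift x i = if x i then + 1 else + 0

_+̄_ : ∀ {n} → V̄ n → V̄ n → V̄ n
(x +̄ y) i = x i xor y i

0̄ : ∀ {n} → V̄ n
0̄ i = false

_≈_ : ∀ {n} → V̄ n → V̄ n → Set
x ≈ y = ∀ i → x i ≡ y i

IsZero : ∀ {n} → V̄ n → Set
IsZero x = x ≈ 0̄

lc : ∀ {n d} → (Fin d → F₂) → (Fin d → V̄ n) → V̄ n
lc {d = zero}  c b = 0̄
lc {d = suc d} c b = (λ i → c zero ∧ b zero i) +̄ lc (λ k → c (suc k)) (λ k → b (suc k))

∑₂ : ∀ {d} → (Fin d → F₂) → F₂
∑₂ {zero}  f = false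
∑₂ {suc d} f = f zero xor ∑₂ (λ k → f (suc k))

-- S/T has dimension d (T ⊆ S subspaces): there is a family b₁..b_d in S
-- whose classes form a basis of S/T.
HasDimMod : ∀ {n} → (S T : V̄ n → Set) → ℕ → Set
HasDimMod {n} S T d =
  Σ (Fin d → V̄ n) λ b →
    (∀ k → S (b k)) ×
    (∀ c → T (lc c b) → ∀ k → c k ≡ false) ×
    (∀ x → S x → ∃[ c ] T (x +̄ lc c b))

HasDim : ∀ {n} → (S : V̄ n → Set) → ℕ → Set
HasDim S d = HasDimMod S IsZero d

V₀ : ∀ {n} → Mat n → Vecℤ n → Set
V₀ A v = ∀ w → + 2 ∣ ⟨ A ⟩ v w

V₀₀ : ∀ {n} → Mat n → Vecℤ n → Set
V₀₀ A v = V₀ A v × + 4 ∣ ⟨ A ⟩ v v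

V₀₀₀ : ∀ {n} → Mat n → Vecℤ n → Set
V₀₀₀ A v = V₀ A v × (∀ w → + 4 ∣ ⟨ A ⟩ v w)

-- V̄₀ = V₀/2V,  V̄₀₀₀ = (V₀₀₀ + 2V)/2V, as subsets of V̄
V̄₀ : ∀ {n} → Mat n → V̄ n → Set
V̄₀ A x = ∃[ v ] V₀ A v × red v ≈ x

V̄₀₀ : ∀ {n} → Mat n → V̄ n → Set
V̄₀₀ A x = ∃[ v ] V₀₀ A v × red v ≈ x

V̄₀₀₀ : ∀ {n} → Mat n → V̄ n → Set
V̄₀₀₀ A x = ∃[ v ] V₀₀₀ A v × red v ≈ x

-- q(x) = (v,v)/2 mod 2 for a lift v of x (canonical lift chosen)
q : ∀ {n} → Mat n → V̄ n → F₂
q A x = parity (⟨ A ⟩ (lift x) (lift x) /ℕ 2)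

Ω : ∀ {n} → Mat n → V̄ n → V̄ n → F₂
Ω A x y = parity (⟨ A ⟩ (lift x) (lift y))

qVanishesOnV̄₀ : ∀ {n} → Mat n → Set
qVanishesOnV̄₀ A = ∀ x → V̄₀ A x → q A x ≡ false

qSurjOnV̄₀ : ∀ {n} → Mat n → Set
qSurjOnV̄₀ A = ∀ (b : F₂) → ∃[ x ] V̄₀ A x × q A x ≡ b

δ : ∀ {k} → Fin k → Fin k → F₂
δ zero    zero    = true
δ zero    (suc _) = false
δ (suc _) zero    = false
δ (suc i) (suc j) = δ i j

IsSymplecticBasis : ∀ {n} → Mat n → (k l : ℕ) →
  (Fin k → V̄ n) → (Fin k → V̄ n) → (Fin l → V̄ n) → Set
IsSymplecticBasis {n} A k l e f h =
  (∀ a b c → IsZero (lc a e +̄ (lc b f +̄ lc c h)) →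
     (∀ i → a i ≡ false) × (∀ i → b i ≡ false) × (∀ j → c j ≡ false)) ×
  (∀ (x : V̄ n) → ∃[ a ] ∃[ b ] ∃[ c ] (lc a e +̄ (lc b f +̄ lc c h)) ≈ x) ×
  -- values of Ω (Ω is symmetric, so one order of each pair suffices)
  (∀ i j → Ω A (e i) (f j) ≡ δ i j) ×
  (∀ i j → Ω A (e i) (e j) ≡ false) ×
  (∀ i j → Ω A (f i) (f j) ≡ false) ×
  (∀ i j → Ω A (e i) (h j) ≡ false) ×
  (∀ i j → Ω A (f i) (h j) ≡ false) ×
  (∀ i j → Ω A (h i) (h j) ≡ false)

-- Arf(q_A) = a  (for q(V̄₀) = {0}): computed from a symplectic basis as
-- ∑ᵢ q(eᵢ) q(fᵢ)
ArfIs : ∀ {n} → Mat n → F₂ → Set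
ArfIs {n} A a =
  ∃[ k ] ∃[ l ] Σ (Fin k → V̄ n) λ e → Σ (Fin k → V̄ n) λ f → Σ (Fin l → V̄ n) λ h →
    IsSymplecticBasis A k l e f h × ∑₂ (λ i → q A (e i) ∧ q A (f i)) ≡ a

IsLinearIso : ∀ {n} → (V̄ n → V̄ n) → Set
IsLinearIso {n} T =
  (∀ x y → T (x +̄ y) ≈ (T x +̄ T y)) ×
  Σ (V̄ n → V̄ n) λ T⁻¹ → (∀ x → T (T⁻¹ x) ≈ x) × (∀ x → T⁻¹ (T x) ≈ x)

_≅q_ : ∀ {n} → (V̄ n → F₂) → (V̄ n → F₂) → Set
_≅q_ {n} q₁ q₂ = Σ (V̄ n → V̄ n) λ T → IsLinearIso T × (∀ x → q₁ (T x) ≡ q₂ x)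

NFParams : Set
NFParams = ℕ × ℕ × ℕ × ℕ × ℕ

IsNF : ∀ {n} → Mat n → NFParams → Set
IsNF A (r , s , t , p , m) = IsNormalForm A r s t p m

{-# OPTIONS --safe #-}
module Submission where

-- A normal form is a basis of ℤⁿ that splits, mod 4, into mutually orthogonal blocks. Reduced mod 2,
-- the blocks H₂ and U₁ span a complement of V̄₀, the blocks U₂ and (2) a complement of V̄₀₀₀ in V̄₀,
-- and the blocks (0) span V̄₀₀₀; this gives (a). Existence: split off blocks one at a time (a unit
-- off the diagonal gives H₂ or U₁, otherwise the form is twice a form mod 2), and use
-- 2H₂ ≅ 2U₁, H₂ ⊕ (2) ≅ U₁ ⊕ (2) and 3(2) ≅ U₂ ⊕ (2) mod 4 to minimise r and p. Uniqueness: the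
-- rank 2(r + s) of Ω is an invariant of q, which together with n, m and the parity of p determines
-- everything except r; the parity of r is the sign of the Gauss sum of (-1)^q over F₂^2(r + s).

open import Defs
open import Data.Nat as ℕ using (ℕ; zero; suc; _≤_; _<_; _%_; z≤n; s≤s)
import Data.Nat.Properties as ℕₚ
import Data.Nat.DivMod as ℕDM
open import Data.Nat.Induction using (<-rec)
import Data.Nat.Tactic.RingSolver as ℕSolver
open import Data.Integer using (ℤ; +_; -[1+_]; _+_; _*_; -_; _⊖_)
import Data.Integer.Properties as ℤₚ
open import Data.Integer.DivMod using (_%ℕ_; _/ℕ_; n%ℕd<d; a≡a%ℕn+[a/ℕn]*n)
import Data.Integer.Divisibility as ℤD
import Data.Integer.Divisibility.Signed as ℤS
open import Data.Integer.Tactic.RingSolver using (solve-∀)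
open import Data.Fin using (Fin; zero; suc; toℕ; punchIn; splitAt; cast; _↑ˡ_; _↑ʳ_)
import Data.Fin.Properties as Finₚ
open import Data.Bool using (Bool; true; false; not; _xor_; _∧_; if_then_else_)
import Data.Bool.Properties as Boolₚ
open import Data.Bool.Solver using (module xor-∧-Solver)
open import Data.List as List using (List; []; _∷_; _++_)
import Data.List.Properties as Listₚ
open import Data.Vec as Vec using (Vec; []; _∷_; lookup; toList)
import Data.Vec.Properties as Vecₚ
open import Data.Vec.Relation.Unary.All as All using (All; []; _∷_)
import Data.Vec.Relation.Unary.All.Properties as Allₚ
open import Data.Vec.Functional using (insertAt) renaming (_∷_ to _◂_; _++_ to _⧺_)
open import Data.Vec.Functional.Properties using (insertAt-lookup; insertAt-punchIn)
open import Data.Product using (Σ; _×_; _,_; ∃-syntax; proj₁; proj₂)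
open import Data.Sum using (_⊎_; inj₁; inj₂)
open import Data.Empty using (⊥-elim)
open import Data.Unit using (⊤; tt)
open import Relation.Nullary using (¬_; Dec; yes; no; contradiction)
open import Relation.Nullary.Decidable using (True; toWitness; from-yes)
open import Relation.Binary.PropositionalEquality
open import Function using (_∘_)
open xor-∧-Solver using (solve; _:+_; _:*_; _:=_)

-- Arithmetic mod 4

-- A enters only through the residues of (v,w) mod 4: their parity is Ω, half the residue of (v,v)
-- is q, and V₀₀₀ is the kernel mod 4. Hence `ℤ₄` is a type with four elements, whose identities are
-- decided by enumeration. Classes mod 2 alone do not suffice: U₂ and two blocks (0) have the same q
-- but different V̄₀₀₀. So a basis consists of integer vectors, is changed only by operations of
-- determinant 1 or -1, and is reduced mod 2 afterwards. The separate dimension of V̄₀₀₀ in (b) has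
-- the same origin. The Arf invariant is compared through a Gauss sum because a sum over all points
-- survives any bijective substitution, so two symplectic bases never have to be transformed into
-- each other. The sum runs over a complement of the radical, and the choice of complement does not
-- matter when q(V̄₀) = {0}. If q(V̄₀) = F₂, a block (2) is present and turns every H₂ into U₁,
-- which is why r can be taken to be 0.

ℤ₄ : Set
ℤ₄ = Fin 4

pattern k0 = zero
pattern k1 = suc zero
pattern k2 = suc (suc zero)
pattern k3 = suc (suc (suc zero))

suc₄ : ℤ₄ → ℤ₄
suc₄ k0 = k1
suc₄ k1 = k2
suc₄ k2 = k3
suc₄ k3 = k0

neg₄ : ℤ₄ → ℤ₄
neg₄ k0 = k0
neg₄ k1 = k3
neg₄ k2 = k2
neg₄ k3 = k1

infixl 6 _+₄_
infixl 7 _*₄_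

-- Sums and products reduce once the left argument is known, so closed coefficients such as `k1` and
-- `k2` evaluate without lemmas.
_+₄_ : ℤ₄ → ℤ₄ → ℤ₄
k0 +₄ y = y
k1 +₄ y = suc₄ y
k2 +₄ y = suc₄ (suc₄ y)
k3 +₄ y = suc₄ (suc₄ (suc₄ y))

_*₄_ : ℤ₄ → ℤ₄ → ℤ₄
k0 *₄ y = k0
k1 *₄ y = y
k2 *₄ y = y +₄ y
k3 *₄ y = neg₄ y

par : ℤ₄ → Bool
par k0 = false
par k1 = true
par k2 = false
par k3 = true

-- z/2 mod 2 for even z.
half : ℤ₄ → Bool
half k0 = false
half k1 = false
half k2 = true
half k3 = true

+₄-comm : ∀ x y → x +₄ y ≡ y +₄ x
+₄-comm = from-yes (Finₚ.all? λ x → Finₚ.all? λ y → x +₄ y Finₚ.≟ y +₄ x)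

+₄-assoc : ∀ x y z → (x +₄ y) +₄ z ≡ x +₄ (y +₄ z)
+₄-assoc = from-yes (Finₚ.all? λ x → Finₚ.all? λ y → Finₚ.all? λ z →
  (x +₄ y) +₄ z Finₚ.≟ x +₄ (y +₄ z))

suc₄-+₄ : ∀ x y → suc₄ x +₄ y ≡ suc₄ (x +₄ y)
suc₄-+₄ = from-yes (Finₚ.all? λ x → Finₚ.all? λ y → suc₄ x +₄ y Finₚ.≟ suc₄ (x +₄ y))

+₄-neg-suc : ∀ x y → suc₄ x +₄ neg₄ (suc₄ y) ≡ x +₄ neg₄ y
+₄-neg-suc = from-yes (Finₚ.all? λ x → Finₚ.all? λ y →
  suc₄ x +₄ neg₄ (suc₄ y) Finₚ.≟ x +₄ neg₄ y)

neg₄-+₄ : ∀ x y → neg₄ (x +₄ y) ≡ neg₄ x +₄ neg₄ y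
neg₄-+₄ = from-yes (Finₚ.all? λ x → Finₚ.all? λ y →
  neg₄ (x +₄ y) Finₚ.≟ neg₄ x +₄ neg₄ y)

*₄-suc₄ : ∀ x y → x *₄ suc₄ y ≡ x +₄ x *₄ y
*₄-suc₄ = from-yes (Finₚ.all? λ x → Finₚ.all? λ y → x *₄ suc₄ y Finₚ.≟ x +₄ x *₄ y)

*₄-neg₄ : ∀ x y → x *₄ neg₄ y ≡ neg₄ (x *₄ y)
*₄-neg₄ = from-yes (Finₚ.all? λ x → Finₚ.all? λ y → x *₄ neg₄ y Finₚ.≟ neg₄ (x *₄ y))

*₄-zeroʳ : ∀ x → x *₄ k0 ≡ k0
*₄-zeroʳ = from-yes (Finₚ.all? λ x → x *₄ k0 Finₚ.≟ k0)

+₄-identityʳ : ∀ x → x +₄ k0 ≡ x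
+₄-identityʳ = from-yes (Finₚ.all? λ x → x +₄ k0 Finₚ.≟ x)

+₄-inverseʳ : ∀ x → x +₄ neg₄ x ≡ k0
+₄-inverseʳ = from-yes (Finₚ.all? λ x → x +₄ neg₄ x Finₚ.≟ k0)

par-+₄ : ∀ x y → par (x +₄ y) ≡ par x xor par y
par-+₄ = from-yes (Finₚ.all? λ x → Finₚ.all? λ y → par (x +₄ y) Boolₚ.≟ (par x xor par y))

par-*₄ : ∀ x y → par (x *₄ y) ≡ par x ∧ par y
par-*₄ = from-yes (Finₚ.all? λ x → Finₚ.all? λ y → par (x *₄ y) Boolₚ.≟ (par x ∧ par y))

k2*₄-even : ∀ {x} → par x ≡ false → k2 *₄ x ≡ k0
k2*₄-even {k0} _ = refl
k2*₄-even {k1} ()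
k2*₄-even {k2} _ = refl
k2*₄-even {k3} ()

resℕ : ℕ → ℤ₄
resℕ zero    = k0
resℕ (suc n) = suc₄ (resℕ n)

res : ℤ → ℤ₄
res (+ n)      = resℕ n
res -[1+ n ]   = neg₄ (resℕ (suc n))

resℕ-+ : ∀ m n → resℕ (m ℕ.+ n) ≡ resℕ m +₄ resℕ n
resℕ-+ zero    n = refl
resℕ-+ (suc m) n = trans (cong suc₄ (resℕ-+ m n)) (sym (suc₄-+₄ (resℕ m) (resℕ n)))

res-⊖ : ∀ m n → res (m ⊖ n) ≡ resℕ m +₄ neg₄ (resℕ n)
res-⊖ zero    zero    = refl
res-⊖ zero    (suc n) = refl
res-⊖ (suc m) zero    = sym (+₄-identityʳ _)
res-⊖ (suc m) (suc n) = trans (cong res (ℤₚ.[1+m]⊖[1+n]≡m⊖n m n))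
  (trans (res-⊖ m n) (sym (+₄-neg-suc (resℕ m) (resℕ n))))

res-+ : ∀ i j → res (i + j) ≡ res i +₄ res j
res-+ (+ m)    (+ n)    = resℕ-+ m n
res-+ (+ m)    -[1+ n ] = res-⊖ m (suc n)
res-+ -[1+ m ] (+ n)    = trans (res-⊖ n (suc m)) (+₄-comm (resℕ n) _)
-- The sum is `-[1+ suc (m + n) ]`; its two successors have to be distributed, one to each summand.
res-+ -[1+ m ] -[1+ n ] = trans
  (cong (λ k → neg₄ (suc₄ k)) (trans (cong suc₄ (resℕ-+ m n)) (sym (suc₄-+₄ (resℕ m) (resℕ n)))))
  (trans (cong neg₄ (trans (cong suc₄ (+₄-comm (suc₄ (resℕ m)) (resℕ n)))
    (trans (sym (suc₄-+₄ (resℕ n) (suc₄ (resℕ m)))) (+₄-comm (suc₄ (resℕ n)) _))))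
    (neg₄-+₄ (suc₄ (resℕ m)) (suc₄ (resℕ n))))

res-neg : ∀ i → res (- i) ≡ neg₄ (res i)
res-neg (+ zero)  = refl
res-neg (+ suc n) = refl
res-neg -[1+ n ]  = sym (neg-neg (suc₄ (resℕ n)))
  where
  neg-neg : ∀ x → neg₄ (neg₄ x) ≡ x
  neg-neg = from-yes (Finₚ.all? λ x → neg₄ (neg₄ x) Finₚ.≟ x)

res-* : ∀ i j → res (i * j) ≡ res i *₄ res j
res-* i (+ n)    = nonneg n
  where
  nonneg : ∀ n → res (i * + n) ≡ res i *₄ resℕ n
  nonneg zero    = trans (cong res (ℤₚ.*-zeroʳ i)) (sym (*₄-zeroʳ (res i)))
  nonneg (suc n) = trans (cong res (ℤₚ.*-suc i (+ n)))
    (trans (res-+ i (i * + n)) (trans (cong (res i +₄_) (nonneg n))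
      (sym (*₄-suc₄ (res i) (resℕ n)))))
res-* i -[1+ n ] = trans (cong res (sym (ℤₚ.neg-distribʳ-* i (+ suc n))))
  (trans (res-neg (i * + suc n)) (trans (cong neg₄ (res-* i (+ suc n)))
    (sym (*₄-neg₄ (res i) (resℕ (suc n))))))

toℕ-resℕ : ∀ m → m ℕ.< 4 → toℕ (resℕ m) ≡ m
toℕ-resℕ 0 _ = refl
toℕ-resℕ 1 _ = refl
toℕ-resℕ 2 _ = refl
toℕ-resℕ 3 _ = refl
toℕ-resℕ (suc (suc (suc (suc m)))) (s≤s (s≤s (s≤s (s≤s ()))))

-- In Euclidean division the multiple of 4 dies under `res`, and a remainder below 4 is recovered by
-- `toℕ`. This links the entrywise reduction in `IsNormalForm` to `ℤ₄`.
toℕ-res : ∀ z → z %ℕ 4 ≡ toℕ (res z)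
toℕ-res z = trans (sym (toℕ-resℕ (z %ℕ 4) (n%ℕd<d z 4))) (cong toℕ (sym eq))
  where
  eq : res z ≡ resℕ (z %ℕ 4)
  eq = trans (cong res (a≡a%ℕn+[a/ℕn]*n z 4))
    (trans (res-+ (+ (z %ℕ 4)) (z /ℕ 4 * + 4)) (trans (cong (resℕ (z %ℕ 4) +₄_)
      (trans (res-* (z /ℕ 4) (+ 4)) (*₄-zeroʳ (res (z /ℕ 4))))) (+₄-identityʳ _)))

-- Both sides have period 2 on the naturals, and `par` is invariant under negation, which covers the
-- negative integers.
parity≡par : ∀ z → parity z ≡ par (res z)
parity≡par (+ n)    = go n
  where
  go : ∀ n → parity (+ n) ≡ par (resℕ n)
  go zero          = refl
  go (suc zero)    = refl
  go (suc (suc n)) = trans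
    (cong (ℕ._≡ᵇ 1) (trans (cong (_% 2) (ℕₚ.+-comm 2 n)) (ℕDM.[m+n]%n≡m%n n 2)))
    (trans (go n) (step (resℕ n)))
    where
    step : ∀ x → par x ≡ par (suc₄ (suc₄ x))
    step = from-yes (Finₚ.all? λ x → par x Boolₚ.≟ par (suc₄ (suc₄ x)))
parity≡par -[1+ n ] = trans (parity≡par (+ suc n)) (par-neg (resℕ (suc n)))
  where
  par-neg : ∀ x → par x ≡ par (neg₄ x)
  par-neg = from-yes (Finₚ.all? λ x → par x Boolₚ.≟ par (neg₄ x))

2∣⇒par : ∀ {z} → + 2 ℤD.∣ z → par (res z) ≡ false
2∣⇒par {z} d with ℤS.∣ᵤ⇒∣ {+ 2} {z} d
... | ℤS.divides c refl = trans (cong par (res-* c (+ 2))) (trans (par-*₄ (res c) k2) (Boolₚ.∧-zeroʳ _))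

4∣⇒res : ∀ {z} → + 4 ℤD.∣ z → res z ≡ k0
4∣⇒res {z} d with ℤS.∣ᵤ⇒∣ {+ 4} {z} d
... | ℤS.divides c refl = trans (res-* c (+ 4)) (*₄-zeroʳ (res c))

res⇒4∣ : ∀ z → res z ≡ k0 → + 4 ℤD.∣ z
res⇒4∣ z e = ℤS.∣⇒∣ᵤ (ℤS.divides (z /ℕ 4) (trans (a≡a%ℕn+[a/ℕn]*n z 4)
  (trans (cong (λ m → + m + (z /ℕ 4) * + 4) (trans (toℕ-res z) (cong toℕ e))) (ℤₚ.+-identityˡ _))))

-- The remainder differs from z by an even number, so it is even, and below 2 that leaves 0.
even⇒≡2* : ∀ z → par (res z) ≡ false → z ≡ (z /ℕ 2) * + 2
even⇒≡2* z e = trans (a≡a%ℕn+[a/ℕn]*n z 2)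
  (trans (cong (λ m → + m + (z /ℕ 2) * + 2) (%2 (z %ℕ 2) (n%ℕd<d z 2) even-rem)) (ℤₚ.+-identityˡ _))
  where
  %2 : ∀ m → m ℕ.< 2 → par (resℕ m) ≡ false → m ≡ 0
  %2 zero _ _ = refl
  %2 (suc zero) _ ()
  %2 (suc (suc m)) (s≤s (s≤s ())) _
  even-quot : par (res (z /ℕ 2 * + 2)) ≡ false
  even-quot = trans (cong par (res-* (z /ℕ 2) (+ 2))) (trans (par-*₄ (res (z /ℕ 2)) k2) (Boolₚ.∧-zeroʳ _))
  even-rem : par (resℕ (z %ℕ 2)) ≡ false
  even-rem = begin
    par (resℕ (z %ℕ 2))                                ≡⟨ Boolₚ.xor-identityʳ _ ⟨
    (par (resℕ (z %ℕ 2)) xor false)                    ≡⟨ cong (par (resℕ (z %ℕ 2)) xor_) even-quot ⟨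
    (par (resℕ (z %ℕ 2)) xor par (res (z /ℕ 2 * + 2))) ≡⟨ par-+₄ (resℕ (z %ℕ 2)) (res (z /ℕ 2 * + 2)) ⟨
    par (resℕ (z %ℕ 2) +₄ res (z /ℕ 2 * + 2))          ≡⟨ cong par (res-+ (+ (z %ℕ 2)) (z /ℕ 2 * + 2)) ⟨
    par (res (+ (z %ℕ 2) + z /ℕ 2 * + 2))              ≡⟨ cong (λ y → par (res y)) (a≡a%ℕn+[a/ℕn]*n z 2) ⟨
    par (res z)                                        ≡⟨ e ⟩
    false ∎
    where open ≡-Reasoning

par⇒2∣ : ∀ z → par (res z) ≡ false → + 2 ℤD.∣ z
par⇒2∣ z e = ℤS.∣⇒∣ᵤ (ℤS.divides (z /ℕ 2) (even⇒≡2* z e))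

-- With z = 2w, the residue of 2w mod 4 remembers exactly the parity of w. This ties `q`, defined by
-- integer division, to `half`.
parity-/2 : ∀ z → par (res z) ≡ false → parity (z /ℕ 2) ≡ half (res z)
parity-/2 z e = trans (parity≡par (z /ℕ 2)) (trans (half-*2 (res (z /ℕ 2)))
  (cong half (sym (trans (cong res (even⇒≡2* z e)) (res-* (z /ℕ 2) (+ 2))))))
  where
  half-*2 : ∀ x → par x ≡ half (x *₄ k2)
  half-*2 = from-yes (Finₚ.all? λ x → par x Boolₚ.≟ half (x *₄ k2))

-- Finite sums and the bilinear form over ℤ

∑-cong : ∀ {n} {f g : Fin n → ℤ} → (∀ i → f i ≡ g i) → ∑ f ≡ ∑ g
∑-cong {zero}  e = refl
∑-cong {suc n} e = cong₂ _+_ (e zero) (∑-cong (λ i → e (suc i)))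

∑-zero : ∀ n → ∑ {n} (λ _ → + 0) ≡ + 0
∑-zero zero    = refl
∑-zero (suc n) = trans (ℤₚ.+-identityˡ _) (∑-zero n)

∑-linear : ∀ {n} (f g : Fin n → ℤ) c → ∑ (λ i → f i + c * g i) ≡ ∑ f + c * ∑ g
∑-linear {zero}  f g c = solve₁ c
  where
  solve₁ : ∀ c → + 0 ≡ + 0 + c * + 0
  solve₁ = solve-∀
∑-linear {suc n} f g c = trans (cong (λ z → f zero + c * g zero + z) (∑-linear (λ i → f (suc i)) (λ i → g (suc i)) c))
  (rearrange (f zero) (g zero) c _ _)
  where
  rearrange : ∀ a b c d e → a + c * b + (d + c * e) ≡ a + d + c * (b + e)
  rearrange = solve-∀

∑-+ : ∀ {n} (f g : Fin n → ℤ) → ∑ (λ i → f i + g i) ≡ ∑ f + ∑ g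
∑-+ f g = trans (∑-cong (λ i → cong (λ z → f i + z) (sym (ℤₚ.*-identityˡ (g i)))))
  (trans (∑-linear f g (+ 1)) (cong (λ z → ∑ f + z) (ℤₚ.*-identityˡ (∑ g))))

∑-swap : ∀ {m n} (f : Fin m → Fin n → ℤ) →
  ∑ (λ i → ∑ λ j → f i j) ≡ ∑ (λ j → ∑ λ i → f i j)
∑-swap {zero}  {n} f = sym (∑-zero n)
∑-swap {suc m} {n} f = trans (cong (λ z → ∑ (f zero) + z) (∑-swap (λ i → f (suc i))))
  (sym (∑-+ (f zero) (λ j → ∑ λ i → f (suc i) j)))

∑-*ʳ : ∀ {n} (f : Fin n → ℤ) c → ∑ (λ i → f i * c) ≡ ∑ f * c
∑-*ʳ {zero}  f c = sym (ℤₚ.*-zeroˡ c)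
∑-*ʳ {suc n} f c = trans (cong (λ z → f zero * c + z) (∑-*ʳ (λ i → f (suc i)) c)) (sym (ℤₚ.*-distribʳ-+ c (f zero) _))

-- A symmetric double sum is its diagonal plus twice its strict upper triangle.
∑-symmetric-even : ∀ {n} (f : Fin n → Fin n → ℤ) → (∀ i j → f i j ≡ f j i) →
  (∀ i → par (res (f i i)) ≡ false) → par (res (∑ λ i → ∑ λ j → f i j)) ≡ false
∑-symmetric-even {zero}  f sy ev = refl
∑-symmetric-even {suc n} f sy ev = begin
  par (res (f zero zero + row + ∑ (λ i → f (suc i) zero + ∑ (λ j → f (suc i) (suc j)))))
    ≡⟨ cong (λ z → par (res (f zero zero + row + z))) (∑-+ (λ i → f (suc i) zero) _) ⟩
  par (res (f zero zero + row + (∑ (λ i → f (suc i) zero) + rest)))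
    ≡⟨ cong (λ z → par (res (f zero zero + row + (z + rest)))) (∑-cong (λ i → sy (suc i) zero)) ⟩
  par (res (f zero zero + row + (row + rest)))
    ≡⟨ cong (λ z → par (res z)) (rearrange (f zero zero) row rest) ⟩
  par (res (f zero zero + rest + row * + 2))
    ≡⟨ cong par (trans (res-+ (f zero zero + rest) (row * + 2)) (cong₂ _+₄_ (res-+ (f zero zero) rest) (res-* row (+ 2)))) ⟩
  par (res (f zero zero) +₄ res rest +₄ res row *₄ k2)
    ≡⟨ trans (par-+₄ (res (f zero zero) +₄ res rest) (res row *₄ k2)) (cong₂ _xor_ (par-+₄ (res (f zero zero)) (res rest)) (par-*₄ (res row) k2)) ⟩
  (par (res (f zero zero)) xor par (res rest)) xor (par (res row) ∧ false)
    ≡⟨ cong₂ (λ a b → (a xor b) xor (par (res row) ∧ false)) (ev zero)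
         (∑-symmetric-even (λ i j → f (suc i) (suc j)) (λ i j → sy (suc i) (suc j)) (λ i → ev (suc i))) ⟩
  (par (res row) ∧ false)
    ≡⟨ Boolₚ.∧-zeroʳ _ ⟩
  false ∎
  where
  open ≡-Reasoning
  row rest : ℤ
  row  = ∑ λ j → f zero (suc j)
  rest = ∑ λ i → ∑ λ j → f (suc i) (suc j)
  rearrange : ∀ a b c → a + b + (b + c) ≡ a + c + b * + 2
  rearrange = solve-∀

infix 6 _⊞_·_
-- The single vector operation: c = 1 is addition, and x - 2x is negation, so bilinearity needs only
-- one rule per argument.
_⊞_·_ : ∀ {n} → Vecℤ n → ℤ → Vecℤ n → Vecℤ n
(x ⊞ c · y) i = x i + c * y i

res-linear : ∀ a c b → res (a + c * b) ≡ res a +₄ res c *₄ res b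
res-linear a c b = trans (res-+ a (c * b)) (cong (res a +₄_) (res-* c b))

⟨⟩-cong : ∀ {n} (A : Mat n) {v v′ w w′} → (∀ i → v i ≡ v′ i) → (∀ i → w i ≡ w′ i) →
  ⟨ A ⟩ v w ≡ ⟨ A ⟩ v′ w′
⟨⟩-cong A e f = ∑-cong λ i → ∑-cong λ j → cong₂ (λ a b → a * A i j * b) (e i) (f j)

⟨⟩-linear : ∀ {n} (A : Mat n) x c y z → ⟨ A ⟩ (x ⊞ c · y) z ≡ ⟨ A ⟩ x z + c * ⟨ A ⟩ y z
⟨⟩-linear A x c y z = trans
  (∑-cong λ i → trans (∑-cong λ j → distribute (x i) c (y i) (A i j) (z j)) (∑-linear (λ j → x i * A i j * z j) (λ j → y i * A i j * z j) c))
  (∑-linear (λ i → ∑ λ j → x i * A i j * z j) (λ i → ∑ λ j → y i * A i j * z j) c)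
  where
  distribute : ∀ x c y a z → (x + c * y) * a * z ≡ x * a * z + c * (y * a * z)
  distribute = solve-∀

⟨⟩-sym : ∀ {n} (A : Mat n) → Symmetric A → ∀ v w → ⟨ A ⟩ v w ≡ ⟨ A ⟩ w v
⟨⟩-sym A sy v w = trans (∑-swap λ i j → v i * A i j * w j)
  (∑-cong λ j → ∑-cong λ i → trans (cong (λ a → v i * a * w j) (sy i j)) (reverse (v i) (A j i) (w j)))
  where
  reverse : ∀ a b c → a * b * c ≡ c * b * a
  reverse = solve-∀

-- Off-diagonal terms pair up by symmetry, and each diagonal term contains the even factor `A i i`.
⟨⟩-even : ∀ {n} (A : Mat n) → Symmetric A → EvenDiagonal A → ∀ v → par (res (⟨ A ⟩ v v)) ≡ false
⟨⟩-even A sy ev v = ∑-symmetric-even (λ i j → v i * A i j * v j)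
  (λ i j → trans (cong (λ a → v i * a * v j) (sy i j)) (reverse (v i) (A j i) (v j)))
  (λ i → trans (cong par (trans (res-* (v i * A i i) (v i)) (cong (_*₄ res (v i)) (res-* (v i) (A i i)))))
     (trans (par-*₄ (res (v i) *₄ res (A i i)) (res (v i)))
       (cong (_∧ par (res (v i))) (trans (par-*₄ (res (v i)) _) (trans (cong (par (res (v i)) ∧_) (2∣⇒par {A i i} (ev i))) (Boolₚ.∧-zeroʳ _))))))
  where
  reverse : ∀ a b c → a * b * c ≡ c * b * a
  reverse = solve-∀

-- Determinants through lists of columns

tl : ∀ {n} → Vecℤ (suc n) → Vecℤ n
tl v i = v (suc i)

-- Laplace expansion along the first row of the matrix with the listed columns;
-- the columns left of the deleted one are absorbed into the argument of D.
expand : ∀ {n} → (List (Vecℤ n) → ℤ) → List (Vecℤ (suc n)) → ℤ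
expand D []      = + 0
expand D (v ∷ l) = v zero * D (List.map tl l) + - expand (λ m → D (tl v ∷ m)) l

detL : ∀ {n} → List (Vecℤ n) → ℤ
detL {zero}  []      = + 1
detL {zero}  (_ ∷ _) = + 0
detL {suc n} l       = expand detL l

-- The laws hold behind an arbitrary prefix because `expand` moves columns into the prefix of the
-- argument of `D`. Vanishing on repeated columns follows from `swap-at`, as ℤ has no 2-torsion.
record Alternating {n} (D : List (Vecℤ n) → ℤ) : Set where
  field
    cong-at   : ∀ pre {x y} l → (∀ i → x i ≡ y i) → D (pre ++ x ∷ l) ≡ D (pre ++ y ∷ l)
    swap-at   : ∀ pre x y l → D (pre ++ x ∷ y ∷ l) ≡ - D (pre ++ y ∷ x ∷ l)
    linear-at : ∀ pre x c y l →
      D (pre ++ (x ⊞ c · y) ∷ l) ≡ D (pre ++ x ∷ l) + c * D (pre ++ y ∷ l)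

open Alternating

after : ∀ {n} {D : List (Vecℤ n) → ℤ} v → Alternating D → Alternating (λ m → D (v ∷ m))
cong-at   (after v alt) pre = cong-at alt (v ∷ pre)
swap-at   (after v alt) pre = swap-at alt (v ∷ pre)
linear-at (after v alt) pre = linear-at alt (v ∷ pre)

expand-ext : ∀ {n} {D E : List (Vecℤ n) → ℤ} → (∀ m → D m ≡ E m) → ∀ l → expand D l ≡ expand E l
expand-ext e []      = refl
expand-ext e (v ∷ l) = cong₂ (λ a b → v zero * a + - b) (e _) (expand-ext (λ m → e (tl v ∷ m)) l)

expand-linear : ∀ {n} (D E : List (Vecℤ n) → ℤ) c l →
  expand (λ m → D m + c * E m) l ≡ expand D l + c * expand E l
expand-linear D E c []      = zeros c
  where
  zeros : ∀ c → + 0 ≡ + 0 + c * + 0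
  zeros = solve-∀
expand-linear D E c (v ∷ l) = trans
  (cong (λ z → v zero * (D l′ + c * E l′) + - z) (expand-linear (λ m → D (tl v ∷ m)) (λ m → E (tl v ∷ m)) c l))
  (rearrange (v zero) (D l′) (E l′) _ _ c)
  where
  l′ = List.map tl l
  rearrange : ∀ a d e x y c → a * (d + c * e) + - (x + c * y) ≡ a * d + - x + c * (a * e + - y)
  rearrange = solve-∀

expand-neg : ∀ {n} {D E : List (Vecℤ n) → ℤ} → (∀ m → D m ≡ - E m) → ∀ l → expand D l ≡ - expand E l
expand-neg e []      = refl
expand-neg {E = E} e (v ∷ l) = trans
  (cong₂ (λ a b → v zero * a + - b) (e _) (expand-neg (λ m → e (tl v ∷ m)) l))
  (rearrange (v zero) (E (List.map tl l)) _)
  where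
  rearrange : ∀ a d x → a * - d + - - x ≡ - (a * d + - x)
  rearrange = solve-∀

module _ {n : ℕ} where

  private
    split-map : (D : List (Vecℤ n) → ℤ) → ∀ pre l →
      D (List.map tl (pre ++ l)) ≡ D (List.map tl pre ++ List.map tl l)
    split-map D pre l = cong D (Listₚ.map-++ tl pre l)

  -- The affected column is either struck out, where its first entry carries the law, or absorbed
  -- into the prefix, where `D` carries it. In a swap the two terms that strike out one column of
  -- the pair trade places with opposite signs.
  expand-alternating : {D : List (Vecℤ n) → ℤ} → Alternating D → Alternating (expand D)
  cong-at (expand-alternating {D} alt) = go alt
    where
    go : ∀ {D} → Alternating D → ∀ pre {x y} l → (∀ i → x i ≡ y i) →
      expand D (pre ++ x ∷ l) ≡ expand D (pre ++ y ∷ l)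
    go alt [] l e = cong₂ (λ a b → a * _ + - b) (e zero)
      (expand-ext (λ m → cong-at alt [] m (λ i → e (suc i))) l)
    go {D} alt (v ∷ pre) {x} {y} l e = cong₂ (λ a b → v zero * a + - b)
      (trans (split-map D pre (x ∷ l)) (trans
        (cong-at alt (List.map tl pre) _ (λ i → e (suc i))) (sym (split-map D pre (y ∷ l)))))
      (go (after (tl v) alt) pre l e)
  swap-at (expand-alternating alt) = go alt
    where
    rearrange : ∀ a b d e x → a * d + - (b * e + - - x) ≡ - (b * e + - (a * d + - x))
    rearrange = solve-∀
    rearrange₂ : ∀ a d x → a * - d + - - x ≡ - (a * d + - x)
    rearrange₂ = solve-∀
    go : ∀ {D} → Alternating D → ∀ pre x y l →
      expand D (pre ++ x ∷ y ∷ l) ≡ - expand D (pre ++ y ∷ x ∷ l)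
    go {D} alt [] x y l = trans
      (cong (λ z → x zero * D (tl y ∷ List.map tl l) + - (y zero * D (tl x ∷ List.map tl l) + - z))
        (expand-neg (λ m → swap-at alt [] (tl x) (tl y) m) l))
      (rearrange (x zero) (y zero) _ _ _)
    go {D} alt (v ∷ pre) x y l = trans (cong₂ (λ a b → v zero * a + - b)
      (trans (split-map D pre (x ∷ y ∷ l)) (trans
        (swap-at alt (List.map tl pre) (tl x) (tl y) _) (cong -_ (sym (split-map D pre (y ∷ x ∷ l))))))
      (go (after (tl v) alt) pre x y l))
      (rearrange₂ (v zero) _ _)
  linear-at (expand-alternating alt) = go alt
    where
    rearrange : ∀ a b c d e f → (a + c * b) * d + - (e + c * f) ≡ a * d + - e + c * (b * d + - f)
    rearrange = solve-∀
    rearrange₂ : ∀ a d e c x y → a * (d + c * e) + - (x + c * y) ≡ a * d + - x + c * (a * e + - y)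
    rearrange₂ = solve-∀
    go : ∀ {D} → Alternating D → ∀ pre x c y l →
      expand D (pre ++ (x ⊞ c · y) ∷ l) ≡ expand D (pre ++ x ∷ l) + c * expand D (pre ++ y ∷ l)
    go {D} alt [] x c y l = trans
      (cong (λ z → (x zero + c * y zero) * D (List.map tl l) + - z)
        (trans (expand-ext (λ m → linear-at alt [] (tl x) c (tl y) m) l)
          (expand-linear (λ m → D (tl x ∷ m)) (λ m → D (tl y ∷ m)) c l)))
      (rearrange (x zero) (y zero) c _ _ _)
    go {D} alt (v ∷ pre) x c y l = trans (cong₂ (λ a b → v zero * a + - b)
      (trans (split-map D pre ((x ⊞ c · y) ∷ l)) (trans
        (linear-at alt (List.map tl pre) (tl x) c (tl y) _)
        (cong₂ (λ a b → a + c * b) (sym (split-map D pre (x ∷ l))) (sym (split-map D pre (y ∷ l))))))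
      (go (after (tl v) alt) pre x c y l))
      (rearrange₂ (v zero) (D (List.map tl (pre ++ x ∷ l))) (D (List.map tl (pre ++ y ∷ l))) c _ _)

detL-alternating : ∀ {n} → Alternating (detL {n})
detL-alternating {suc n} = expand-alternating detL-alternating
detL-alternating {zero}  = record
  { cong-at   = λ pre l _ → trans (vanish pre) (sym (vanish pre))
  ; swap-at   = λ pre x y l → trans (vanish pre) (cong -_ (sym (vanish pre)))
  ; linear-at = λ pre x c y l → trans (vanish pre)
      (sym (trans (cong₂ (λ a b → a + c * b) (vanish pre) (vanish pre)) (trans (ℤₚ.+-identityˡ (c * + 0)) (ℤₚ.*-zeroʳ c))))
  }
  where
  vanish : ∀ pre {x : Vecℤ 0} {l} → detL (pre ++ x ∷ l) ≡ + 0
  vanish []      = refl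
  vanish (_ ∷ _) = refl

sgn-suc : ∀ {n} (j : Fin n) → sgn (suc j) ≡ - sgn j
sgn-suc j = go (toℕ j)
  where
  sign : ℕ → ℤ
  sign m = if (m % 2) ℕ.≡ᵇ 0 then + 1 else - (+ 1)
  periodic : ∀ m → sign (suc (suc m)) ≡ sign m
  periodic m = cong (λ k → if k ℕ.≡ᵇ 0 then + 1 else - (+ 1))
    (trans (cong (_% 2) (ℕₚ.+-comm 2 m)) (ℕDM.[m+n]%n≡m%n m 2))
  go : ∀ m → sign (suc m) ≡ - sign m
  go zero          = refl
  go (suc zero)    = refl
  go (suc (suc m)) = trans (periodic (suc m)) (trans (go m) (cong -_ (sym (periodic m))))

∑-neg : ∀ {n} (f : Fin n → ℤ) → ∑ (λ i → - f i) ≡ - ∑ f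
∑-neg {zero}  f = refl
∑-neg {suc n} f = trans (cong (λ z → - f zero + z) (∑-neg (f ∘ suc))) (sym (ℤₚ.neg-distrib-+ (f zero) _))

-- The number of columns is independent of the number of rows because the recursion drops columns
-- but no rows. The alternation of `sgn` is the minus sign in `expand`.
expand-tabulate : ∀ {n} k (V : Fin (suc k) → Vecℤ (suc n)) (D : List (Vecℤ n) → ℤ) →
  ∑ (λ j → sgn j * V j zero * D (List.tabulate λ b → tl (V (punchIn j b)))) ≡ expand D (List.tabulate V)
expand-tabulate k V D = cong₂ _+_
  (cong₂ _*_ (ℤₚ.*-identityˡ (V zero zero)) (cong D (sym (Listₚ.map-tabulate (V ∘ suc) tl))))
  (tail k V)
  where
  tail : ∀ k (V : Fin (suc k) → Vecℤ _) →
    ∑ (λ j → sgn (suc j) * V (suc j) zero * D (List.tabulate λ b → tl (V (punchIn (suc j) b))))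
    ≡ - expand (λ m → D (tl (V zero) ∷ m)) (List.tabulate (V ∘ suc))
  tail zero    V = refl
  tail (suc k) V = trans
    (∑-cong λ j → trans (cong (λ s → s * V (suc j) zero * E j) (sgn-suc j)) (pull (sgn j) (V (suc j) zero) (E j)))
    (trans (∑-neg (λ j → sgn j * V (suc j) zero * E j))
      (cong -_ (expand-tabulate k (V ∘ suc) (λ m → D (tl (V zero) ∷ m)))))
    where
    E : Fin (suc k) → ℤ
    E j = D (tl (V zero) ∷ List.tabulate λ b → tl (V (suc (punchIn j b))))
    pull : ∀ a b c → (- a) * b * c ≡ - (a * b * c)
    pull = solve-∀

det≡detL : ∀ {n} (M : Mat n) → det M ≡ detL (List.tabulate λ j i → M i j)
det≡detL {zero}  M = refl
det≡detL {suc n} M = trans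
  (∑-cong λ j → cong (sgn j * M zero j *_) (det≡detL (minor j M)))
  (expand-tabulate n (λ j i → M i j) detL)

-- Elementary column operations and the determinant up to sign

infix 4 _≡±_
_≡±_ : ℤ → ℤ → Set
a ≡± b = a ≡ b ⊎ a ≡ - b

≡±-trans : ∀ {a b c} → a ≡± b → b ≡± c → a ≡± c
≡±-trans (inj₁ refl) q           = q
≡±-trans (inj₂ refl) (inj₁ refl) = inj₂ refl
≡±-trans (inj₂ refl) (inj₂ refl) = inj₁ (ℤₚ.neg-involutive _)

self-neg : ∀ z → z ≡ - z → z ≡ + 0
self-neg (+ zero)  _ = refl
self-neg (+ suc n) ()
self-neg -[1+ n ]  ()

module _ {n : ℕ} where

  infix 4 _↝_
  -- `add` and `neg` act at the head only; `swap` and `cons` bring any pair of columns there. `neg`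
  -- is written x - 2x so that the linearity rule of `_⊞_·_` covers it too.
  data _↝_ : ∀ {k} → Vec (Vecℤ n) k → Vec (Vecℤ n) k → Set where
    swap : ∀ {k x y} {l : Vec _ k} → x ∷ y ∷ l ↝ y ∷ x ∷ l
    add  : ∀ {k x y} {l : Vec _ k} c → x ∷ y ∷ l ↝ (x ⊞ c · y) ∷ y ∷ l
    neg  : ∀ {k x} {l : Vec _ k} → x ∷ l ↝ (x ⊞ -[1+ 1 ] · x) ∷ l
    cons : ∀ {k x} {l l′ : Vec _ k} → l ↝ l′ → x ∷ l ↝ x ∷ l′
    done : ∀ {k} {l : Vec _ k} → l ↝ l
    _⨾_  : ∀ {k} {l l′ l″ : Vec _ k} → l ↝ l′ → l′ ↝ l″ → l ↝ l″

  infixr 5 _⨾_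

  ↝-alternating : ∀ {D k} {L L′ : Vec (Vecℤ n) k} → Alternating D → L ↝ L′ →
    ∀ pre → D (pre ++ toList L′) ≡± D (pre ++ toList L)
  ↝-alternating alt (swap {x = x} {y} {l}) pre = inj₂ (swap-at alt pre y x (toList l))
  -- The extra term contains the column y twice; swapping the two copies shows that it equals its
  -- own negative.
  ↝-alternating {D} alt (add {x = x} {y} {l} c) pre = inj₁ (trans (linear-at alt pre x c y (y ∷ toList l))
    (trans (cong (λ z → D (pre ++ x ∷ y ∷ toList l) + c * z)
        (self-neg _ (swap-at alt pre y y (toList l))))
      (trans (cong (λ z → D (pre ++ x ∷ y ∷ toList l) + z) (ℤₚ.*-zeroʳ c)) (ℤₚ.+-identityʳ _))))
  ↝-alternating {D} alt (neg {x = x} {l}) pre = inj₂ (trans (linear-at alt pre x -[1+ 1 ] x (toList l))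
    (minus (D (pre ++ x ∷ toList l))))
    where
    minus : ∀ d → d + -[1+ 1 ] * d ≡ - d
    minus = solve-∀
  ↝-alternating {D} alt (cons {x = x} {l} {l′} r) pre =
    subst₂ _≡±_ (assoc l′) (assoc l) (↝-alternating alt r (pre ++ x ∷ []))
    where
    assoc : ∀ l → D ((pre ++ x ∷ []) ++ toList l) ≡ D (pre ++ x ∷ toList l)
    assoc l = cong D (Listₚ.++-assoc pre (x ∷ []) (toList l))
  ↝-alternating alt done    pre = inj₁ refl
  ↝-alternating alt (r ⨾ s) pre = ≡±-trans (↝-alternating alt s pre) (↝-alternating alt r pre)

toList-tabulate : ∀ {X : Set} {k} (f : Fin k → X) → toList (Vec.tabulate f) ≡ List.tabulate f
toList-tabulate {k = zero}  f = refl
toList-tabulate {k = suc k} f = cong (f zero ∷_) (toList-tabulate (f ∘ suc))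

tabulate-lookup : ∀ {X : Set} {k} (L : Vec X k) → List.tabulate (lookup L) ≡ toList L
tabulate-lookup []      = refl
tabulate-lookup (x ∷ L) = cong (x ∷_) (tabulate-lookup L)

std : ∀ {n} → Fin n → Vecℤ n
std j i = if δ i j then + 1 else + 0

det-std : ∀ n → det {n} (λ i j → std j i) ≡ + 1
det-std zero    = refl
det-std (suc n) = trans (cong₂ _+_
  (trans (ℤₚ.*-identityˡ _) (det-std n))
  (trans (∑-cong {n} λ j → trans (cong (_* D j) (ℤₚ.*-zeroʳ (sgn (suc j)))) (ℤₚ.*-zeroˡ (D j))) (∑-zero n)))
  refl
  where
  D : Fin n → ℤ
  D j = det (minor (suc j) (λ i j → std j i))

det-reduced : ∀ {n} (L : Vec (Vecℤ n) n) → Vec.tabulate std ↝ L →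
  det (λ i j → lookup L j i) ≡ + 1 ⊎ det (λ i j → lookup L j i) ≡ - (+ 1)
det-reduced {n} L r with ↝-alternating detL-alternating r []
... | s rewrite det≡detL (λ i j → lookup L j i) | tabulate-lookup L | toList-tabulate (std {n})
    | sym (det≡detL {n} (λ i j → std j i)) | det-std n = s

-- Linear algebra over F₂

≢true⇒≡false : ∀ {a} → a ≢ true → a ≡ false
≢true⇒≡false {false} _ = refl
≢true⇒≡false {true}  n = ⊥-elim (n refl)

xor≡false⇒≡ : ∀ {a b} → a xor b ≡ false → a ≡ b
xor≡false⇒≡ {false} {false} _ = refl
xor≡false⇒≡ {true}  {true}  _ = refl

∑₂-cong : ∀ {d} {f g : Fin d → F₂} → (∀ k → f k ≡ g k) → ∑₂ f ≡ ∑₂ g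
∑₂-cong {zero}  e = refl
∑₂-cong {suc d} e = cong₂ _xor_ (e zero) (∑₂-cong (e ∘ suc))

∑₂-zero : ∀ {d} {f : Fin d → F₂} → (∀ k → f k ≡ false) → ∑₂ f ≡ false
∑₂-zero {zero}  e = refl
∑₂-zero {suc d} e = cong₂ _xor_ (e zero) (∑₂-zero (e ∘ suc))

∑₂-xor : ∀ {d} (f g : Fin d → F₂) → ∑₂ (λ k → f k xor g k) ≡ ∑₂ f xor ∑₂ g
∑₂-xor {zero}  f g = refl
∑₂-xor {suc d} f g = trans (cong ((f zero xor g zero) xor_) (∑₂-xor (f ∘ suc) (g ∘ suc)))
  (solve 4 (λ a b c d → (a :+ b) :+ (c :+ d) := (a :+ c) :+ (b :+ d)) refl (f zero) (g zero) _ _)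

∑₂-∧ʳ : ∀ {d} (f : Fin d → F₂) a → ∑₂ (λ k → f k ∧ a) ≡ ∑₂ f ∧ a
∑₂-∧ʳ {zero}  f a = refl
∑₂-∧ʳ {suc d} f a = trans (cong ((f zero ∧ a) xor_) (∑₂-∧ʳ (f ∘ suc) a))
  (solve 3 (λ b c a → (b :* a) :+ (c :* a) := (b :+ c) :* a) refl (f zero) _ a)

∑₂-∧ˡ : ∀ {d} (f : Fin d → F₂) a → ∑₂ (λ k → a ∧ f k) ≡ a ∧ ∑₂ f
∑₂-∧ˡ f a = trans (∑₂-cong λ k → Boolₚ.∧-comm a (f k)) (trans (∑₂-∧ʳ f a) (Boolₚ.∧-comm (∑₂ f) a))

∑₂-swap : ∀ {d e} (f : Fin d → Fin e → F₂) → ∑₂ (λ i → ∑₂ (f i)) ≡ ∑₂ (λ j → ∑₂ λ i → f i j)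
∑₂-swap {zero} {e} f = sym (∑₂-zero {e} {λ _ → false} λ _ → refl)
∑₂-swap {suc d} f = trans (cong (∑₂ (f zero) xor_) (∑₂-swap (f ∘ suc)))
  (sym (∑₂-xor (f zero) (λ j → ∑₂ λ i → f (suc i) j)))

∑₂-remove : ∀ {d} (f : Fin (suc d) → F₂) i → ∑₂ f ≡ f i xor ∑₂ (f ∘ punchIn i)
∑₂-remove f zero = refl
∑₂-remove {suc d} f (suc i) = trans (cong (f zero xor_) (∑₂-remove (f ∘ suc) i))
  (solve 3 (λ a b c → a :+ (b :+ c) := b :+ (a :+ c)) refl (f zero) (f (suc i)) _)

∑₂-δ : ∀ {d} (c : Fin d → F₂) j → ∑₂ (λ k → c k ∧ δ k j) ≡ c j
∑₂-δ {suc d} c zero = trans (cong₂ _xor_ (Boolₚ.∧-identityʳ (c zero)) (∑₂-zero λ k → Boolₚ.∧-zeroʳ (c (suc k)))) (Boolₚ.xor-identityʳ (c zero))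
∑₂-δ {suc d} c (suc j) = trans
  (cong (_xor ∑₂ (λ k → c (suc k) ∧ δ k j)) (Boolₚ.∧-zeroʳ (c zero))) (∑₂-δ (c ∘ suc) j)

lc-∑₂ : ∀ {n d} (c : Fin d → F₂) (b : Fin d → V̄ n) i → lc c b i ≡ ∑₂ (λ k → c k ∧ b k i)
lc-∑₂ {d = zero}  c b i = refl
lc-∑₂ {d = suc d} c b i = cong ((c zero ∧ b zero i) xor_) (lc-∑₂ (c ∘ suc) (b ∘ suc) i)

module _ {n : ℕ} where

  lc-cong : ∀ {d} {c c′ : Fin d → F₂} {b b′ : Fin d → V̄ n} →
    (∀ k → c k ≡ c′ k) → (∀ k → b k ≈ b′ k) → lc c b ≈ lc c′ b′
  lc-cong {zero}  e f i = refl
  lc-cong {suc d} e f i = cong₂ _xor_ (cong₂ _∧_ (e zero) (f zero i)) (lc-cong (e ∘ suc) (f ∘ suc) i)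

  lc-zero : ∀ {d} {c : Fin d → F₂} (b : Fin d → V̄ n) → (∀ k → c k ≡ false) → IsZero (lc c b)
  lc-zero {c = c} b e i = trans (lc-∑₂ c b i) (∑₂-zero λ k → cong (_∧ b k i) (e k))

  lc-+ : ∀ {d} (c c′ : Fin d → F₂) (b : Fin d → V̄ n) →
    lc (λ k → c k xor c′ k) b ≈ (lc c b +̄ lc c′ b)
  lc-+ c c′ b i = trans (lc-∑₂ (λ k → c k xor c′ k) b i)
    (trans (∑₂-cong λ k → Boolₚ.∧-distribʳ-xor (b k i) (c k) (c′ k))
      (trans (∑₂-xor (λ k → c k ∧ b k i) (λ k → c′ k ∧ b k i)) (sym (cong₂ _xor_ (lc-∑₂ c b i) (lc-∑₂ c′ b i)))))

  -- Associativity of the product of the row c with the matrices M and b, by exchanging the two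
  -- sums.
  lc-lc : ∀ {d m} (c : Fin d → F₂) (M : Fin d → V̄ m) (b : Fin m → V̄ n) →
    lc c (λ k → lc (M k) b) ≈ lc (lc c M) b
  lc-lc c M b i = begin
    lc c (λ k → lc (M k) b) i                       ≡⟨ lc-∑₂ c (λ k → lc (M k) b) i ⟩
    ∑₂ (λ k → c k ∧ lc (M k) b i)                   ≡⟨ ∑₂-cong (λ k → trans (cong (c k ∧_) (lc-∑₂ (M k) b i)) (sym (∑₂-∧ˡ (λ j → M k j ∧ b j i) (c k)))) ⟩
    ∑₂ (λ k → ∑₂ λ j → c k ∧ (M k j ∧ b j i))       ≡⟨ ∑₂-swap (λ k j → c k ∧ (M k j ∧ b j i)) ⟩
    ∑₂ (λ j → ∑₂ λ k → c k ∧ (M k j ∧ b j i))       ≡⟨ ∑₂-cong (λ j → trans (∑₂-cong λ k → sym (Boolₚ.∧-assoc (c k) (M k j) (b j i))) (∑₂-∧ʳ (λ k → c k ∧ M k j) (b j i))) ⟩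
    ∑₂ (λ j → ∑₂ (λ k → c k ∧ M k j) ∧ b j i)       ≡⟨ ∑₂-cong (λ j → cong (_∧ b j i) (sym (lc-∑₂ c M j))) ⟩
    ∑₂ (λ j → lc c M j ∧ b j i)                     ≡⟨ lc-∑₂ (lc c M) b i ⟨
    lc (lc c M) b i                                 ∎
    where open ≡-Reasoning

-- Gaussian elimination: clear the first coordinate with a pivot vector and recurse.
dependent : ∀ {d} m → m < d → (b : Fin d → V̄ m) →
  ∃[ c ] (∃[ j ] c j ≡ true) × IsZero (lc c b)
dependent {suc d} zero    _ b = (λ _ → true) , (zero , refl) , λ ()
dependent {suc d} (suc m) (s≤s m<d) b with Finₚ.any? (λ i → b i zero Boolₚ.≟ true)
... | no none with dependent {suc d} m (ℕₚ.m≤n⇒m≤1+n m<d) (λ k i → b k (suc i))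
...   | c , nz , z = c , nz , λ
  { zero    → trans (lc-∑₂ c b zero) (∑₂-zero λ k →
      trans (cong (c k ∧_) (≢true⇒≡false (λ e → none (k , e)))) (Boolₚ.∧-zeroʳ (c k)))
  ; (suc i) → trans (lc-∑₂ c b (suc i)) (trans (sym (lc-∑₂ c (λ k i → b k (suc i)) i)) (z i)) }
dependent {suc d} (suc m) (s≤s m<d) b | yes (i , pivot)
  with dependent {d} m m<d (λ k a → b (punchIn i k) (suc a) xor (b (punchIn i k) zero ∧ b i (suc a)))
... | c′ , (j , nz) , z = c , (punchIn i j , trans (insertAt-punchIn c′ i v j) nz) , zeros
  where
  r = λ k → b (punchIn i k)
  -- The pivot vector has first coordinate 1, so this coefficient cancels the first coordinate of
  -- the whole combination.
  v = ∑₂ (λ k → c′ k ∧ r k zero)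
  c = insertAt c′ i v
  open ≡-Reasoning
  at : ∀ a → lc c b a ≡ (v ∧ b i a) xor ∑₂ (λ k → c′ k ∧ r k a)
  at a = trans (lc-∑₂ c b a) (trans (∑₂-remove (λ k → c k ∧ b k a) i)
    (cong₂ _xor_ (cong (_∧ b i a) (insertAt-lookup c′ i v))
      (∑₂-cong λ k → cong (_∧ r k a) (insertAt-punchIn c′ i v k))))
  zeros : IsZero (lc c b)
  zeros zero    = trans (at zero) (trans (cong (λ p → (v ∧ p) xor v) pivot)
    (trans (cong (_xor v) (Boolₚ.∧-identityʳ v)) (Boolₚ.xor-same v)))
  zeros (suc a) = begin
    lc c b (suc a)                                                        ≡⟨ at (suc a) ⟩
    (v ∧ b i (suc a)) xor ∑₂ (λ k → c′ k ∧ r k (suc a))                   ≡⟨ cong (_xor ∑₂ (λ k → c′ k ∧ r k (suc a))) (sym (∑₂-∧ʳ (λ k → c′ k ∧ r k zero) (b i (suc a)))) ⟩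
    ∑₂ (λ k → (c′ k ∧ r k zero) ∧ b i (suc a)) xor ∑₂ (λ k → c′ k ∧ r k (suc a)) ≡⟨ ∑₂-xor (λ k → (c′ k ∧ r k zero) ∧ b i (suc a)) _ ⟨
    ∑₂ (λ k → ((c′ k ∧ r k zero) ∧ b i (suc a)) xor (c′ k ∧ r k (suc a))) ≡⟨ ∑₂-cong (λ k → solve 4 (λ c p q s → ((c :* p) :* q) :+ (c :* s) := c :* (s :+ (p :* q))) refl (c′ k) (r k zero) (b i (suc a)) (r k (suc a))) ⟩
    ∑₂ (λ k → c′ k ∧ (r k (suc a) xor (r k zero ∧ b i (suc a))))          ≡⟨ lc-∑₂ c′ _ a ⟨
    lc c′ (λ k a → r k (suc a) xor (r k zero ∧ b i (suc a))) a            ≡⟨ z a ⟩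
    false                                                                 ∎

-- The n + 1 vectors x and b are dependent, and independence of b forces x to occur in the relation.
independent⇒spanning : ∀ {n} (b : Fin n → V̄ n) → (∀ c → IsZero (lc c b) → ∀ j → c j ≡ false) →
  ∀ x → ∃[ c ] (lc c b ≈ x)
independent⇒spanning {n} b indep x with dependent n ℕₚ.≤-refl family
  where
  family : Fin (suc n) → V̄ n
  family zero    = x
  family (suc k) = b k
... | c , nz , z = go (c zero) refl nz
  where
  go : ∀ v → c zero ≡ v → (Σ (Fin (suc n)) λ j → c j ≡ true) → ∃[ a ] (lc a b ≈ x)
  go true  c₀ _ = c ∘ suc , λ i → sym (xor≡false⇒≡
    (trans (cong (λ v → (v ∧ x i) xor lc (c ∘ suc) b i) (sym c₀)) (z i)))
  go false c₀ (zero  , nz) = contradiction (trans (sym nz) c₀) λ ()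
  go false c₀ (suc j , nz) = contradiction (trans (sym nz) (indep (c ∘ suc)
    (λ i → trans (cong (λ v → (v ∧ x i) xor lc (c ∘ suc) b i) (sym c₀)) (z i)) j)) λ ()

-- If d exceeded e, the coordinate vectors of b over b′ would be dependent, and the same relation
-- would hold among the b themselves.
HasDim-mono : ∀ {n} {S T : V̄ n → Set} {d e} → (∀ x → S x → T x) → HasDim S d → HasDim T e → d ≤ e
HasDim-mono {n} {d = d} {e} S⊆T (b , b∈S , indep , _) (b′ , _ , _ , span) with d ℕₚ.≤? e
... | yes d≤e = d≤e
... | no  d≰e with dependent e (ℕₚ.≰⇒> d≰e) (λ k → proj₁ (span (b k) (S⊆T _ (b∈S k))))
...   | c , (j , nz) , z = contradiction (trans (sym nz) (indep c vanish j)) λ ()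
  where
  M : Fin d → V̄ e
  M k = proj₁ (span (b k) (S⊆T _ (b∈S k)))
  vanish : IsZero (lc c b)
  vanish i = trans (lc-cong (λ _ → refl) (λ k a → xor≡false⇒≡ (proj₂ (span (b k) (S⊆T _ (b∈S k))) a)) i)
    (trans (lc-lc c M b′ i) (lc-zero b′ z i))

HasDim-unique : ∀ {n} {S T : V̄ n → Set} {d e} → (∀ x → S x → T x) → (∀ x → T x → S x) →
  HasDim S d → HasDim T e → d ≡ e
HasDim-unique S⊆T T⊆S p q = ℕₚ.≤-antisym (HasDim-mono S⊆T p q) (HasDim-mono T⊆S q p)

-- Reduction mod 2 of integer vectors and bases

bit : Bool → ℤ
bit b = if b then + 1 else + 0

parity-bit : ∀ b → parity (bit b) ≡ b
parity-bit false = refl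
parity-bit true  = refl

module _ {n : ℕ} where

  red-⊞ : ∀ (x : Vecℤ n) c y i → red (x ⊞ c · y) i ≡ red x i xor (parity c ∧ red y i)
  red-⊞ x c y i = begin
    parity (x i + c * y i)                         ≡⟨ parity≡par (x i + c * y i) ⟩
    par (res (x i + c * y i))                      ≡⟨ cong par (res-linear (x i) c (y i)) ⟩
    par (res (x i) +₄ res c *₄ res (y i))          ≡⟨ par-+₄ (res (x i)) (res c *₄ res (y i)) ⟩
    (par (res (x i)) xor par (res c *₄ res (y i))) ≡⟨ cong₂ _xor_ (sym (parity≡par (x i))) (trans (par-*₄ (res c) (res (y i))) (cong₂ _∧_ (sym (parity≡par c)) (sym (parity≡par (y i))))) ⟩
    (red x i xor (parity c ∧ red y i))             ∎
    where open ≡-Reasoning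

  redL : ∀ {k} → Vec (Vecℤ n) k → Fin k → V̄ n
  redL L k = red (lookup L k)

  comb : ∀ {k} → (Fin k → F₂) → Vec (Vecℤ n) k → Vecℤ n
  comb c []      = λ _ → + 0
  comb c (x ∷ L) = comb (c ∘ suc) L ⊞ bit (c zero) · x

  red-comb : ∀ {k} c (L : Vec (Vecℤ n) k) → red (comb c L) ≈ lc c (redL L)
  red-comb c []      i = refl
  red-comb c (x ∷ L) i = trans (red-⊞ (comb (c ∘ suc) L) (bit (c zero)) x i)
    (trans (cong₂ (λ a b → a xor (b ∧ red x i)) (red-comb (c ∘ suc) L i) (parity-bit (c zero)))
      (Boolₚ.xor-comm _ (c zero ∧ red x i)))

  -- The source of every argument that a pairing or a square depends only on classes mod 2.
  halve : ∀ (v u : Vecℤ n) → red v ≈ red u → ∃[ w ] (∀ i → v i ≡ (u ⊞ + 2 · w) i)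
  halve v u e = (λ i → (v i + -[1+ 0 ] * u i) /ℕ 2) , λ i →
    trans (split (v i) (u i)) (cong (λ z → u i + z) (trans (even⇒≡2* _ (even i)) (ℤₚ.*-comm _ (+ 2))))
    where
    split : ∀ a b → a ≡ b + (a + -[1+ 0 ] * b)
    split = solve-∀
    even : ∀ i → par (res (v i + -[1+ 0 ] * u i)) ≡ false
    even i = trans (sym (parity≡par (v i + -[1+ 0 ] * u i))) (trans (red-⊞ v -[1+ 0 ] u i)
      (trans (cong (_xor red u i) (e i)) (Boolₚ.xor-same (red u i))))

  record IsBasis {k} (b : Fin k → V̄ n) : Set where
    field
      independent : ∀ c → IsZero (lc c b) → ∀ j → c j ≡ false
      spanning    : ∀ x → ∃[ c ] (lc c b ≈ x)

  absorb : ∀ {k} x (L : Vec (Vecℤ n) k) c →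
    ∃[ y ] (x ∷ L ↝ y ∷ L) × red y ≈ (red x +̄ lc c (redL L))
  absorb x []      c = x , done , λ i → sym (Boolₚ.xor-identityʳ _)
  absorb x (z ∷ L) c with absorb (x ⊞ bit (c zero) · z) L (c ∘ suc)
  -- After its multiple has been added, z is parked in front so that the recursion meets the growing
  -- column directly before the rest of L.
  ... | y , r , e = y , add (bit (c zero)) ⨾ swap ⨾ cons r ⨾ swap , λ i →
    trans (e i) (trans (cong (_xor lc (c ∘ suc) (redL L) i)
      (trans (red-⊞ x (bit (c zero)) z i) (cong (λ b → red x i xor (b ∧ red z i)) (parity-bit (c zero)))))
      (Boolₚ.xor-assoc (red x i) _ _))

  -- The first column with coefficient 1 absorbs all later ones; the columns before it have
  -- coefficient 0 and are moved behind it.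
  bring-to-front : ∀ {k} (L : Vec (Vecℤ n) (suc k)) c j → c j ≡ true →
    ∃[ x ] ∃[ L′ ] (L ↝ x ∷ L′) × red x ≈ lc c (redL L)
  bring-to-front (x ∷ L) c zero e with absorb x L (c ∘ suc)
  ... | y , r , f = y , L , r , λ i → trans (f i)
    (cong (λ b → (b ∧ red x i) xor lc (c ∘ suc) (redL L) i) (sym e))
  bring-to-front {suc k} (x ∷ L) c (suc j) e = go (c zero) refl
    where
    go : ∀ b → c zero ≡ b → ∃[ y ] ∃[ L′ ] (x ∷ L ↝ y ∷ L′) × red y ≈ lc c (redL (x ∷ L))
    go true  c₀ = bring-to-front (x ∷ L) c zero c₀
    go false c₀ with bring-to-front L (c ∘ suc) j e
    ... | y , L′ , r , f = y , x ∷ L′ , (cons r ⨾ swap) , λ i → trans (f i)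
      (cong (λ b → (b ∧ red x i) xor lc (c ∘ suc) (redL L) i) (sym c₀))

Unimodular : ∀ {n} → Vec (Vecℤ n) n → Set
Unimodular L = detL (toList L) ≡ + 1 ⊎ detL (toList L) ≡ - (+ 1)

-- A relation mod 2 among the columns lets an even column be produced by
-- determinant-preserving operations, so the determinant would be even.
unimodular-basis : ∀ {n} (L : Vec (Vecℤ n) n) → Unimodular L → IsBasis (redL L)
unimodular-basis {n} L det±1 = record { independent = indep ; spanning = independent⇒spanning (redL L) indep }
  where
  odd : ∀ {D} → D ≡ + 1 ⊎ D ≡ - (+ 1) → par (res D) ≡ true
  odd (inj₁ refl) = refl
  odd (inj₂ refl) = refl
  indep′ : ∀ {n} (L : Vec (Vecℤ n) n) → Unimodular L → ∀ c → IsZero (lc c (redL L)) → ∀ j → c j ≢ true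
  indep′ {suc n} L det±1 c z j e with bring-to-front L c j e
  ... | x , L′ , r , f with halve x (λ _ → + 0) (λ i → trans (f i) (z i))
  ...   | w , g = contradiction (trans (sym (odd (parity-of (↝-alternating detL-alternating r [])))) even) λ ()
    where
    parity-of : detL (toList (x ∷ L′)) ≡± detL (toList L) → detL (toList (x ∷ L′)) ≡ + 1 ⊎ detL (toList (x ∷ L′)) ≡ - (+ 1)
    parity-of s = ≡±-trans s det±1
    twice : ∀ d → d + + 1 * d ≡ d * + 2
    twice = solve-∀
    doubled : ∀ i → x i ≡ (w ⊞ + 1 · w) i
    doubled i = trans (g i) (double (w i))
      where
      double : ∀ a → + 0 + + 2 * a ≡ a + + 1 * a
      double = solve-∀
    even : par (res (detL (toList (x ∷ L′)))) ≡ false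
    even = trans (cong (par ∘ res) (trans (Alternating.cong-at detL-alternating [] (toList L′) doubled)
      (trans (Alternating.linear-at detL-alternating [] w (+ 1) w (toList L′)) (twice (detL (w ∷ toList L′))))))
      (trans (cong par (res-* (detL (w ∷ toList L′)) (+ 2))) (trans (par-*₄ (res (detL (w ∷ toList L′))) k2) (Boolₚ.∧-zeroʳ _)))
  indep : ∀ c → IsZero (lc c (redL L)) → ∀ j → c j ≡ false
  indep c z j = ≢true⇒≡false (indep′ L det±1 c z j)

-- Normal forms as lists of mutually orthogonal blocks

-- The columns of P are the new basis vectors, so finding a normal form is prescribing a Gram
-- matrix.
congruence-entry : ∀ {n} (A P : Mat n) i j →
  ((P ᵀ) · A · P) i j ≡ ⟨ A ⟩ (λ k → P k i) (λ k → P k j)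
congruence-entry A P i j = trans (∑-cong λ k → sym (∑-*ʳ (λ l → P l i * A l k) (P k j)))
  (∑-swap (λ k l → P l i * A l k * P k j))

module _ {n : ℕ} (A : Mat n) where

  abstract
    -- Opaque, so that pairings are never unfolded into double sums; from here on only bilinearity,
    -- symmetry and evenness are visible.
    γ : Vecℤ n → Vecℤ n → ℤ₄
    γ v w = res (⟨ A ⟩ v w)

    γ-def : ∀ v w → γ v w ≡ res (⟨ A ⟩ v w)
    γ-def v w = refl

module _ {b : ℕ} (c : ℕ) (R : Mat b) where

  -- By definition the matrix is (B ⊕ rep c B) ⊕ R, while peeling off a block needs B ⊕ (rep c B ⊕
  -- R). The two agree entrywise once `splitAt` is resolved.
  ⊕₂-rest : ∀ B i j → (rep {2} (suc c) B ⊕ R) (suc (suc i)) (suc (suc j)) ≡ (rep c B ⊕ R) i j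
  ⊕₂-rest B i j with splitAt (c ℕ.* 2) i | splitAt (c ℕ.* 2) j
  ... | inj₁ _ | inj₁ _ = refl
  ... | inj₁ _ | inj₂ _ = refl
  ... | inj₂ _ | inj₁ _ = refl
  ... | inj₂ _ | inj₂ _ = refl

  ⊕₂-row₀ : ∀ B j → (rep {2} (suc c) B ⊕ R) zero (suc (suc j)) ≡ + 0
  ⊕₂-row₀ B j with splitAt (c ℕ.* 2) j
  ... | inj₁ _ = refl
  ... | inj₂ _ = refl

  ⊕₂-row₁ : ∀ B j → (rep {2} (suc c) B ⊕ R) (suc zero) (suc (suc j)) ≡ + 0
  ⊕₂-row₁ B j with splitAt (c ℕ.* 2) j
  ... | inj₁ _ = refl
  ... | inj₂ _ = refl

  ⊕₂-col₀ : ∀ B j → (rep {2} (suc c) B ⊕ R) (suc (suc j)) zero ≡ + 0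
  ⊕₂-col₀ B j with splitAt (c ℕ.* 2) j
  ... | inj₁ _ = refl
  ... | inj₂ _ = refl

  ⊕₂-col₁ : ∀ B j → (rep {2} (suc c) B ⊕ R) (suc (suc j)) (suc zero) ≡ + 0
  ⊕₂-col₁ B j with splitAt (c ℕ.* 2) j
  ... | inj₁ _ = refl
  ... | inj₂ _ = refl

  ⊕₁-rest : ∀ a i j → (rep (suc c) (mat1 a) ⊕ R) (suc i) (suc j) ≡ (rep c (mat1 a) ⊕ R) i j
  ⊕₁-rest a i j with splitAt (c ℕ.* 1) i | splitAt (c ℕ.* 1) j
  ... | inj₁ _ | inj₁ _ = refl
  ... | inj₁ _ | inj₂ _ = refl
  ... | inj₂ _ | inj₁ _ = refl
  ... | inj₂ _ | inj₂ _ = refl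

  ⊕₁-row₀ : ∀ a j → (rep (suc c) (mat1 a) ⊕ R) zero (suc j) ≡ + 0
  ⊕₁-row₀ a j with splitAt (c ℕ.* 1) j
  ... | inj₁ _ = refl
  ... | inj₂ _ = refl

  ⊕₁-col₀ : ∀ a j → (rep (suc c) (mat1 a) ⊕ R) (suc j) zero ≡ + 0
  ⊕₁-col₀ a j with splitAt (c ℕ.* 1) j
  ... | inj₁ _ = refl
  ... | inj₂ _ = refl

module Form {n} (A : Mat n) (A-sym : Symmetric A) (A-even : EvenDiagonal A) where

  X : Set
  X = Vecℤ n

  infix 7 _∙_
  _∙_ : X → X → ℤ₄
  _∙_ = γ A

  ∙-linearˡ : ∀ x c y z → (x ⊞ c · y) ∙ z ≡ x ∙ z +₄ res c *₄ (y ∙ z)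
  ∙-linearˡ x c y z rewrite γ-def A (x ⊞ c · y) z | γ-def A x z | γ-def A y z =
    trans (cong res (⟨⟩-linear A x c y z)) (res-linear (⟨ A ⟩ x z) c (⟨ A ⟩ y z))

  ∙-sym : ∀ x y → x ∙ y ≡ y ∙ x
  ∙-sym x y rewrite γ-def A x y | γ-def A y x = cong res (⟨⟩-sym A A-sym x y)

  ∙-linearʳ : ∀ z x c y → z ∙ (x ⊞ c · y) ≡ z ∙ x +₄ res c *₄ (z ∙ y)
  ∙-linearʳ z x c y = trans (∙-sym z (x ⊞ c · y)) (trans (∙-linearˡ x c y z)
    (cong₂ (λ a b → a +₄ res c *₄ b) (∙-sym x z) (∙-sym y z)))

  ∙-even : ∀ x → par (x ∙ x) ≡ false
  ∙-even x rewrite γ-def A x x = ⟨⟩-even A A-sym A-even x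

  ∙-cong : ∀ {v v′ w w′} → (∀ i → v i ≡ v′ i) → (∀ i → w i ≡ w′ i) → v ∙ w ≡ v′ ∙ w′
  ∙-cong {v} {v′} {w} {w′} e f rewrite γ-def A v w | γ-def A v′ w′ = cong res (⟨⟩-cong A e f)

  -- The zero vector evaluates from 0 - 0, so linearity makes the value cancel against itself.
  ∙-zeroˡ : ∀ z → (λ _ → + 0) ∙ z ≡ k0
  ∙-zeroˡ z = trans (∙-linearˡ (λ _ → + 0) -[1+ 0 ] (λ _ → + 0) z) (+₄-inverseʳ ((λ _ → + 0) ∙ z))

  Orth : ∀ {k} → X → Vec X k → Set
  Orth x L = All (λ z → x ∙ z ≡ k0) L

  Block : ℤ₄ → ℤ₄ → ℤ₄ → X → X → Set
  Block a b c x y = x ∙ x ≡ a × x ∙ y ≡ b × y ∙ y ≡ c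

  -- hcons, ucons, tcons, dcons and zcons split off a block H₂, U₁, U₂, (2) and (0).
  data Nf : (r s t p m : ℕ) → ∀ {k} → Vec X k → Set where
    nil   : Nf 0 0 0 0 0 []
    zcons : ∀ {m k x} {L : Vec X k} → x ∙ x ≡ k0 → Orth x L →
            Nf 0 0 0 0 m L → Nf 0 0 0 0 (suc m) (x ∷ L)
    dcons : ∀ {p m k x} {L : Vec X k} → x ∙ x ≡ k2 → Orth x L →
            Nf 0 0 0 p m L → Nf 0 0 0 (suc p) m (x ∷ L)
    tcons : ∀ {t p m k x y} {L : Vec X k} → Block k0 k2 k0 x y → Orth x L → Orth y L →
            Nf 0 0 t p m L → Nf 0 0 (suc t) p m (x ∷ y ∷ L)
    ucons : ∀ {s t p m k x y} {L : Vec X k} → Block k0 k1 k0 x y → Orth x L → Orth y L →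
            Nf 0 s t p m L → Nf 0 (suc s) t p m (x ∷ y ∷ L)
    hcons : ∀ {r s t p m k x y} {L : Vec X k} → Block k2 k1 k2 x y → Orth x L → Orth y L →
            Nf r s t p m L → Nf (suc r) s t p m (x ∷ y ∷ L)

  digit : ℤ₄ → ℤ
  digit g = + toℕ g

  digit-injective : ∀ {g h} → digit g ≡ digit h → g ≡ h
  digit-injective e = Finₚ.toℕ-injective (ℤₚ.+-injective e)

  HasGram : ∀ {k} → Mat k → Vec X k → Set
  HasGram M L = ∀ i j → digit (lookup L i ∙ lookup L j) ≡ M i j

  orth-row : ∀ {k x} {L : Vec X k} → Orth x L → ∀ j → digit (x ∙ lookup L j) ≡ + 0
  orth-row o j = cong digit (Allₚ.lookup⁺ o j)

  module _ {b c} (R : Mat b) {B : Mat 2} {x y : X} {L : Vec X (c ℕ.* 2 ℕ.+ b)} where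

    peel₂ : ∀ {p q s} → B zero zero ≡ digit p → B zero (suc zero) ≡ digit q → B (suc zero) (suc zero) ≡ digit s →
      HasGram (rep (suc c) B ⊕ R) (x ∷ y ∷ L) →
      Block p q s x y × Orth x L × Orth y L × HasGram (rep c B ⊕ R) L
    peel₂ e f g G =
      (digit-injective (trans (G zero zero) e) , digit-injective (trans (G zero (suc zero)) f) ,
       digit-injective (trans (G (suc zero) (suc zero)) g)) ,
      Allₚ.lookup⁻ (λ j → digit-injective (trans (G zero (suc (suc j))) (⊕₂-row₀ c R B j))) ,
      Allₚ.lookup⁻ (λ j → digit-injective (trans (G (suc zero) (suc (suc j))) (⊕₂-row₁ c R B j))) ,
      λ i j → trans (G (suc (suc i)) (suc (suc j))) (⊕₂-rest c R B i j)

    unpeel₂ : ∀ {p q s} → B zero zero ≡ digit p → B zero (suc zero) ≡ digit q →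
      B (suc zero) zero ≡ digit q → B (suc zero) (suc zero) ≡ digit s →
      Block p q s x y → Orth x L → Orth y L → HasGram (rep c B ⊕ R) L →
      HasGram (rep (suc c) B ⊕ R) (x ∷ y ∷ L)
    unpeel₂ e f f′ g (p , q , s) ox oy G zero zero = trans (cong digit p) (sym e)
    unpeel₂ e f f′ g (p , q , s) ox oy G zero (suc zero) = trans (cong digit q) (sym f)
    unpeel₂ e f f′ g (p , q , s) ox oy G zero (suc (suc j)) = trans (orth-row ox j) (sym (⊕₂-row₀ c R B j))
    unpeel₂ e f f′ g (p , q , s) ox oy G (suc zero) zero = trans (cong digit (trans (∙-sym y x) q)) (sym f′)
    unpeel₂ e f f′ g (p , q , s) ox oy G (suc zero) (suc zero) = trans (cong digit s) (sym g)
    unpeel₂ e f f′ g (p , q , s) ox oy G (suc zero) (suc (suc j)) = trans (orth-row oy j) (sym (⊕₂-row₁ c R B j))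
    unpeel₂ e f f′ g (p , q , s) ox oy G (suc (suc i)) zero =
      trans (cong digit (∙-sym (lookup L i) x)) (trans (orth-row ox i) (sym (⊕₂-col₀ c R B i)))
    unpeel₂ e f f′ g (p , q , s) ox oy G (suc (suc i)) (suc zero) =
      trans (cong digit (∙-sym (lookup L i) y)) (trans (orth-row oy i) (sym (⊕₂-col₁ c R B i)))
    unpeel₂ e f f′ g (p , q , s) ox oy G (suc (suc i)) (suc (suc j)) = trans (G i j) (sym (⊕₂-rest c R B i j))

  gram⇒Nf : ∀ r s t p m (L : Vec X (nfSize r s t p m)) → HasGram (N r s t p m) L → Nf r s t p m L
  gram⇒Nf (suc r) s t p m (x ∷ y ∷ L) G with peel₂ {c = r} (rep s U₁ ⊕ (rep t U₂ ⊕ (rep p (mat1 (+ 2)) ⊕ rep m (mat1 (+ 0))))) {H₂} refl refl refl G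
  ... | B , ox , oy , G′ = hcons B ox oy (gram⇒Nf r s t p m L G′)
  gram⇒Nf zero (suc s) t p m (x ∷ y ∷ L) G with peel₂ {c = s} (rep t U₂ ⊕ (rep p (mat1 (+ 2)) ⊕ rep m (mat1 (+ 0)))) {U₁} refl refl refl G
  ... | B , ox , oy , G′ = ucons B ox oy (gram⇒Nf zero s t p m L G′)
  gram⇒Nf zero zero (suc t) p m (x ∷ y ∷ L) G with peel₂ {c = t} (rep p (mat1 (+ 2)) ⊕ rep m (mat1 (+ 0))) {U₂} refl refl refl G
  ... | B , ox , oy , G′ = tcons B ox oy (gram⇒Nf zero zero t p m L G′)
  gram⇒Nf zero zero zero (suc p) m (x ∷ L) G = dcons (digit-injective (G zero zero))
    (Allₚ.lookup⁻ λ j → digit-injective (trans (G zero (suc j)) (⊕₁-row₀ p (rep m (mat1 (+ 0))) (+ 2) j)))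
    (gram⇒Nf zero zero zero p m L λ i j → trans (G (suc i) (suc j)) (⊕₁-rest p (rep m (mat1 (+ 0))) (+ 2) i j))
  gram⇒Nf zero zero zero zero (suc m) (x ∷ L) G = zcons (digit-injective (G zero zero))
    (Allₚ.lookup⁻ λ j → digit-injective (G zero (suc j)))
    (gram⇒Nf zero zero zero zero m L λ i j → G (suc i) (suc j))
  gram⇒Nf zero zero zero zero zero [] G = nil

  Nf⇒gram : ∀ r s t p m (L : Vec X (nfSize r s t p m)) → Nf r s t p m L → HasGram (N r s t p m) L
  Nf⇒gram (suc r) s t p m (x ∷ y ∷ L) (hcons B ox oy F) =
    unpeel₂ {c = r} (rep s U₁ ⊕ (rep t U₂ ⊕ (rep p (mat1 (+ 2)) ⊕ rep m (mat1 (+ 0))))) {H₂}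
      refl refl refl refl B ox oy (Nf⇒gram r s t p m L F)
  Nf⇒gram zero (suc s) t p m (x ∷ y ∷ L) (ucons B ox oy F) =
    unpeel₂ {c = s} (rep t U₂ ⊕ (rep p (mat1 (+ 2)) ⊕ rep m (mat1 (+ 0)))) {U₁}
      refl refl refl refl B ox oy (Nf⇒gram zero s t p m L F)
  Nf⇒gram zero zero (suc t) p m (x ∷ y ∷ L) (tcons B ox oy F) =
    unpeel₂ {c = t} (rep p (mat1 (+ 2)) ⊕ rep m (mat1 (+ 0))) {U₂}
      refl refl refl refl B ox oy (Nf⇒gram zero zero t p m L F)
  Nf⇒gram zero zero zero (suc p) m (x ∷ L) (dcons e o F) = λ
    { zero    zero    → cong digit e
    ; zero    (suc j) → trans (orth-row o j) (sym (⊕₁-row₀ p (rep m (mat1 (+ 0))) (+ 2) j))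
    ; (suc i) zero    → trans (cong digit (∙-sym (lookup L i) x))
                          (trans (orth-row o i) (sym (⊕₁-col₀ p (rep m (mat1 (+ 0))) (+ 2) i)))
    ; (suc i) (suc j) → trans (Nf⇒gram zero zero zero p m L F i j) (sym (⊕₁-rest p (rep m (mat1 (+ 0))) (+ 2) i j)) }
  Nf⇒gram zero zero zero zero (suc m) (x ∷ L) (zcons e o F) = λ
    { zero    zero    → cong digit e
    ; zero    (suc j) → orth-row o j
    ; (suc i) zero    → trans (cong digit (∙-sym (lookup L i) x)) (orth-row o i)
    ; (suc i) (suc j) → Nf⇒gram zero zero zero zero m L F i j }
  Nf⇒gram zero zero zero zero zero [] nil ()

  Nf-size : ∀ {r s t p m k} {L : Vec X k} → Nf r s t p m L → nfSize r s t p m ≡ k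
  Nf-size nil              = refl
  Nf-size (zcons _ _ F)    = cong suc (Nf-size F)
  Nf-size (dcons _ _ F)    = cong suc (Nf-size F)
  Nf-size (tcons _ _ _ F)  = cong (2 ℕ.+_) (Nf-size F)
  Nf-size (ucons _ _ _ F)  = cong (2 ℕ.+_) (Nf-size F)
  Nf-size (hcons _ _ _ F)  = cong (2 ℕ.+_) (Nf-size F)

  entry-digit : ∀ P i j →
    + (((P ᵀ) · A · P) i j %ℕ 4) ≡ digit ((λ k → P k i) ∙ (λ k → P k j))
  entry-digit P i j = cong +_ (trans (toℕ-res (((P ᵀ) · A · P) i j)) (cong toℕ (trans
    (cong res (congruence-entry A P i j)) (sym (γ-def A (λ k → P k i) (λ k → P k j))))))

  Nf⇒IsNormalForm : ∀ {r s t p m} (L : Vec X n) →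
    det (λ i j → lookup L j i) ≡ + 1 ⊎ det (λ i j → lookup L j i) ≡ - (+ 1) →
    Nf r s t p m L → IsNormalForm A r s t p m
  Nf⇒IsNormalForm {r} {s} {t} {p} {m} L d F = Nf-size F , (λ i j → lookup L j i) , d ,
    λ i j → trans (entry-digit (λ a b → lookup L b a) i j) (transport (Nf-size F) L F i j)
    where
    -- The length is generalised from n to k so that the size equation can be matched with `refl`.
    transport : ∀ {k} (eq : nfSize r s t p m ≡ k) (L : Vec X k) → Nf r s t p m L →
      ∀ i j → digit (lookup L i ∙ lookup L j) ≡ N r s t p m (cast (sym eq) i) (cast (sym eq) j)
    transport refl L F i j rewrite Finₚ.cast-is-id refl i | Finₚ.cast-is-id refl j =
      Nf⇒gram r s t p m L F i j

  IsNormalForm⇒Nf : ∀ {r s t p m} → IsNormalForm A r s t p m →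
    Σ (Vec X n) λ L → Unimodular L × Nf r s t p m L
  IsNormalForm⇒Nf {r} {s} {t} {p} {m} (eq , P , d , G) = L , unimod , transport eq L gram
    where
    L : Vec X n
    L = Vec.tabulate λ j i → P i j
    unimod : Unimodular L
    unimod = subst (λ D → D ≡ + 1 ⊎ D ≡ - (+ 1))
      (trans (det≡detL P) (cong detL (sym (toList-tabulate (λ j i → P i j))))) d
    gram : ∀ i j → digit (lookup L i ∙ lookup L j) ≡ N r s t p m (cast (sym eq) i) (cast (sym eq) j)
    gram i j = trans (cong digit (cong₂ _∙_ (Vecₚ.lookup∘tabulate (λ j i → P i j) i) (Vecₚ.lookup∘tabulate (λ j i → P i j) j)))
      (trans (sym (entry-digit P i j)) (G i j))
    transport : ∀ {k} (eq : nfSize r s t p m ≡ k) (L : Vec X k) →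
      (∀ i j → digit (lookup L i ∙ lookup L j) ≡ N r s t p m (cast (sym eq) i) (cast (sym eq) j)) →
      Nf r s t p m L
    transport refl L g = gram⇒Nf r s t p m L λ i j →
      trans (g i j) (cong₂ (N r s t p m) (Finₚ.cast-is-id refl i) (Finₚ.cast-is-id refl j))

-- Reduction to a minimal normal form

identity₂ : ∀ (f g : ℤ₄ → ℤ₄ → ℤ₄) →
  {True (Finₚ.all? λ x → Finₚ.all? λ y → f x y Finₚ.≟ g x y)} → ∀ x y → f x y ≡ g x y
identity₂ f g {t} = toWitness t

-- Coefficients making z + αx + βy orthogonal to x and y when (x,x), (x,y), (y,y) are p, q, s
-- and g = (x,z), h = (y,z).
record Clears (I : ℤ₄ → Set) (p q s : ℤ₄) : Set where
  field
    α β    : ℤ₄ → ℤ₄ → ℤ₄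
    first  : ∀ {g h} → I g → I h → (g +₄ α g h *₄ p) +₄ β g h *₄ q ≡ k0
    second : ∀ {g h} → I g → I h → (h +₄ α g h *₄ q) +₄ β g h *₄ s ≡ k0

IsEven : ℤ₄ → Set
IsEven g = par g ≡ false

clears-U : Clears (λ _ → ⊤) k0 k1 k0
clears-U = record
  { α      = λ g h → neg₄ h
  ; β      = λ g h → neg₄ g
  ; first  = λ {g} {h} _ _ → identity₂ (λ g h → (g +₄ neg₄ h *₄ k0) +₄ neg₄ g *₄ k1) (λ _ _ → k0) g h
  ; second = λ {g} {h} _ _ → identity₂ (λ g h → (h +₄ neg₄ h *₄ k1) +₄ neg₄ g *₄ k0) (λ _ _ → k0) g h
  }

-- The matrix of the block is its own inverse mod 4.
clears-H : Clears (λ _ → ⊤) k2 k1 k2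
clears-H = record
  { α      = λ g h → neg₄ (k2 *₄ g +₄ h)
  ; β      = λ g h → neg₄ (g +₄ k2 *₄ h)
  ; first  = λ {g} {h} _ _ → identity₂
      (λ g h → (g +₄ neg₄ (k2 *₄ g +₄ h) *₄ k2) +₄ neg₄ (g +₄ k2 *₄ h) *₄ k1) (λ _ _ → k0) g h
  ; second = λ {g} {h} _ _ → identity₂
      (λ g h → (h +₄ neg₄ (k2 *₄ g +₄ h) *₄ k1) +₄ neg₄ (g +₄ k2 *₄ h) *₄ k2) (λ _ _ → k0) g h
  }

-- U₂ is divisible by 2, so only even pairings can be cleared, and the coefficient is half the
-- pairing.
clears-T : Clears IsEven k0 k2 k0
clears-T = record { α = λ _ h → halved h ; β = λ g _ → halved g ; first = first ; second = second }
  where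
  halved : ℤ₄ → ℤ₄
  halved g = if half g then k1 else k0
  first : ∀ {g h} → IsEven g → IsEven h → (g +₄ halved h *₄ k0) +₄ halved g *₄ k2 ≡ k0
  first {k0} {k0} _ _ = refl
  first {k0} {k2} _ _ = refl
  first {k2} {k0} _ _ = refl
  first {k2} {k2} _ _ = refl
  first {k1} () _
  first {k3} () _
  first {k0} {k1} _ ()
  first {k0} {k3} _ ()
  first {k2} {k1} _ ()
  first {k2} {k3} _ ()
  second : ∀ {g h} → IsEven g → IsEven h → (h +₄ halved h *₄ k2) +₄ halved g *₄ k0 ≡ k0
  second {k0} {k0} _ _ = refl
  second {k0} {k2} _ _ = refl
  second {k2} {k0} _ _ = refl
  second {k2} {k2} _ _ = refl
  second {k1} () _
  second {k3} () _
  second {k0} {k1} _ ()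
  second {k0} {k3} _ ()
  second {k2} {k1} _ ()
  second {k2} {k3} _ ()

res-digit : ∀ g → res (+ toℕ g) ≡ g
res-digit k0 = refl
res-digit k1 = refl
res-digit k2 = refl
res-digit k3 = refl

module Reduction {n} (A : Mat n) (A-sym : Symmetric A) (A-even : EvenDiagonal A) where

  open Form A A-sym A-even

  -- Reflected integer combinations: pairings of new basis vectors are evaluated from the Gram
  -- matrix of the old ones, which turns each block isomorphism below into a computation.
  data Lin (k : ℕ) : Set where
    var     : Fin k → Lin k
    _⊞ₗ_·_ : Lin k → ℤ → Lin k → Lin k

  infix 6 _⊞ₗ_·_

  ⟦_⟧ : ∀ {k} → Lin k → Vec X k → X
  ⟦ var i ⟧      E = lookup E i
  ⟦ a ⊞ₗ c · b ⟧ E = ⟦ a ⟧ E ⊞ c · ⟦ b ⟧ E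

  value : ∀ {k} → Mat k → Lin k → Lin k → ℤ₄
  value M (var i)        (var j)        = res (M i j)
  value M (var i)        (a ⊞ₗ c · b) = value M (var i) a +₄ res c *₄ value M (var i) b
  value M (a ⊞ₗ c · b) w              = value M a w +₄ res c *₄ value M b w

  value-correct : ∀ {k} {M : Mat k} {E : Vec X k} → HasGram M E →
    ∀ a b → ⟦ a ⟧ E ∙ ⟦ b ⟧ E ≡ value M a b
  value-correct {E = E} G (var i) (var j) = trans (sym (res-digit (lookup E i ∙ lookup E j))) (cong res (G i j))
  value-correct {E = E} G (var i) (a ⊞ₗ c · b) = trans (∙-linearʳ (lookup E i) (⟦ a ⟧ E) c (⟦ b ⟧ E))
    (cong₂ (λ p q → p +₄ res c *₄ q) (value-correct G (var i) a) (value-correct G (var i) b))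
  value-correct {E = E} G (a ⊞ₗ c · b) w = trans (∙-linearˡ (⟦ a ⟧ E) c (⟦ b ⟧ E) (⟦ w ⟧ E))
    (cong₂ (λ p q → p +₄ res c *₄ q) (value-correct G a w) (value-correct G b w))

  orth-⊞ : ∀ {k x y} {L : Vec X k} c → Orth x L → Orth y L → Orth (x ⊞ c · y) L
  orth-⊞ c []       []       = []
  orth-⊞ {x = x} {y} {z ∷ _} c (p ∷ ps) (q ∷ qs) =
    trans (∙-linearˡ x c y z) (trans (cong₂ (λ a b → a +₄ res c *₄ b) p q) (*₄-zeroʳ (res c))) ∷ orth-⊞ c ps qs

  orth-Lin : ∀ {j k} {E : Vec X j} {L : Vec X k} → All (λ x → Orth x L) E → ∀ a → Orth (⟦ a ⟧ E) L
  orth-Lin os (var i)        = Allₚ.lookup⁺ os i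
  orth-Lin os (a ⊞ₗ c · b) = orth-⊞ c (orth-Lin os a) (orth-Lin os b)

  -- Orthogonality and evenness both say that pairings lie in an ideal of `ℤ₄`, so a single
  -- induction carries them along `↝`.
  record IsIdeal (I : ℤ₄ → Set) : Set where
    field closed : ∀ {a b} c → I a → I b → I (a +₄ c *₄ b)
  open IsIdeal

  zero-ideal : IsIdeal (_≡ k0)
  closed zero-ideal c refl refl = *₄-zeroʳ c

  even-ideal : IsIdeal IsEven
  closed even-ideal {a} {b} c e f = trans (par-+₄ a (c *₄ b)) (trans (cong₂ _xor_ e (par-*₄ c b))
    (trans (cong (par c ∧_) f) (Boolₚ.∧-zeroʳ (par c))))

  ↝-ideal : ∀ {I} → IsIdeal I → ∀ {x k} {L L′ : Vec X k} → L ↝ L′ →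
    All (λ z → I (x ∙ z)) L → All (λ z → I (x ∙ z)) L′
  ↝-ideal i swap (p ∷ q ∷ ps) = q ∷ p ∷ ps
  ↝-ideal {I} i {x} (add {x = y} {z} c) (p ∷ q ∷ ps) = subst I (sym (∙-linearʳ x y c z)) (closed i (res c) p q) ∷ q ∷ ps
  ↝-ideal {I} i {x} (neg {x = y}) (p ∷ ps) = subst I (sym (∙-linearʳ x y -[1+ 1 ] y)) (closed i k2 p p) ∷ ps
  ↝-ideal i (cons r) (p ∷ ps) = p ∷ ↝-ideal i r ps
  ↝-ideal i done     ps       = ps
  ↝-ideal i (r ⨾ s)  ps       = ↝-ideal i s (↝-ideal i r ps)

  orth-↝ : ∀ {x k} {L L′ : Vec X k} → L ↝ L′ → Orth x L → Orth x L′
  orth-↝ = ↝-ideal zero-ideal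

  Even : ∀ {k} → X → Vec X k → Set
  Even x L = All (λ z → IsEven (x ∙ z)) L

  -- Only pairs in list order are recorded: symmetry supplies the others, and squares are always
  -- even.
  AllEven : ∀ {k} → Vec X k → Set
  AllEven []      = ⊤

  AllEven (x ∷ L) = Even x L × AllEven L

  allEven-↝ : ∀ {k} {L L′ : Vec X k} → L ↝ L′ → AllEven L → AllEven L′
  allEven-↝ (swap {x = x} {y}) (e ∷ es , fs , gs) = (subst IsEven (∙-sym x y) e ∷ fs) , es , gs
  allEven-↝ {L = x ∷ y ∷ L} (add c) (es , fs , gs) = combine (y ∷ L) es (∙-even y ∷ fs) , fs , gs
    where
    combine : ∀ {k} (L : Vec X k) → Even x L → Even y L → Even (x ⊞ c · y) L
    combine []      []       []       = []
    combine (z ∷ L) (p ∷ ps) (q ∷ qs) =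
      subst IsEven (sym (∙-linearˡ x c y z)) (closed even-ideal (res c) p q) ∷ combine L ps qs
  allEven-↝ {L = x ∷ L} neg (es , fs) = combine L es , fs
    where
    combine : ∀ {k} (L : Vec X k) → Even x L → Even (x ⊞ -[1+ 1 ] · x) L
    combine []      []       = []
    combine (z ∷ L) (p ∷ ps) = subst IsEven (sym (∙-linearˡ x -[1+ 1 ] x z)) (closed even-ideal k2 p p) ∷ combine L ps
  allEven-↝ (cons r) (es , fs) = ↝-ideal even-ideal r es , allEven-↝ r fs
  allEven-↝ done     es        = es
  allEven-↝ (r ⨾ s)  es        = allEven-↝ s (allEven-↝ r es)

  rot₁ : ∀ {k x u v} {L : Vec X k} → x ∷ u ∷ v ∷ L ↝ u ∷ v ∷ x ∷ L
  rot₁ = swap ⨾ cons swap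

  rot₁⁻ : ∀ {k x u v} {L : Vec X k} → u ∷ v ∷ x ∷ L ↝ x ∷ u ∷ v ∷ L
  rot₁⁻ = cons swap ⨾ swap

  rot₂ : ∀ {k x y u v} {L : Vec X k} → x ∷ y ∷ u ∷ v ∷ L ↝ u ∷ v ∷ x ∷ y ∷ L
  rot₂ = cons rot₁ ⨾ rot₁

  add₂ : ∀ {k x y} {L : Vec X k} c → x ∷ y ∷ L ↝ x ∷ (y ⊞ c · x) ∷ L
  add₂ c = swap ⨾ add c ⨾ swap

  clear₂ : ∀ {I p q s x y} → Clears I p q s → Block p q s x y →
    ∀ {k} (L : Vec X k) → All (λ z → I (x ∙ z)) L → All (λ z → I (y ∙ z)) L →
    Σ (Vec X k) λ L′ → (x ∷ y ∷ L ↝ x ∷ y ∷ L′) × Orth x L′ × Orth y L′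
  clear₂ C B [] [] [] = [] , done , [] , []
  clear₂ {x = x} {y} C B@(refl , refl , refl) (z ∷ L) (e ∷ es) (f ∷ fs) with clear₂ C B L es fs
  ... | L′ , r , ox , oy = z″ ∷ L′ ,
    -- z comes to the front, receives its multiples of x and y, and returns behind them once the
    -- tail is cleared.
    (rot₁⁻ ⨾ add a ⨾ cons swap ⨾ add b ⨾ cons swap ⨾ cons r ⨾ rot₁) ,
    trans (expand₂ x) (Clears.first C e f) ∷ ox ,
    trans (expand₂ y) (trans (cong (λ w → (y ∙ z +₄ α *₄ w) +₄ β *₄ (y ∙ y)) (∙-sym y x)) (Clears.second C e f)) ∷ oy
    where
    α = Clears.α C (x ∙ z) (y ∙ z)
    β = Clears.β C (x ∙ z) (y ∙ z)
    a = + toℕ α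
    b = + toℕ β
    z′ = z ⊞ a · x
    z″ = z′ ⊞ b · y
    expand₂ : ∀ w → w ∙ z″ ≡ (w ∙ z +₄ α *₄ (w ∙ x)) +₄ β *₄ (w ∙ y)
    expand₂ w = trans (∙-linearʳ w z′ b y) (cong₂ (λ p c → p +₄ c *₄ (w ∙ y))
      (trans (∙-linearʳ w z a x) (cong (λ c → w ∙ z +₄ c *₄ (w ∙ x)) (res-digit α))) (res-digit β))

  clear₁ : ∀ {x} → x ∙ x ≡ k2 → ∀ {k} (L : Vec X k) → Even x L →
    Σ (Vec X k) λ L′ → (x ∷ L ↝ x ∷ L′) × Orth x L′
  clear₁ e [] [] = [] , done , []
  clear₁ {x} e (z ∷ L) (f ∷ fs) with clear₁ e L fs
  ... | L′ , r , o = z ⊞ c · x ∷ L′ , (swap ⨾ add c ⨾ cons r ⨾ swap) , trans (∙-linearʳ x z c x) zero-product ∷ o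
    where
    -- An even pairing is 0 or 2; in the second case adding x, of square 2, cancels it.
    c = bit (half (x ∙ z))
    lemma : ∀ g → IsEven g → g +₄ res (bit (half g)) *₄ k2 ≡ k0
    lemma k0 _ = refl
    lemma k2 _ = refl
    lemma k1 ()
    lemma k3 ()
    zero-product : x ∙ z +₄ res c *₄ (x ∙ x) ≡ k0
    zero-product rewrite e = lemma (x ∙ z) f

  data Search (P : X → Set) : ∀ {k} → Vec X k → Set where
    none  : ∀ {k} {L : Vec X k} → All (¬_ ∘ P) L → Search P L
    found : ∀ {k} {L : Vec X (suc k)} z L′ → L ↝ z ∷ L′ → P z → Search P L

  search : ∀ {P} → (∀ x → Dec (P x)) → ∀ {k} (L : Vec X k) → Search P L
  search P? []      = none []
  search P? (x ∷ L) with P? x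
  ... | yes p = found x L done p
  ... | no ¬p with search P? L
  ...   | none ps         = none (¬p ∷ ps)
  ...   | found z L′ r p = found z (x ∷ L′) (cons r ⨾ swap) p

  -- The indices of `Nf` fix the order of the blocks, so a new vector or plane has to be carried
  -- past the blocks that must precede it. The other insertions work in the same way.
  insert-Z : ∀ {t p m k x} {L : Vec X k} → x ∙ x ≡ k0 → Orth x L → Nf 0 0 t p m L →
    ∃[ L′ ] (x ∷ L ↝ L′) × Nf 0 0 t p (suc m) L′
  insert-Z e o nil           = _ , done , zcons e o nil
  insert-Z e o (zcons f q F) = _ , done , zcons e o (zcons f q F)
  insert-Z {x = x} e (a ∷ o) (dcons {x = y} f q F) with insert-Z e o F
  ... | L′ , r , F′ = y ∷ L′ , (swap ⨾ cons r) , dcons f (orth-↝ r (trans (∙-sym y x) a ∷ q)) F′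
  insert-Z {x = x} e (a ∷ b ∷ o) (tcons {x = y} {z} B oy oz F) with insert-Z e o F
  ... | L′ , r , F′ = y ∷ z ∷ L′ , (rot₁ ⨾ cons (cons r)) ,
    tcons B (orth-↝ r (trans (∙-sym y x) a ∷ oy)) (orth-↝ r (trans (∙-sym z x) b ∷ oz)) F′

  insert-D : ∀ {t p m k x} {L : Vec X k} → x ∙ x ≡ k2 → Orth x L → Nf 0 0 t p m L →
    ∃[ L′ ] (x ∷ L ↝ L′) × Nf 0 0 t (suc p) m L′
  insert-D e o nil           = _ , done , dcons e o nil
  insert-D e o (zcons f q F) = _ , done , dcons e o (zcons f q F)
  insert-D e o (dcons f q F) = _ , done , dcons e o (dcons f q F)
  insert-D {x = x} e (a ∷ b ∷ o) (tcons {x = y} {z} B oy oz F) with insert-D e o F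
  ... | L′ , r , F′ = y ∷ z ∷ L′ , (rot₁ ⨾ cons (cons r)) ,
    tcons B (orth-↝ r (trans (∙-sym y x) a ∷ oy)) (orth-↝ r (trans (∙-sym z x) b ∷ oz)) F′

  insert-U : ∀ {r s t p m k x y} {L : Vec X k} → Block k0 k1 k0 x y → Orth x L → Orth y L → Nf r s t p m L →
    ∃[ L′ ] (x ∷ y ∷ L ↝ L′) × Nf r (suc s) t p m L′
  insert-U {x = x} {y} B (a ∷ b ∷ ox) (c ∷ d ∷ oy) (hcons {x = u} {v} B′ ou ov F) with insert-U B ox oy F
  ... | L′ , r , F′ = u ∷ v ∷ L′ , (rot₂ ⨾ cons (cons r)) ,
    hcons B′ (orth-↝ r (trans (∙-sym u x) a ∷ trans (∙-sym u y) c ∷ ou))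
             (orth-↝ r (trans (∙-sym v x) b ∷ trans (∙-sym v y) d ∷ ov)) F′
  insert-U B ox oy F@nil             = _ , done , ucons B ox oy F
  insert-U B ox oy F@(zcons _ _ _)   = _ , done , ucons B ox oy F
  insert-U B ox oy F@(dcons _ _ _)   = _ , done , ucons B ox oy F
  insert-U B ox oy F@(tcons _ _ _ _) = _ , done , ucons B ox oy F
  insert-U B ox oy F@(ucons _ _ _ _) = _ , done , ucons B ox oy F

  -- 3(2) ≅ U₂ ⊕ (2), with basis x + y, y + z, x + y + z.
  DDD⇒TD : ∀ {t m k} {L : Vec X k} → Nf 0 0 t 3 m L → ∃[ L′ ] (L ↝ L′) × Nf 0 0 (suc t) 1 m L′
  DDD⇒TD (tcons {x = x} {y} B ox oy F) with DDD⇒TD F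
  ... | L′ , r , F′ = x ∷ y ∷ L′ , cons (cons r) , tcons B (orth-↝ r ox) (orth-↝ r oy) F′
  DDD⇒TD (dcons {x = x} e (a ∷ b ∷ o) (dcons {x = y} f (c ∷ q) (dcons {x = z} {L = L} g q′ F))) =
    ⟦ u ⟧ E ∷ ⟦ v ⟧ E ∷ ⟦ w ⟧ E ∷ L ,
    (add (+ 1) ⨾ cons (add (+ 1)) ⨾ cons swap ⨾ add₂ (+ 1) ⨾ cons swap) ,
    tcons (val u u , val u v , val v v)
      (val u w ∷ orth u) (val v w ∷ orth v)
      (dcons (val w w) (orth w) F)
    where
    E = x ∷ y ∷ z ∷ []
    val = value-correct {M = N 0 0 0 3 0} {E} (Nf⇒gram 0 0 0 3 0 E (dcons e (a ∷ b ∷ []) (dcons f (c ∷ []) (dcons g [] nil))))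
    orth = orth-Lin {E = E} {L} (o ∷ q ∷ q′ ∷ [])
    u v w : Lin 3
    u = var zero ⊞ₗ + 1 · var (suc zero)
    v = var (suc zero) ⊞ₗ + 1 · var (suc (suc zero))
    w = var (suc (suc zero)) ⊞ₗ + 1 · u

  -- Adding d, of square 2, makes x and y isotropic with pairing 1 + 2 = 3; negating the second
  -- vector turns 3 into 1. `d′` is d corrected to be orthogonal to the new plane, and its square is
  -- still 2. Blocks standing before d are passed by carrying the plane behind them and back.
  HD⇒UD : ∀ {s t p m k x y} {L : Vec X k} → Block k2 k1 k2 x y → Orth x L → Orth y L → Nf 0 s t (suc p) m L →
    ∃[ x′ ] ∃[ y′ ] ∃[ L′ ] (x ∷ y ∷ L ↝ x′ ∷ y′ ∷ L′) × Block k0 k1 k0 x′ y′ ×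
      Orth x′ L′ × Orth y′ L′ × Nf 0 s t (suc p) m L′
  HD⇒UD {x = x} {y} (a , b , c) (i ∷ ox) (j ∷ oy) (dcons {x = d} {L} e o F) =
    ⟦ x′ ⟧ E , ⟦ y′ ⟧ E , ⟦ d′ ⟧ E ∷ L ,
    (cons swap ⨾ add (+ 1) ⨾ cons swap ⨾ cons (add (+ 1)) ⨾ cons neg ⨾ cons (add₂ (+ 2)) ⨾ cons swap
      ⨾ add₂ (+ 2) ⨾ cons swap) ,
    (val x′ x′ , val x′ y′ , val y′ y′) ,
    val x′ d′ ∷ orth x′ , val y′ d′ ∷ orth y′ ,
    dcons (val d′ d′) (orth d′) F
    where
    E = x ∷ y ∷ d ∷ []
    val = value-correct {M = N 1 0 0 1 0} {E} (Nf⇒gram 1 0 0 1 0 E (hcons (a , b , c) (i ∷ []) (j ∷ []) (dcons e [] nil)))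
    orth = orth-Lin {E = E} {L} (ox ∷ oy ∷ o ∷ [])
    x′ y₁ y′ d′ : Lin 3
    x′ = var zero ⊞ₗ + 1 · var (suc (suc zero))
    y₁ = var (suc zero) ⊞ₗ + 1 · var (suc (suc zero))
    y′ = y₁ ⊞ₗ -[1+ 1 ] · y₁
    d′ = (var (suc (suc zero)) ⊞ₗ + 2 · y′) ⊞ₗ + 2 · x′
  HD⇒UD {x = x} {y} B (i ∷ j ∷ ox) (k ∷ l ∷ oy) (tcons {x = u} {v} C ou ov F) with HD⇒UD B ox oy F
  ... | x′ , y′ , L′ , r , B′ , ox′ , oy′ , F′
    with orth-↝ r (trans (∙-sym u x) i ∷ trans (∙-sym u y) k ∷ ou) | orth-↝ r (trans (∙-sym v x) j ∷ trans (∙-sym v y) l ∷ ov)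
  ...   | i′ ∷ k′ ∷ ou′ | j′ ∷ l′ ∷ ov′ = x′ , y′ , u ∷ v ∷ L′ , (rot₂ ⨾ cons (cons r) ⨾ rot₂) , B′ ,
    trans (∙-sym x′ u) i′ ∷ trans (∙-sym x′ v) j′ ∷ ox′ , trans (∙-sym y′ u) k′ ∷ trans (∙-sym y′ v) l′ ∷ oy′ ,
    tcons C ou′ ov′ F′
  HD⇒UD {x = x} {y} B (i ∷ j ∷ ox) (k ∷ l ∷ oy) (ucons {x = u} {v} C ou ov F) with HD⇒UD B ox oy F
  ... | x′ , y′ , L′ , r , B′ , ox′ , oy′ , F′
    with orth-↝ r (trans (∙-sym u x) i ∷ trans (∙-sym u y) k ∷ ou) | orth-↝ r (trans (∙-sym v x) j ∷ trans (∙-sym v y) l ∷ ov)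
  ...   | i′ ∷ k′ ∷ ou′ | j′ ∷ l′ ∷ ov′ = x′ , y′ , u ∷ v ∷ L′ , (rot₂ ⨾ cons (cons r) ⨾ rot₂) , B′ ,
    trans (∙-sym x′ u) i′ ∷ trans (∙-sym x′ v) j′ ∷ ox′ , trans (∙-sym y′ u) k′ ∷ trans (∙-sym y′ v) l′ ∷ oy′ ,
    ucons C ou′ ov′ F′

  -- 2 H₂ ≅ 2 U₁: x + u and y + x + u span a copy of U₁, and the rest is its complement.
  HH⇒UU : ∀ {s t p m k} {L : Vec X k} → Nf 2 s t p m L → ∃[ L′ ] (L ↝ L′) × Nf 0 (suc (suc s)) t p m L′
  HH⇒UU (hcons {x = x} {y} B (a ∷ b ∷ ox) (c ∷ d ∷ oy) (hcons {x = u} {v} {L} C ou ov F)) =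
    ⟦ x′ ⟧ E ∷ ⟦ y′ ⟧ E ∷ ⟦ v′ ⟧ E ∷ ⟦ u′ ⟧ E ∷ L ,
    (cons swap ⨾ add (+ 1) ⨾ cons swap ⨾ add₂ (+ 1) ⨾ cons (cons (add (+ 1)))
      ⨾ cons swap ⨾ add₂ (+ 1) ⨾ cons swap ⨾ cons (add₂ (+ 1))
      ⨾ cons (cons swap) ⨾ cons swap ⨾ add₂ -[1+ 0 ] ⨾ cons swap ⨾ cons (add₂ -[1+ 0 ])) ,
    ucons (val x′ x′ , val x′ y′ , val y′ y′)
      (val x′ v′ ∷ val x′ u′ ∷ orth x′)
      (val y′ v′ ∷ val y′ u′ ∷ orth y′)
      (ucons (val v′ v′ , val v′ u′ , val u′ u′)
        (orth v′) (orth u′) F)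
    where
    E = x ∷ y ∷ u ∷ v ∷ []
    val = value-correct {M = N 2 0 0 0 0} {E} (Nf⇒gram 2 0 0 0 0 E (hcons B (a ∷ b ∷ []) (c ∷ d ∷ []) (hcons C [] [] nil)))
    orth = orth-Lin {E = E} {L} (ox ∷ oy ∷ ou ∷ ov ∷ [])
    x′ y′ u′ v′ : Lin 4
    x′ = var zero ⊞ₗ + 1 · var (suc (suc zero))
    y′ = var (suc zero) ⊞ₗ + 1 · x′
    u′ = ((var (suc (suc zero)) ⊞ₗ + 1 · var (suc (suc (suc zero)))) ⊞ₗ + 1 · x′) ⊞ₗ + 1 · y′
    v′ = (var (suc (suc (suc zero))) ⊞ₗ -[1+ 0 ] · x′) ⊞ₗ -[1+ 0 ] · y′

  block-gram : ∀ {p q s x y} → Block p q s x y →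
    HasGram (mat2 (digit p) (digit q) (digit q) (digit s)) (x ∷ y ∷ [])
  block-gram (a , b , c) zero       zero       = cong digit a
  block-gram (a , b , c) zero       (suc zero) = cong digit b
  block-gram {x = x} {y} (a , b , c) (suc zero) zero = cong digit (trans (∙-sym y x) b)
  block-gram (a , b , c) (suc zero) (suc zero) = cong digit c

  OddBlock : X → X → Set
  OddBlock x y = Block k0 k1 k0 x y ⊎ Block k2 k1 k2 x y

  -- Negating y turns a pairing 3 into 1. If the squares are then 2 and 0, the sum of the two
  -- vectors has square 2 + 2 = 0 and can replace the one of square 2, which gives U₁.
  odd-block : ∀ x y → par (x ∙ y) ≡ true → ∀ {k} (L : Vec X k) →
    ∃[ x′ ] ∃[ y′ ] (x ∷ y ∷ L ↝ x′ ∷ y′ ∷ L) × OddBlock x′ y′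
  odd-block x y odd L = go (x ∙ x) (x ∙ y) (y ∙ y) (refl , refl , refl) (∙-even x) odd (∙-even y)
    where
    one : ∀ y p s → Block p k1 s x y → IsEven p → IsEven s →
      ∃[ x′ ] ∃[ y′ ] (x ∷ y ∷ L ↝ x′ ∷ y′ ∷ L) × OddBlock x′ y′
    one y k0 k0 B _ _ = x , y , done , inj₁ B
    one y k2 k2 B _ _ = x , y , done , inj₂ B
    one y k2 k0 B _ _ = ⟦ x′ ⟧ E , y , add (+ 1) ,
      inj₁ (val x′ x′ , val x′ (var (suc zero)) , val (var (suc zero)) (var (suc zero)))
      where
      E = x ∷ y ∷ []
      val = value-correct {M = mat2 (+ 2) (+ 1) (+ 1) (+ 0)} {E} (block-gram B)
      x′ : Lin 2
      x′ = var zero ⊞ₗ + 1 · var (suc zero)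
    one y k0 k2 B _ _ = x , ⟦ y′ ⟧ E , add₂ (+ 1) ,
      inj₁ (val (var zero) (var zero) , val (var zero) y′ , val y′ y′)
      where
      E = x ∷ y ∷ []
      val = value-correct {M = mat2 (+ 0) (+ 1) (+ 1) (+ 2)} {E} (block-gram B)
      y′ : Lin 2
      y′ = var (suc zero) ⊞ₗ + 1 · var zero
    one y k1 _  _ () _
    one y k3 _  _ () _
    one y k0 k1 _ _ ()
    one y k0 k3 _ _ ()
    one y k2 k1 _ _ ()
    one y k2 k3 _ _ ()
    go : ∀ p q s → Block p q s x y → IsEven p → par q ≡ true → IsEven s →
      ∃[ x′ ] ∃[ y′ ] (x ∷ y ∷ L ↝ x′ ∷ y′ ∷ L) × OddBlock x′ y′
    go p k1 s B e _ f = one y p s B e f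
    go p k3 s B@(a , b , _) e _ f with one y′ p (y′ ∙ y′) (a , xy′ , refl) e (∙-even y′)
      where
      y′ = y ⊞ -[1+ 1 ] · y
      xy′ : x ∙ y′ ≡ k1
      xy′ = trans (∙-linearʳ x y -[1+ 1 ] y) (cong₂ (λ p q → p +₄ k2 *₄ q) b b)
    ... | x″ , y″ , r , B′ = x″ , y″ , (swap ⨾ neg ⨾ swap ⨾ r) , B′
    go p k0 s _ _ () _
    go p k2 s _ _ () _

  -- Descent to a minimal normal form

  data OddPair : ∀ {k} → Vec X k → Set where
    all-even : ∀ {k} {L : Vec X k} → AllEven L → OddPair L
    odd-pair : ∀ {k} {L : Vec X (suc (suc k))} x y L′ → L ↝ x ∷ y ∷ L′ → par (x ∙ y) ≡ true → OddPair L

  find-odd : ∀ {k} (L : Vec X k) → OddPair L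
  find-odd []      = all-even tt
  find-odd (x ∷ L) with search (λ z → par (x ∙ z) Boolₚ.≟ true) L
  ... | found z L′ r p = odd-pair x z L′ (cons r) p
  ... | none ps with find-odd L
  ...   | all-even es          = all-even (All.map ≢true⇒≡false ps , es)
  ...   | odd-pair y z L′ r p = odd-pair y z (x ∷ L′) (cons r ⨾ rot₁) p

  EvenNf : ∀ {k} → Vec X k → Set
  EvenNf L = ∃[ t ] ∃[ p ] ∃[ m ] ∃[ L′ ] (L ↝ L′) × Nf 0 0 t p m L′ × p ≤ 2

  -- The bound 3 is enough because blocks (2) arrive one at a time at a form that has at most two.
  reduce-D : ∀ {t p m k} {L L′ : Vec X k} → L ↝ L′ → Nf 0 0 t p m L′ → p ≤ 3 → EvenNf L
  reduce-D r F z≤n                         = _ , _ , _ , _ , r , F , z≤n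
  reduce-D r F (s≤s z≤n)                   = _ , _ , _ , _ , r , F , s≤s z≤n
  reduce-D r F (s≤s (s≤s z≤n))             = _ , _ , _ , _ , r , F , s≤s (s≤s z≤n)
  reduce-D r F (s≤s (s≤s (s≤s z≤n))) with DDD⇒TD F
  ... | _ , r′ , F′ = _ , _ , _ , _ , (r ⨾ r′) , F′ , s≤s z≤n

  split-D : ∀ {k} → (∀ (L : Vec X k) → AllEven L → EvenNf L) →
    ∀ x (L : Vec X k) → x ∙ x ≡ k2 → AllEven (x ∷ L) → EvenNf (x ∷ L)
  split-D rec x L e (f , es) with clear₁ e L f
  ... | L₁ , r₁ , o₁ with rec L₁ (proj₂ (allEven-↝ r₁ (f , es)))
  ...   | t , p , m , L₂ , r₂ , F , p≤2 with insert-D e (orth-↝ r₂ o₁) F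
  ...     | L₃ , r₃ , F′ = reduce-D (r₁ ⨾ cons r₂ ⨾ r₃) F′ (s≤s p≤2)

  -- A head x of square 2 splits off as (2). An isotropic x orthogonal to the rest is a block (0);
  -- otherwise it pairs to 2 with some z, which either has square 2 and splits off itself, or spans
  -- U₂ with x. The last case removes two vectors, hence the course-of-values recursion.
  even-Nf-step : ∀ k → (∀ {j} → j < k → (L : Vec X j) → AllEven L → EvenNf L) →
    (L : Vec X k) → AllEven L → EvenNf L
  even-Nf-step zero    rec [] _ = _ , _ , _ , _ , done , nil , z≤n
  even-Nf-step (suc k) rec (x ∷ L) (f , es) = go (x ∙ x) refl (∙-even x)
    where
    even-nonzero : ∀ {g} → IsEven g → ¬ (g ≡ k2) → g ≡ k0
    even-nonzero {k0} _ _ = refl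
    even-nonzero {k2} _ n = ⊥-elim (n refl)
    even-nonzero {k1} ()
    even-nonzero {k3} ()
    isotropic : x ∙ x ≡ k0 → Search (λ z → x ∙ z ≡ k2) L → EvenNf (x ∷ L)
    isotropic e (none ps) with rec ℕₚ.≤-refl L es
    ... | t , p , m , L₁ , r₁ , F , p≤2
      with insert-Z e (orth-↝ r₁ (All.map (λ (a , b) → even-nonzero a b) (All.zip (f , ps)))) F
    ...   | L₂ , r₂ , F′ = t , p , suc m , L₂ , (cons r₁ ⨾ r₂) , F′ , p≤2
    isotropic e (found {k′} z L₁ r xz) = second (z ∙ z) refl (∙-even z)
      where
      L₁-even = allEven-↝ (cons r) (f , es)
      second : ∀ g → z ∙ z ≡ g → IsEven g → EvenNf (x ∷ L)
      second k2 zz _ with split-D (rec ℕₚ.≤-refl) z (x ∷ L₁) zz (allEven-↝ (cons r ⨾ swap) (f , es))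
      ... | t , p , m , L₂ , r₂ , F , p≤2 = t , p , m , L₂ , (cons r ⨾ swap ⨾ r₂) , F , p≤2
      second k0 zz _ with L₁-even
      ... | (_ ∷ fx) , fz , es₁ with clear₂ clears-T (e , xz , zz) L₁ fx fz
      ...   | L₂ , r₂ , ox , oz with rec (ℕₚ.n≤1+n _) L₂ (proj₂ (proj₂ (allEven-↝ r₂ L₁-even)))
      ...     | t , p , m , L₃ , r₃ , F , p≤2 = suc t , p , m , x ∷ z ∷ L₃ , (cons r ⨾ r₂ ⨾ cons (cons r₃)) ,
                tcons (e , xz , zz) (orth-↝ r₃ ox) (orth-↝ r₃ oz) F , p≤2
      second k1 _ ()
      second k3 _ ()
    go : ∀ g → x ∙ x ≡ g → IsEven g → EvenNf (x ∷ L)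
    go k0 e _ = isotropic e (search (λ z → x ∙ z Finₚ.≟ k2) L)
    go k2 e _ = split-D (rec ℕₚ.≤-refl) x L e (f , es)
    go k1 _ ()
    go k3 _ ()

  even-Nf : ∀ k (L : Vec X k) → AllEven L → EvenNf L
  even-Nf = <-rec (λ k → (L : Vec X k) → AllEven L → EvenNf L) even-Nf-step

  -- `p≡0⊎r≡0` lets one construction serve both cases of (b): `r≤1` is what the vanishing case asks
  -- for, and in the other case p is non-zero, which forces r = 0.
  record Minimal {k} (L : Vec X k) : Set where
    constructor minimal
    field
      {r s t p m} : ℕ
      {result}    : Vec X k
      reduction   : L ↝ result
      normal      : Nf r s t p m result
      r≤1         : r ≤ 1
      p≤2         : p ≤ 2
      p≡0⊎r≡0     : p ≡ 0 ⊎ r ≡ 0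

  -- A new H₂ survives only if it meets neither another H₂, with which it becomes two U₁, nor a
  -- block (2), which converts it into U₁.
  insert-H : ∀ {k x y} {L₀ : Vec X (suc (suc k))} {L : Vec X k} → L₀ ↝ x ∷ y ∷ L → Block k2 k1 k2 x y →
    Orth x L → Orth y L → ∀ {r s t p m} → Nf r s t p m L → r ≤ 1 → p ≤ 2 → p ≡ 0 ⊎ r ≡ 0 → Minimal L₀
  insert-H q B ox oy {p = zero} F z≤n p≤2 _ = minimal q (hcons B ox oy F) (s≤s z≤n) p≤2 (inj₁ refl)
  insert-H q B ox oy {p = p} F (s≤s z≤n) p≤2 (inj₁ p≡0) with HH⇒UU (hcons B ox oy F)
  ... | _ , q′ , F′ = minimal (q ⨾ q′) F′ z≤n p≤2 (inj₂ refl)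
  insert-H q B ox oy {p = suc p} F z≤n p≤2 _ with HD⇒UD B ox oy F
  ... | x′ , y′ , L′ , q′ , B′ , ox′ , oy′ , F′ = minimal (q ⨾ q′) (ucons B′ ox′ oy′ F′) z≤n p≤2 (inj₂ refl)

  -- An odd pair spans a plane that is unimodular mod 4, so the remaining vectors can be made
  -- orthogonal to it; the descent stops when all pairings are even.
  minimal-Nf : ∀ k (L : Vec X k) → Minimal L
  minimal-Nf k L with find-odd L
  ... | all-even es with even-Nf k L es
  ...   | t , p , m , L′ , r , F , p≤2 = minimal r F z≤n p≤2 (inj₂ refl)
  minimal-Nf (suc (suc k)) L | odd-pair x y L₁ q odd with odd-block x y odd L₁
  ... | x′ , y′ , q₁ , inj₁ B with clear₂ clears-U B L₁ (All.universal (λ _ → tt) L₁) (All.universal (λ _ → tt) L₁)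
  ...   | L₂ , q₂ , ox , oy with minimal-Nf k L₂
  ...     | minimal q₃ F r≤1 p≤2 d with insert-U B (orth-↝ q₃ ox) (orth-↝ q₃ oy) F
  ...       | _ , q₄ , F′ = minimal (q ⨾ q₁ ⨾ q₂ ⨾ cons (cons q₃) ⨾ q₄) F′ r≤1 p≤2 d
  minimal-Nf (suc (suc k)) L | odd-pair x y L₁ q odd
      | x′ , y′ , q₁ , inj₂ B with clear₂ clears-H B L₁ (All.universal (λ _ → tt) L₁) (All.universal (λ _ → tt) L₁)
  ...   | L₂ , q₂ , ox , oy with minimal-Nf k L₂
  ...     | minimal q₃ F r≤1 p≤2 d = insert-H (q ⨾ q₁ ⨾ q₂ ⨾ cons (cons q₃)) B (orth-↝ q₃ ox) (orth-↝ q₃ oy) F r≤1 p≤2 d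

  exists-minimal : ∃[ r ] ∃[ s ] ∃[ t ] ∃[ p ] ∃[ m ] IsNormalForm A r s t p m × r ≤ 1 × p ≤ 2 × (p ≡ 0 ⊎ r ≡ 0)
  exists-minimal with minimal-Nf n (Vec.tabulate std)
  ... | minimal {r} {s} {t} {p} {m} {L} q F r≤1 p≤2 d =
    r , s , t , p , m , Nf⇒IsNormalForm L (det-reduced L q) F , r≤1 , p≤2 , d

-- The spaces V̄₀ and V̄₀₀₀ in a normal basis

parity-suc : ∀ r → parity (+ suc r) ≡ true xor parity (+ r)
parity-suc r = trans (parity≡par (+ suc r)) (trans (par-+₄ k1 (resℕ r)) (cong (true xor_) (sym (parity≡par (+ r)))))

module Splitting {n} (A : Mat n) (A-sym : Symmetric A) (A-even : EvenDiagonal A) where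

  open Form A A-sym A-even

  -- E and F come from the blocks H₂ and U₁, G from U₂ and (2), H from (0); G ∘ σ is the basis dual
  -- to G for the form divided by 2. ρ is the Arf sum of E, F, and p the number of blocks (2).
  record Split {k} (L : Vec X k) (a d m : ℕ) (ρ : F₂) (p : ℕ) : Set where
    field
      E F : Vec X a
      G   : Vec X d
      H   : Vec X m
      σ   : Fin d → Fin d
      EF  : ∀ i j → par (lookup E i ∙ lookup F j) ≡ δ i j
      EE  : ∀ i j → par (lookup E i ∙ lookup E j) ≡ false
      FF  : ∀ i j → par (lookup F i ∙ lookup F j) ≡ false
      EG  : ∀ i j → lookup E i ∙ lookup G j ≡ k0
      EH  : ∀ i j → lookup E i ∙ lookup H j ≡ k0
      FG  : ∀ i j → lookup F i ∙ lookup G j ≡ k0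
      FH  : ∀ i j → lookup F i ∙ lookup H j ≡ k0
      GG  : ∀ i j → par (lookup G i ∙ lookup G j) ≡ false
      GH  : ∀ i j → lookup G i ∙ lookup H j ≡ k0
      HH  : ∀ i j → lookup H i ∙ lookup H j ≡ k0
      dual : ∀ i j → half (lookup G i ∙ lookup G (σ j)) ≡ δ i j
      arf  : ∑₂ (λ i → half (lookup E i ∙ lookup E i) ∧ half (lookup F i ∙ lookup F i)) ≡ ρ
      diagonal₀ : p ≡ 0 → ∀ i → lookup G i ∙ lookup G i ≡ k0
      diagonal₁ : p ≢ 0 → ∃[ i ] lookup G i ∙ lookup G i ≡ k2
      -- Supplies the orthogonality of a newly prepended block to all vectors already sorted.
      parts : ∀ x → Orth x L → Orth x E × Orth x F × Orth x G × Orth x H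
    combine : (Fin a → F₂) → (Fin a → F₂) → (Fin d → F₂) → (Fin m → F₂) → V̄ n
    combine α β g h = lc α (redL E) +̄ (lc β (redL F) +̄ (lc g (redL G) +̄ lc h (redL H)))
    field
      decompose : ∀ c → ∃[ α ] ∃[ β ] ∃[ g ] ∃[ h ] (lc c (redL L) ≈ combine α β g h)
      -- The second component passes independence from the columns of L to the four families
      -- jointly.
      compose   : ∀ α β g h → ∃[ c ] (lc c (redL L) ≈ combine α β g h) ×
        ((∀ i → c i ≡ false) →
         (∀ i → α i ≡ false) × (∀ i → β i ≡ false) × (∀ i → g i ≡ false) × (∀ i → h i ≡ false))

  open Split

  private
    at : ∀ {k x} {L : Vec X k} → Orth x L → ∀ j → x ∙ lookup L j ≡ k0
    at = Allₚ.lookup⁺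

    at′ : ∀ {k x} {L : Vec X k} → Orth x L → ∀ j → lookup L j ∙ x ≡ k0
    at′ {x = x} {L} o j = trans (∙-sym (lookup L j) x) (at o j)

    cons-false : ∀ {k} {a : Fin (suc k) → F₂} → a zero ≡ false → (∀ i → a (suc i) ≡ false) → ∀ i → a i ≡ false
    cons-false e f zero    = e
    cons-false e f (suc i) = f i

  split-[] : Split [] 0 0 0 false 0
  split-[] = record
    { E = [] ; F = [] ; G = [] ; H = [] ; σ = λ () ; EF = λ () ; EE = λ () ; FF = λ () ; EG = λ () ; EH = λ ()
    ; FG = λ () ; FH = λ () ; GG = λ () ; GH = λ () ; HH = λ () ; dual = λ () ; arf = refl
    ; diagonal₀ = λ _ () ; diagonal₁ = λ n → ⊥-elim (n refl) ; parts = λ _ _ → [] , [] , [] , []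
    ; decompose = λ _ → (λ ()) , (λ ()) , (λ ()) , (λ ()) , λ _ → refl
    ; compose = λ _ _ _ _ → (λ ()) , (λ _ → refl) , λ _ → (λ ()) , (λ ()) , (λ ()) , (λ ())
    }

  split-Z : ∀ {a d m ρ p k x} {L : Vec X k} → x ∙ x ≡ k0 → Orth x L →
    Split L a d m ρ p → Split (x ∷ L) a d (suc m) ρ p
  split-Z {x = x} {L} e o S = record
    { E = E S ; F = F S ; G = G S ; H = x ∷ H S ; σ = σ S ; EF = EF S ; EE = EE S ; FF = FF S ; EG = EG S
    ; EH = λ { i zero → at′ oE i ; i (suc j) → EH S i j }
    ; FG = FG S
    ; FH = λ { i zero → at′ oF i ; i (suc j) → FH S i j }
    ; GG = GG S
    ; GH = λ { i zero → at′ oG i ; i (suc j) → GH S i j }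
    ; HH = λ { zero zero → e ; zero (suc j) → at oH j ; (suc i) zero → at′ oH i ; (suc i) (suc j) → HH S i j }
    ; dual = dual S ; arf = arf S
    ; diagonal₀ = diagonal₀ S ; diagonal₁ = diagonal₁ S
    ; parts = λ { y (b ∷ oy) → let (p , q , r , s) = parts S y oy in p , q , r , b ∷ s }
    ; decompose = λ c → let (α , β , g , h , eq) = decompose S (c ∘ suc) in
        α , β , g , (c zero ◂ h) , λ i → trans (cong ((c zero ∧ red x i) xor_) (eq i))
          (arrange (c zero ∧ red x i) (lc α (redL (E S)) i) (lc β (redL (F S)) i) (lc g (redL (G S)) i) _)
    ; compose = λ α β g h → let (c , eq , z) = compose S α β g (h ∘ suc) in
        (h zero ◂ c) , (λ i → trans (cong ((h zero ∧ red x i) xor_) (eq i))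
          (arrange (h zero ∧ red x i) (lc α (redL (E S)) i) (lc β (redL (F S)) i) (lc g (redL (G S)) i) _)) ,
        λ v → let (p , q , r , s) = z (v ∘ suc) in p , q , r , cons-false (v zero) s
    }
    where
    oE = proj₁ (parts S x o)
    oF = proj₁ (proj₂ (parts S x o))
    oG = proj₁ (proj₂ (proj₂ (parts S x o)))
    oH = proj₂ (proj₂ (proj₂ (parts S x o)))
    arrange : ∀ p a b c d → p xor (a xor (b xor (c xor d))) ≡ a xor (b xor (c xor (p xor d)))
    arrange = solve 5 (λ p a b c d → p :+ (a :+ (b :+ (c :+ d))) := a :+ (b :+ (c :+ (p :+ d)))) refl

  split-D : ∀ {a d m ρ p k x} {L : Vec X k} → x ∙ x ≡ k2 → Orth x L →
    Split L a d m ρ p → Split (x ∷ L) a (suc d) m ρ (suc p)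
  split-D {x = x} {L} e o S = record
    { E = E S ; F = F S ; G = x ∷ G S ; H = H S
    ; σ = λ { zero → zero ; (suc i) → suc (σ S i) } ; EF = EF S ; EE = EE S ; FF = FF S
    ; EG = λ { i zero → at′ oE i ; i (suc j) → EG S i j }
    ; EH = EH S
    ; FG = λ { i zero → at′ oF i ; i (suc j) → FG S i j }
    ; FH = FH S
    ; GG = λ { zero zero → cong par e ; zero (suc j) → cong par (at oG j)
             ; (suc i) zero → cong par (at′ oG i) ; (suc i) (suc j) → GG S i j }
    ; GH = λ { zero j → at oH j ; (suc i) j → GH S i j }
    ; HH = HH S
    ; dual = λ { zero zero → cong half e ; zero (suc j) → cong half (at oG (σ S j))
               ; (suc i) zero → cong half (at′ oG i) ; (suc i) (suc j) → dual S i j }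
    ; arf = arf S
    ; diagonal₀ = λ () ; diagonal₁ = λ _ → zero , e
    ; parts = λ { y (b ∷ oy) → let (p , q , r , s) = parts S y oy in p , q , b ∷ r , s }
    ; decompose = λ c → let (α , β , g , h , eq) = decompose S (c ∘ suc) in
        α , β , (c zero ◂ g) , h , λ i → trans (cong ((c zero ∧ red x i) xor_) (eq i))
          (arrange (c zero ∧ red x i) (lc α (redL (E S)) i) (lc β (redL (F S)) i) (lc g (redL (G S)) i) _)
    ; compose = λ α β g h → let (c , eq , z) = compose S α β (g ∘ suc) h in
        (g zero ◂ c) , (λ i → trans (cong ((g zero ∧ red x i) xor_) (eq i))
          (arrange (g zero ∧ red x i) (lc α (redL (E S)) i) (lc β (redL (F S)) i) (lc (g ∘ suc) (redL (G S)) i) _)) ,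
        λ v → let (p , q , r , s) = z (v ∘ suc) in p , q , cons-false (v zero) r , s
    }
    where
    oE = proj₁ (parts S x o)
    oF = proj₁ (proj₂ (parts S x o))
    oG = proj₁ (proj₂ (proj₂ (parts S x o)))
    oH = proj₂ (proj₂ (proj₂ (parts S x o)))
    arrange : ∀ p a b c d → p xor (a xor (b xor (c xor d))) ≡ a xor (b xor ((p xor c) xor d))
    arrange = solve 5 (λ p a b c d → p :+ (a :+ (b :+ (c :+ d))) := a :+ (b :+ ((p :+ c) :+ d))) refl

  split-T : ∀ {a d m ρ p k x y} {L : Vec X k} → Block k0 k2 k0 x y → Orth x L → Orth y L →
    Split L a d m ρ p → Split (x ∷ y ∷ L) a (suc (suc d)) m ρ p
  split-T {x = x} {y} {L} (e , f , g) o o′ S = record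
    { E = E S ; F = F S ; G = x ∷ y ∷ G S ; H = H S
    -- After division by 2 the vectors of U₂ are dual to each other, whereas the vector of a block
    -- (2) is its own dual.
    ; σ = λ { zero → suc zero ; (suc zero) → zero ; (suc (suc i)) → suc (suc (σ S i)) }
    ; EF = EF S ; EE = EE S ; FF = FF S
    ; EG = λ { i zero → at′ oE i ; i (suc zero) → at′ oE′ i ; i (suc (suc j)) → EG S i j }
    ; EH = EH S
    ; FG = λ { i zero → at′ oF i ; i (suc zero) → at′ oF′ i ; i (suc (suc j)) → FG S i j }
    ; FH = FH S
    ; GG = λ { zero zero → cong par e ; zero (suc zero) → cong par f ; zero (suc (suc j)) → cong par (at oG j)
             ; (suc zero) zero → cong par f′ ; (suc zero) (suc zero) → cong par g
             ; (suc zero) (suc (suc j)) → cong par (at oG′ j)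
             ; (suc (suc i)) zero → cong par (at′ oG i) ; (suc (suc i)) (suc zero) → cong par (at′ oG′ i)
             ; (suc (suc i)) (suc (suc j)) → GG S i j }
    ; GH = λ { zero j → at oH j ; (suc zero) j → at oH′ j ; (suc (suc i)) j → GH S i j }
    ; HH = HH S
    ; dual = λ { zero zero → cong half f ; zero (suc zero) → cong half e
               ; zero (suc (suc j)) → cong half (at oG (σ S j))
               ; (suc zero) zero → cong half g ; (suc zero) (suc zero) → cong half f′
               ; (suc zero) (suc (suc j)) → cong half (at oG′ (σ S j))
               ; (suc (suc i)) zero → cong half (at′ oG′ i) ; (suc (suc i)) (suc zero) → cong half (at′ oG i)
               ; (suc (suc i)) (suc (suc j)) → dual S i j }
    ; arf = arf S
    ; diagonal₀ = λ { z zero → e ; z (suc zero) → g ; z (suc (suc i)) → diagonal₀ S z i }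
    ; diagonal₁ = λ z → let (i , v) = diagonal₁ S z in suc (suc i) , v
    ; parts = λ { z (b ∷ b′ ∷ oz) → let (p , q , r , s) = parts S z oz in p , q , b ∷ b′ ∷ r , s }
    ; decompose = λ c → let (α , β , γ , h , eq) = decompose S (λ k → c (suc (suc k))) in
        α , β , (c zero ◂ (c (suc zero) ◂ γ)) , h , λ i →
          trans (cong (λ w → (c zero ∧ red x i) xor ((c (suc zero) ∧ red y i) xor w)) (eq i))
          (arrange (c zero ∧ red x i) (c (suc zero) ∧ red y i)
            (lc α (redL (E S)) i) (lc β (redL (F S)) i) (lc γ (redL (G S)) i) _)
    ; compose = λ α β γ h → let (c , eq , z) = compose S α β (λ k → γ (suc (suc k))) h in
        (γ zero ◂ (γ (suc zero) ◂ c)) , (λ i →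
          trans (cong (λ w → (γ zero ∧ red x i) xor ((γ (suc zero) ∧ red y i) xor w)) (eq i))
          (arrange (γ zero ∧ red x i) (γ (suc zero) ∧ red y i)
            (lc α (redL (E S)) i) (lc β (redL (F S)) i) (lc (λ k → γ (suc (suc k))) (redL (G S)) i) _)) ,
        λ v → let (p , q , r , s) = z (λ k → v (suc (suc k))) in
          p , q , cons-false (v zero) (cons-false (v (suc zero)) r) , s
    }
    where
    f′ = trans (∙-sym y x) f
    oE  = proj₁ (parts S x o)
    oE′ = proj₁ (parts S y o′)
    oF  = proj₁ (proj₂ (parts S x o))
    oF′ = proj₁ (proj₂ (parts S y o′))
    oG  = proj₁ (proj₂ (proj₂ (parts S x o)))
    oG′ = proj₁ (proj₂ (proj₂ (parts S y o′)))
    oH  = proj₂ (proj₂ (proj₂ (parts S x o)))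
    oH′ = proj₂ (proj₂ (proj₂ (parts S y o′)))
    arrange : ∀ p q a b c d → p xor (q xor (a xor (b xor (c xor d)))) ≡ a xor (b xor ((p xor (q xor c)) xor d))
    arrange = solve 6 (λ p q a b c d → p :+ (q :+ (a :+ (b :+ (c :+ d)))) := a :+ (b :+ ((p :+ (q :+ c)) :+ d))) refl

  -- H₂ and U₁ differ only in the squares u and w. Their contributions to the Arf sum are 1 and 0,
  -- so the total is the parity of r.
  split-HU : ∀ {a d m ρ p k u w x y} {L : Vec X k} → Block u k1 w x y → Orth x L → Orth y L →
    Split L a d m ρ p → Split (x ∷ y ∷ L) (suc a) d m ((half u ∧ half w) xor ρ) p
  split-HU {x = x} {y} {L} (e , f , g) o o′ S = record
    { E = x ∷ E S ; F = y ∷ F S ; G = G S ; H = H S ; σ = σ S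
    ; EF = λ { zero zero → cong par f ; zero (suc j) → cong par (at oF j)
             ; (suc i) zero → cong par (at′ oE′ i) ; (suc i) (suc j) → EF S i j }
    ; EE = λ { zero zero → ∙-even x ; zero (suc j) → cong par (at oE j)
             ; (suc i) zero → cong par (at′ oE i) ; (suc i) (suc j) → EE S i j }
    ; FF = λ { zero zero → ∙-even y ; zero (suc j) → cong par (at oF′ j)
             ; (suc i) zero → cong par (at′ oF′ i) ; (suc i) (suc j) → FF S i j }
    ; EG = λ { zero j → at oG j ; (suc i) j → EG S i j }
    ; EH = λ { zero j → at oH j ; (suc i) j → EH S i j }
    ; FG = λ { zero j → at oG′ j ; (suc i) j → FG S i j }
    ; FH = λ { zero j → at oH′ j ; (suc i) j → FH S i j }
    ; GG = GG S ; GH = GH S ; HH = HH S ; dual = dual S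
    ; arf = cong₂ _xor_ (cong₂ (λ u w → half u ∧ half w) e g) (arf S)
    ; diagonal₀ = diagonal₀ S ; diagonal₁ = diagonal₁ S
    ; parts = λ { z (b ∷ b′ ∷ oz) → let (p , q , r , s) = parts S z oz in b ∷ p , b′ ∷ q , r , s }
    ; decompose = λ c → let (α , β , γ , h , eq) = decompose S (λ k → c (suc (suc k))) in
        (c zero ◂ α) , (c (suc zero) ◂ β) , γ , h , λ i →
          trans (cong (λ w → (c zero ∧ red x i) xor ((c (suc zero) ∧ red y i) xor w)) (eq i))
          (arrange (c zero ∧ red x i) (c (suc zero) ∧ red y i) (lc α (redL (E S)) i) (lc β (redL (F S)) i) _)
    ; compose = λ α β γ h → let (c , eq , z) = compose S (α ∘ suc) (β ∘ suc) γ h in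
        (α zero ◂ (β zero ◂ c)) , (λ i →
          trans (cong (λ w → (α zero ∧ red x i) xor ((β zero ∧ red y i) xor w)) (eq i))
          (arrange (α zero ∧ red x i) (β zero ∧ red y i)
            (lc (α ∘ suc) (redL (E S)) i) (lc (β ∘ suc) (redL (F S)) i) _)) ,
        λ v → let (p , q , r , s) = z (λ k → v (suc (suc k))) in
          cons-false (v zero) p , cons-false (v (suc zero)) q , r , s
    }
    where
    oE  = proj₁ (parts S x o)
    oE′ = proj₁ (parts S y o′)
    oF  = proj₁ (proj₂ (parts S x o))
    oF′ = proj₁ (proj₂ (parts S y o′))
    oG  = proj₁ (proj₂ (proj₂ (parts S x o)))
    oG′ = proj₁ (proj₂ (proj₂ (parts S y o′)))
    oH  = proj₂ (proj₂ (proj₂ (parts S x o)))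
    oH′ = proj₂ (proj₂ (proj₂ (parts S y o′)))
    arrange : ∀ p q a b c → p xor (q xor (a xor (b xor c))) ≡ (p xor a) xor ((q xor b) xor c)
    arrange = solve 5 (λ p q a b c → p :+ (q :+ (a :+ (b :+ c))) := (p :+ a) :+ ((q :+ b) :+ c)) refl

  split : ∀ {r s t p m k} {L : Vec X k} → Nf r s t p m L → Split L (r ℕ.+ s) (t ℕ.* 2 ℕ.+ p) m (parity (+ r)) p
  split nil              = split-[]
  split (zcons e o N)    = split-Z e o (split N)
  split (dcons e o N)    = split-D e o (split N)
  split (tcons B o o′ N) = split-T B o o′ (split N)
  split (ucons B o o′ N) = split-HU B o o′ (split N)
  split {suc r} {s} {t} {p} {m} {L = L} (hcons B o o′ N) =
    subst (λ ρ → Split L (suc r ℕ.+ s) (t ℕ.* 2 ℕ.+ p) m ρ p) (sym (parity-suc r)) (split-HU B o o′ (split N))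

-- Gauss sums of quadratic forms over F₂

⧺-suc : ∀ {X : Set} {a b} (f : Fin (suc a) → X) (g : Fin b → X) j → (f ⧺ g) (suc j) ≡ ((f ∘ suc) ⧺ g) j
⧺-suc {a = a} f g j with splitAt a j
... | inj₁ _ = refl
... | inj₂ _ = refl

⧺-↑ˡ : ∀ {X : Set} {a b} (f : Fin a → X) (g : Fin b → X) i → (f ⧺ g) (i ↑ˡ b) ≡ f i
⧺-↑ˡ {a = a} {b} f g i rewrite Finₚ.splitAt-↑ˡ a i b = refl

⧺-↑ʳ : ∀ {X : Set} {a b} (f : Fin a → X) (g : Fin b → X) j → (f ⧺ g) (a ↑ʳ j) ≡ g j
⧺-↑ʳ {a = a} {b} f g j rewrite Finₚ.splitAt-↑ʳ a b j = refl

⧺-elim : ∀ {X : Set} {a b} {P : X → Set} (f : Fin a → X) (g : Fin b → X) →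
  (∀ i → P (f i)) → (∀ j → P (g j)) → ∀ k → P ((f ⧺ g) k)
⧺-elim {a = a} f g p q k with splitAt a k
... | inj₁ i = p i
... | inj₂ j = q j

↑-elim : ∀ a {b} {P : Fin (a ℕ.+ b) → Set} → (∀ i → P (i ↑ˡ b)) → (∀ j → P (a ↑ʳ j)) → ∀ k → P k
↑-elim zero            p q k       = q k
↑-elim (suc a)         p q zero    = p zero
↑-elim (suc a) {P = P} p q (suc k) = ↑-elim a {P = P ∘ suc} (p ∘ suc) q k

lc-⧺ : ∀ {n a b} (c : Fin (a ℕ.+ b) → F₂) (f : Fin a → V̄ n) (g : Fin b → V̄ n) →
  lc c (f ⧺ g) ≈ (lc (λ i → c (i ↑ˡ b)) f +̄ lc (λ j → c (a ↑ʳ j)) g)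
lc-⧺ {a = zero}  c f g i = refl
lc-⧺ {a = suc a} {b} c f g i = trans
  (cong ((c zero ∧ f zero i) xor_) (trans (lc-cong {c = c ∘ suc} (λ _ → refl) (λ k a → cong (λ h → h a) (⧺-suc f g k)) i)
    (lc-⧺ (c ∘ suc) (f ∘ suc) g i)))
  (sym (Boolₚ.xor-assoc (c zero ∧ f zero i) _ _))

δ-↑ˡ : ∀ {a} b (i j : Fin a) → δ (i ↑ˡ b) (j ↑ˡ b) ≡ δ i j
δ-↑ˡ b zero    zero    = refl
δ-↑ˡ b zero    (suc j) = refl
δ-↑ˡ b (suc i) zero    = refl
δ-↑ˡ b (suc i) (suc j) = δ-↑ˡ b i j

δ-↑ʳ : ∀ a {b} (i j : Fin b) → δ (a ↑ʳ i) (a ↑ʳ j) ≡ δ i j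
δ-↑ʳ zero    i j = refl
δ-↑ʳ (suc a) i j = δ-↑ʳ a i j

δ-↑ˡʳ : ∀ {a b} (i : Fin a) (j : Fin b) → δ (i ↑ˡ b) (a ↑ʳ j) ≡ false
δ-↑ˡʳ zero    j = refl
δ-↑ˡʳ (suc i) j = δ-↑ˡʳ i j

δ-sym : ∀ {k} (i j : Fin k) → δ i j ≡ δ j i
δ-sym zero    zero    = refl
δ-sym zero    (suc j) = refl
δ-sym (suc i) zero    = refl
δ-sym (suc i) (suc j) = δ-sym i j

-- Points of F₂^k are vectors and not functions, so that pointwise equal points are equal, as
-- reindexing requires.
∑ⱽ : ∀ k → (Vec Bool k → ℤ) → ℤ
∑ⱽ zero    f = f []
∑ⱽ (suc k) f = ∑ⱽ k (λ c → f (false ∷ c)) + ∑ⱽ k (λ c → f (true ∷ c))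

∑ⱽ-cong : ∀ k {f g : Vec Bool k → ℤ} → (∀ c → f c ≡ g c) → ∑ⱽ k f ≡ ∑ⱽ k g
∑ⱽ-cong zero    e = e []
∑ⱽ-cong (suc k) e = cong₂ _+_ (∑ⱽ-cong k λ c → e (false ∷ c)) (∑ⱽ-cong k λ c → e (true ∷ c))

∑ⱽ-+ : ∀ k (f g : Vec Bool k → ℤ) → ∑ⱽ k (λ c → f c + g c) ≡ ∑ⱽ k f + ∑ⱽ k g
∑ⱽ-+ zero    f g = refl
∑ⱽ-+ (suc k) f g = trans (cong₂ _+_ (∑ⱽ-+ k (λ c → f (false ∷ c)) (λ c → g (false ∷ c))) (∑ⱽ-+ k (λ c → f (true ∷ c)) (λ c → g (true ∷ c))))
  (rearrange (∑ⱽ k λ c → f (false ∷ c)) (∑ⱽ k λ c → g (false ∷ c)) (∑ⱽ k λ c → f (true ∷ c)) (∑ⱽ k λ c → g (true ∷ c)))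
  where
  rearrange : ∀ a b c d → (a + b) + (c + d) ≡ (a + c) + (b + d)
  rearrange = solve-∀

∑ⱽ-*ˡ : ∀ k a (f : Vec Bool k → ℤ) → ∑ⱽ k (λ c → a * f c) ≡ a * ∑ⱽ k f
∑ⱽ-*ˡ zero    a f = refl
∑ⱽ-*ˡ (suc k) a f = trans (cong₂ _+_ (∑ⱽ-*ˡ k a (λ c → f (false ∷ c))) (∑ⱽ-*ˡ k a (λ c → f (true ∷ c))))
  (sym (ℤₚ.*-distribˡ-+ a _ _))

∑ⱽ-swap : ∀ k l (f : Vec Bool k → Vec Bool l → ℤ) →
  ∑ⱽ k (λ c → ∑ⱽ l (f c)) ≡ ∑ⱽ l (λ d → ∑ⱽ k λ c → f c d)
∑ⱽ-swap zero    l f = refl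
∑ⱽ-swap (suc k) l f = trans (cong₂ _+_ (∑ⱽ-swap k l (λ c → f (false ∷ c))) (∑ⱽ-swap k l (λ c → f (true ∷ c))))
  (sym (∑ⱽ-+ l _ _))

∑ⱽ-++ : ∀ k l (f : Vec Bool (k ℕ.+ l) → ℤ) → ∑ⱽ (k ℕ.+ l) f ≡ ∑ⱽ k (λ c → ∑ⱽ l (λ d → f (c Vec.++ d)))
∑ⱽ-++ zero    l f = refl
∑ⱽ-++ (suc k) l f = cong₂ _+_ (∑ⱽ-++ k l (λ c → f (false ∷ c))) (∑ⱽ-++ k l (λ c → f (true ∷ c)))

eqᵇ : ∀ {k} → Vec Bool k → Vec Bool k → Bool
eqᵇ []      []      = true
eqᵇ (a ∷ x) (b ∷ y) = (not (a xor b)) ∧ eqᵇ x y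

eqᵇ⇒≡ : ∀ {k} (x y : Vec Bool k) → eqᵇ x y ≡ true → x ≡ y
eqᵇ⇒≡ []          []          _ = refl
eqᵇ⇒≡ (false ∷ x) (false ∷ y) e = cong (false ∷_) (eqᵇ⇒≡ x y e)
eqᵇ⇒≡ (true ∷ x)  (true ∷ y)  e = cong (true ∷_) (eqᵇ⇒≡ x y e)
eqᵇ⇒≡ (false ∷ x) (true ∷ y)  ()
eqᵇ⇒≡ (true ∷ x)  (false ∷ y) ()

eqᵇ-refl : ∀ {k} (x : Vec Bool k) → eqᵇ x x ≡ true
eqᵇ-refl []          = refl
eqᵇ-refl (false ∷ x) = eqᵇ-refl x
eqᵇ-refl (true ∷ x)  = eqᵇ-refl x

∑ⱽ-select : ∀ k (x : Vec Bool k) (f : Vec Bool k → ℤ) → ∑ⱽ k (λ y → bit (eqᵇ x y) * f y) ≡ f x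
∑ⱽ-select zero    []          f = ℤₚ.*-identityˡ (f [])
∑ⱽ-select (suc k) (false ∷ x) f = trans (cong₂ _+_ (∑ⱽ-select k x (λ y → f (false ∷ y))) (∑ⱽ-*ˡ k (+ 0) (λ y → f (true ∷ y))))
  (drop (f (false ∷ x)) (∑ⱽ k λ y → f (true ∷ y)))
  where
  drop : ∀ a b → a + + 0 * b ≡ a
  drop = solve-∀
∑ⱽ-select (suc k) (true ∷ x)  f = trans (cong₂ _+_ (∑ⱽ-*ˡ k (+ 0) (λ y → f (false ∷ y))) (∑ⱽ-select k x (λ y → f (true ∷ y))))
  (drop (f (true ∷ x)) (∑ⱽ k λ y → f (false ∷ y)))
  where
  drop : ∀ a b → + 0 * b + a ≡ a
  drop = solve-∀

-- Each value is expanded against the indicator of φ x = y, which is also the indicator of ψ y = x;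
-- exchanging the two sums does the rest.
∑ⱽ-reindex : ∀ k (φ ψ : Vec Bool k → Vec Bool k) → (∀ x → ψ (φ x) ≡ x) → (∀ y → φ (ψ y) ≡ y) →
  ∀ f → ∑ⱽ k (f ∘ φ) ≡ ∑ⱽ k f
∑ⱽ-reindex k φ ψ ψφ φψ f = begin
  ∑ⱽ k (λ x → f (φ x))                               ≡⟨ ∑ⱽ-cong k (λ x → ∑ⱽ-select k (φ x) f) ⟨
  ∑ⱽ k (λ x → ∑ⱽ k λ y → bit (eqᵇ (φ x) y) * f y)    ≡⟨ ∑ⱽ-swap k k (λ x y → bit (eqᵇ (φ x) y) * f y) ⟩
  ∑ⱽ k (λ y → ∑ⱽ k λ x → bit (eqᵇ (φ x) y) * f y)    ≡⟨ ∑ⱽ-cong k (λ y → ∑ⱽ-cong k λ x → cong (λ b → bit b * f y) (adjoint x y)) ⟩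
  ∑ⱽ k (λ y → ∑ⱽ k λ x → bit (eqᵇ (ψ y) x) * f y)    ≡⟨ ∑ⱽ-cong k (λ y → ∑ⱽ-select k (ψ y) (λ _ → f y)) ⟩
  ∑ⱽ k f                                             ∎
  where
  open ≡-Reasoning
  adjoint : ∀ x y → eqᵇ (φ x) y ≡ eqᵇ (ψ y) x
  adjoint x y with eqᵇ (φ x) y in e | eqᵇ (ψ y) x in e′
  ... | true  | true  = refl
  ... | false | false = refl
  ... | true  | false with eqᵇ⇒≡ (φ x) y e
  ...   | refl = contradiction (trans (sym (eqᵇ-refl x)) (trans (cong (λ z → eqᵇ z x) (sym (ψφ x))) e′)) λ ()
  adjoint x y | false | true with eqᵇ⇒≡ (ψ y) x e′
  ...   | refl = contradiction (trans (sym (eqᵇ-refl y)) (trans (cong (λ z → eqᵇ z y) (sym (φψ y))) e)) λ ()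

sg : F₂ → ℤ
sg false = + 1
sg true  = -[1+ 0 ]

sg-xor : ∀ a b → sg (a xor b) ≡ sg a * sg b
sg-xor false b     = sym (ℤₚ.*-identityˡ (sg b))
sg-xor true  false = refl
sg-xor true  true  = refl

-- The value of a quadratic form with q(eᵢ) = uᵢ, q(fᵢ) = vᵢ at ∑ αᵢeᵢ + βᵢfᵢ.
hyperbolic : ∀ {a} → (u v : Fin a → F₂) → (α β : Fin a → F₂) → F₂
hyperbolic u v α β = ∑₂ λ i → ((α i ∧ u i) xor (β i ∧ v i)) xor (α i ∧ β i)

-- The sum is a product over hyperbolic planes. On one plane the values are 0, u, v and u + v + 1,
-- and their signs add up to 2 or -2 according to uv.
gauss-sum : ∀ a (u v : Fin a → F₂) →
  ∑ⱽ a (λ α → ∑ⱽ a λ β → sg (hyperbolic u v (lookup α) (lookup β))) ≡ + (2 ℕ.^ a) * sg (∑₂ λ i → u i ∧ v i)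
gauss-sum zero    u v = refl
gauss-sum (suc a) u v = begin
  ∑ⱽ a (λ α → ∑ⱽ a (S false false α) + ∑ⱽ a (S false true α)) + ∑ⱽ a (λ α → ∑ⱽ a (S true false α) + ∑ⱽ a (S true true α))
    ≡⟨ cong₂ _+_ (trans (∑ⱽ-+ a (λ α → ∑ⱽ a (S false false α)) (λ α → ∑ⱽ a (S false true α))) (cong₂ _+_ (factor false false) (factor false true)))
                 (trans (∑ⱽ-+ a (λ α → ∑ⱽ a (S true false α)) (λ α → ∑ⱽ a (S true true α))) (cong₂ _+_ (factor true false) (factor true true))) ⟩
  (sg (h false false) * R + sg (h false true) * R) + (sg (h true false) * R + sg (h true true) * R)
    ≡⟨ collect (sg (h false false)) (sg (h false true)) (sg (h true false)) (sg (h true true)) R ⟩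
  (sg (h false false) + sg (h false true) + sg (h true false) + sg (h true true)) * R
    ≡⟨ cong₂ _*_ (plane (u zero) (v zero)) (gauss-sum a (u ∘ suc) (v ∘ suc)) ⟩
  (+ 2 * sg (u zero ∧ v zero)) * (+ (2 ℕ.^ a) * sg rest)
    ≡⟨ regroup (sg (u zero ∧ v zero)) (+ (2 ℕ.^ a)) (sg rest) ⟩
  (+ 2 * + (2 ℕ.^ a)) * (sg (u zero ∧ v zero) * sg rest)
    ≡⟨ cong₂ _*_ (sym (ℤₚ.pos-* 2 (2 ℕ.^ a))) (sym (sg-xor (u zero ∧ v zero) rest)) ⟩
  + (2 ℕ.^ suc a) * sg ((u zero ∧ v zero) xor rest)
    ∎
  where
  open ≡-Reasoning
  rest = ∑₂ λ i → u (suc i) ∧ v (suc i)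
  h : Bool → Bool → F₂
  h x y = ((x ∧ u zero) xor (y ∧ v zero)) xor (x ∧ y)
  H : Vec Bool a → Vec Bool a → F₂
  H α β = hyperbolic (u ∘ suc) (v ∘ suc) (lookup α) (lookup β)
  S : Bool → Bool → Vec Bool a → Vec Bool a → ℤ
  S x y α β = sg (h x y xor H α β)
  R = ∑ⱽ a (λ α → ∑ⱽ a λ β → sg (H α β))
  factor : ∀ x y → ∑ⱽ a (λ α → ∑ⱽ a (S x y α)) ≡ sg (h x y) * R
  factor x y = trans (∑ⱽ-cong a λ α → trans (∑ⱽ-cong a λ β → sg-xor (h x y) (H α β)) (∑ⱽ-*ˡ a (sg (h x y)) (λ β → sg (H α β))))
    (∑ⱽ-*ˡ a (sg (h x y)) (λ α → ∑ⱽ a λ β → sg (H α β)))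
  collect : ∀ a b c d r → (a * r + b * r) + (c * r + d * r) ≡ (a + b + c + d) * r
  collect = solve-∀
  regroup : ∀ a b c → (+ 2 * a) * (b * c) ≡ (+ 2 * b) * (a * c)
  regroup = solve-∀
  plane : ∀ u v → let h = λ x y → ((x ∧ u) xor (y ∧ v)) xor (x ∧ y) in
    sg (h false false) + sg (h false true) + sg (h true false) + sg (h true true) ≡ + 2 * sg (u ∧ v)
  plane false false = refl
  plane false true  = refl
  plane true  false = refl
  plane true  true  = refl

-- Quadratic forms over F₂

record IsQuadratic {n} (q : V̄ n → F₂) (Ω : V̄ n → V̄ n → F₂) : Set where
  field
    q-cong : ∀ {x y} → x ≈ y → q x ≡ q y
    q-zero : q 0̄ ≡ false
    Ω-cong : ∀ {x x′ y y′} → x ≈ x′ → y ≈ y′ → Ω x y ≡ Ω x′ y′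
    Ω-+    : ∀ x y z → Ω (x +̄ y) z ≡ Ω x z xor Ω y z
    Ω-sym  : ∀ x y → Ω x y ≡ Ω y x
    polar  : ∀ x y → q (x +̄ y) ≡ (q x xor q y) xor Ω x y

  Ω-zero : ∀ y → Ω 0̄ y ≡ false
  Ω-zero y = trans (Ω-+ 0̄ 0̄ y) (Boolₚ.xor-same (Ω 0̄ y))

  Ω-scale : ∀ b x y → Ω (λ i → b ∧ x i) y ≡ b ∧ Ω x y
  Ω-scale false x y = Ω-zero y
  Ω-scale true  x y = refl

  q-scale : ∀ b x → q (λ i → b ∧ x i) ≡ b ∧ q x
  q-scale false x = q-zero
  q-scale true  x = refl

  Ω-lc : ∀ {k} (c : Fin k → F₂) y z → Ω (lc c y) z ≡ ∑₂ (λ k → c k ∧ Ω (y k) z)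
  Ω-lc {zero}  c y z = Ω-zero z
  Ω-lc {suc k} c y z = trans (Ω-+ (λ i → c zero ∧ y zero i) (lc (c ∘ suc) (y ∘ suc)) z)
    (cong₂ _xor_ (Ω-scale (c zero) (y zero) z) (Ω-lc (c ∘ suc) (y ∘ suc) z))

  Radical : V̄ n → Set
  Radical x = ∀ y → Ω x y ≡ false

  -- x is (x + y) + y, and the radical summand contributes neither a value of q nor a pairing.
  q-mod-radical : (∀ x → Radical x → q x ≡ false) → ∀ x y → Radical (x +̄ y) → q x ≡ q y
  q-mod-radical vanish x y rad = begin
    q x                                            ≡⟨ q-cong (λ i → sym (trans (cong (x i xor_) (Boolₚ.xor-same (y i))) (Boolₚ.xor-identityʳ (x i)))) ⟩
    q (x +̄ (y +̄ y))                                ≡⟨ q-cong (λ i → sym (Boolₚ.xor-assoc (x i) (y i) (y i))) ⟩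
    q ((x +̄ y) +̄ y)                                ≡⟨ polar (x +̄ y) y ⟩
    ((q (x +̄ y) xor q y) xor Ω (x +̄ y) y)          ≡⟨ cong₂ (λ a b → (a xor q y) xor b) (vanish (x +̄ y) rad) (rad y) ⟩
    (q y xor false)                                ≡⟨ Boolₚ.xor-identityʳ (q y) ⟩
    q y                                            ∎
    where open ≡-Reasoning

  module _ {a} (e f : Fin a → V̄ n) where

    Hyperbolic : Set
    Hyperbolic = (∀ i j → Ω (e i) (f j) ≡ δ i j) × (∀ i j → Ω (e i) (e j) ≡ false) × (∀ i j → Ω (f i) (f j) ≡ false)

  -- The first plane is orthogonal to the others, so its value splits off and the rest is the
  -- induction hypothesis.
  hyperbolic-value : ∀ {a} (e f : Fin a → V̄ n) → Hyperbolic e f → ∀ α β →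
    q (lc α e +̄ lc β f) ≡ hyperbolic (q ∘ e) (q ∘ f) α β
  hyperbolic-value {zero}  e f _ α β = q-zero
  hyperbolic-value {suc a} e f (ef , ee , ff) α β = begin
    q ((x +̄ X) +̄ (y +̄ Y))
      ≡⟨ q-cong (λ i → solve 4 (λ x X y Y → (x :+ X) :+ (y :+ Y) := (x :+ y) :+ (X :+ Y)) refl (x i) (X i) (y i) (Y i)) ⟩
    q ((x +̄ y) +̄ (X +̄ Y))
      ≡⟨ polar (x +̄ y) (X +̄ Y) ⟩
    ((q (x +̄ y) xor q (X +̄ Y)) xor Ω (x +̄ y) (X +̄ Y))
      ≡⟨ cong ((q (x +̄ y) xor q (X +̄ Y)) xor_) orthogonal ⟩
    ((q (x +̄ y) xor q (X +̄ Y)) xor false)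
      ≡⟨ Boolₚ.xor-identityʳ _ ⟩
    (q (x +̄ y) xor q (X +̄ Y))
      ≡⟨ cong₂ _xor_ plane (hyperbolic-value (e ∘ suc) (f ∘ suc)
           ((λ i j → ef (suc i) (suc j)) , (λ i j → ee (suc i) (suc j)) , (λ i j → ff (suc i) (suc j))) (α ∘ suc) (β ∘ suc)) ⟩
    hyperbolic (q ∘ e) (q ∘ f) α β ∎
    where
    open ≡-Reasoning
    x y X Y : V̄ n
    x i = α zero ∧ e zero i
    y i = β zero ∧ f zero i
    X = lc (α ∘ suc) (e ∘ suc)
    Y = lc (β ∘ suc) (f ∘ suc)
    fe : ∀ i j → Ω (f i) (e j) ≡ δ j i
    fe i j = trans (Ω-sym (f i) (e j)) (ef j i)
    against : ∀ z → Ω (e zero) z ≡ false → Ω (f zero) z ≡ false → Ω z (x +̄ y) ≡ false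
    against z p r = trans (Ω-sym z (x +̄ y)) (trans (Ω-+ x y z) (cong₂ _xor_
      (trans (Ω-scale (α zero) (e zero) z) (trans (cong (α zero ∧_) p) (Boolₚ.∧-zeroʳ (α zero))))
      (trans (Ω-scale (β zero) (f zero) z) (trans (cong (β zero ∧_) r) (Boolₚ.∧-zeroʳ (β zero))))))
    vanish : ∀ {k} (c : Fin k → F₂) (b : Fin k → V̄ n) → (∀ i → Ω (b i) (x +̄ y) ≡ false) → Ω (lc c b) (x +̄ y) ≡ false
    vanish c b h = trans (Ω-lc c b (x +̄ y)) (∑₂-zero λ k → trans (cong (c k ∧_) (h k)) (Boolₚ.∧-zeroʳ (c k)))
    orthogonal : Ω (x +̄ y) (X +̄ Y) ≡ false
    orthogonal = trans (Ω-sym (x +̄ y) (X +̄ Y)) (trans (Ω-+ X Y (x +̄ y)) (cong₂ _xor_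
      (vanish (α ∘ suc) (e ∘ suc) (λ i → against (e (suc i)) (ee zero (suc i)) (fe zero (suc i))))
      (vanish (β ∘ suc) (f ∘ suc) (λ i → against (f (suc i)) (ef zero (suc i)) (ff zero (suc i))))))
    plane : q (x +̄ y) ≡ ((α zero ∧ q (e zero)) xor (β zero ∧ q (f zero))) xor (α zero ∧ β zero)
    plane = trans (polar x y) (cong₂ _xor_
      (cong₂ _xor_ (q-scale (α zero) (e zero)) (q-scale (β zero) (f zero)))
      (trans (Ω-scale (α zero) (e zero) y) (cong (α zero ∧_) (trans (Ω-sym (e zero) y)
        (trans (Ω-scale (β zero) (f zero) (e zero)) (trans (cong (β zero ∧_) (fe zero zero)) (Boolₚ.∧-identityʳ (β zero))))))))

  -- Encodes a basis B of a complement of the radical without quotients: `dual` gives independence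
  -- modulo the radical, and `complete` gives spanning, since x minus its B-part pairs to 0 with
  -- `B*`.
  record DualPair {k} (B B* : Fin k → V̄ n) : Set where
    field
      dual     : ∀ i j → Ω (B i) (B* j) ≡ δ i j
      complete : ∀ x → (∀ j → Ω x (B* j) ≡ false) → Radical x

  hyperbolic-dual : ∀ {a} (e f : Fin a → V̄ n) → Hyperbolic e f → ∀ i j → Ω ((e ⧺ f) i) ((f ⧺ e) j) ≡ δ i j
  hyperbolic-dual {a} e f (ef , ee , ff) = ↑-elim a
    (λ i → ↑-elim a
      (λ j → trans (cong₂ Ω (⧺-↑ˡ e f i) (⧺-↑ˡ f e j)) (trans (ef i j) (sym (δ-↑ˡ a i j))))
      (λ j → trans (cong₂ Ω (⧺-↑ˡ e f i) (⧺-↑ʳ f e j)) (trans (ee i j) (sym (δ-↑ˡʳ i j)))))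
    (λ i → ↑-elim a
      (λ j → trans (cong₂ Ω (⧺-↑ʳ e f i) (⧺-↑ˡ f e j)) (trans (ff i j) (trans (sym (δ-↑ˡʳ j i)) (δ-sym _ (a ↑ʳ i)))))
      (λ j → trans (cong₂ Ω (⧺-↑ʳ e f i) (⧺-↑ʳ f e j)) (trans (Ω-sym (f i) (e j)) (trans (ef j i)
        (trans (δ-sym j i) (sym (δ-↑ʳ a i j)))))))

-- Two quadratic forms related by an isometry

module Comparison {n} {q q′ : V̄ n → F₂} {Ω Ω′} (Q : IsQuadratic q Ω) (Q′ : IsQuadratic {n} q′ Ω′) where

  private
    module Q  = IsQuadratic Q
    module Q′ = IsQuadratic Q′

  -- Pairing with the image of the i-th dual vector reads off the i-th coefficient.
  image-independent : (T : V̄ n → V̄ n) → (∀ x y → Ω (T x) (T y) ≡ Ω′ x y) →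
    ∀ {k} {B B* : Fin k → V̄ n} → Q′.DualPair B B* → ∀ c → Q.Radical (lc c (T ∘ B)) → ∀ i → c i ≡ false
  image-independent T iso {B = B} {B*} D c rad i = begin
    c i                                              ≡⟨ ∑₂-δ c i ⟨
    ∑₂ (λ k → c k ∧ δ k i)                           ≡⟨ ∑₂-cong (λ k → cong (c k ∧_) (trans (iso (B k) (B* i)) (Q′.DualPair.dual D k i))) ⟨
    ∑₂ (λ k → c k ∧ Ω (T (B k)) (T (B* i)))          ≡⟨ Q.Ω-lc c (T ∘ B) (T (B* i)) ⟨
    Ω (lc c (T ∘ B)) (T (B* i))                      ≡⟨ rad (T (B* i)) ⟩
    false                                            ∎
    where open ≡-Reasoning

  coordinates : ∀ {k} → (Fin k → V̄ n) → V̄ n → V̄ k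
  coordinates B* x j = Ω x (B* j)

  coordinates-lc : ∀ {k l} (B* : Fin k → V̄ n) (c : Fin l → F₂) y →
    coordinates B* (lc c y) ≈ lc c (coordinates B* ∘ y)
  coordinates-lc B* c y i = trans (Q.Ω-lc c y (B* i)) (sym (lc-∑₂ c (coordinates B* ∘ y) i))

  -- More than k image vectors have dependent coordinates, so a non-trivial combination pairs to 0
  -- with `B*` and falls into the radical. The hypothesis on T is preservation of the pairing
  -- because the lemma also serves the inverse of an isometry, for which no additivity is given.
  rank-mono : (T : V̄ n → V̄ n) → (∀ x y → Ω (T x) (T y) ≡ Ω′ x y) →
    ∀ {k l} {B B* : Fin k → V̄ n} {B′ B′* : Fin l → V̄ n} → Q.DualPair B B* → Q′.DualPair B′ B′* → l ≤ k
  rank-mono T iso {k} {l} {B* = B*} {B′} D D′ with l ℕₚ.≤? k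
  ... | yes l≤k = l≤k
  ... | no  l≰k with dependent k (ℕₚ.≰⇒> l≰k) (coordinates B* ∘ T ∘ B′)
  ...   | c , (j , nz) , z = contradiction (trans (sym nz) (image-independent T iso D′ c
            (Q.DualPair.complete D _ λ i → trans (coordinates-lc B* c (T ∘ B′) i) (z i)) j)) λ ()

  module _ (T : V̄ n → V̄ n) (T-+ : ∀ x y → T (x +̄ y) ≈ (T x +̄ T y)) (qT : ∀ x → q (T x) ≡ q′ x) where

    -- The pairing is the polarisation of the form, so it is preserved along with sums and values.
    additive-polar : ∀ x y → Ω (T x) (T y) ≡ Ω′ x y
    additive-polar x y = xor-cancelˡ (q′ x xor q′ y) (begin
      (q′ x xor q′ y) xor Ω (T x) (T y)           ≡⟨ cong₂ (λ a b → (a xor b) xor Ω (T x) (T y)) (qT x) (qT y) ⟨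
      (q (T x) xor q (T y)) xor Ω (T x) (T y)     ≡⟨ Q.polar (T x) (T y) ⟨
      q (T x +̄ T y)                               ≡⟨ Q.q-cong (λ i → sym (T-+ x y i)) ⟩
      q (T (x +̄ y))                               ≡⟨ qT (x +̄ y) ⟩
      q′ (x +̄ y)                                  ≡⟨ Q′.polar x y ⟩
      (q′ x xor q′ y) xor Ω′ x y                  ∎)
      where
      open ≡-Reasoning
      xor-cancelˡ : ∀ a {b c} → a xor b ≡ a xor c → b ≡ c
      xor-cancelˡ false e = e
      xor-cancelˡ true  e = Boolₚ.not-injective e

    -- T is not assumed to respect ≈, so its value on a combination is only
    -- controlled for a suitable representative.
    T-lc : ∀ {k} (c : Fin k → F₂) (b : Fin k → V̄ n) →
      ∃[ x ] (x ≈ lc c b) × (T x ≈ lc c (T ∘ b))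
    T-lc {zero}  c b = 0̄ , (λ _ → refl) , λ i → trans (T-+ 0̄ 0̄ i) (Boolₚ.xor-same (T 0̄ i))
    T-lc {suc k} c b with T-lc (c ∘ suc) (b ∘ suc) | c zero
    ... | x , e , f | false = x , e , f
    ... | x , e , f | true  = (b zero +̄ x) , (λ i → cong (b zero i xor_) (e i)) ,
      λ i → trans (T-+ (b zero) x i) (cong (T (b zero) i xor_) (f i))

    q-image : ∀ {k} (c : Fin k → F₂) b → q (lc c (T ∘ b)) ≡ q′ (lc c b)
    q-image c b with T-lc c b
    ... | x , e , f = trans (Q.q-cong (λ i → sym (f i))) (trans (qT x) (Q′.q-cong e))

    -- Reduced modulo the radical, the images of B′ are a basis of the span of B, so the
    -- two restricted forms differ by a bijective substitution.
    value-sum : (∀ x → Q.Radical x → q x ≡ false) →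
      ∀ {k} {B B* B′ B′* : Fin k → V̄ n} → Q.DualPair B B* → Q′.DualPair B′ B′* →
      ∑ⱽ k (λ c → sg (q′ (lc (lookup c) B′))) ≡ ∑ⱽ k (λ c → sg (q (lc (lookup c) B)))
    value-sum vanish {k} {B} {B*} {B′} D D′ = trans
      (∑ⱽ-cong k λ c → cong sg (trans (sym (q-image (lookup c) B′)) (trans (reduce (lookup c))
        (Q.q-cong (lc-cong (λ i → sym (Vecₚ.lookup∘tabulate (lc (lookup c) M) i)) (λ _ _ → refl))))))
      (∑ⱽ-reindex k φ ψ ψφ φψ (λ c → sg (q (lc (lookup c) B))))
      where
      y = T ∘ B′
      M : Fin k → V̄ k
      M = coordinates B* ∘ y
      independent : ∀ c → IsZero (lc c M) → ∀ j → c j ≡ false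
      independent c z = image-independent T additive-polar D′ c
        (Q.DualPair.complete D _ λ i → trans (coordinates-lc B* c y i) (z i))
      solution = independent⇒spanning M independent
      φ ψ : Vec Bool k → Vec Bool k
      φ c = Vec.tabulate (lc (lookup c) M)
      ψ d = Vec.tabulate (proj₁ (solution (lookup d)))
      lookup-injective : ∀ {l} {c d : Vec Bool l} → (∀ i → lookup c i ≡ lookup d i) → c ≡ d
      lookup-injective {c = c} {d} e = trans (sym (Vecₚ.tabulate∘lookup c)) (trans (Vecₚ.tabulate-cong e) (Vecₚ.tabulate∘lookup d))
      φψ : ∀ d → φ (ψ d) ≡ d
      φψ d = lookup-injective λ i → trans (Vecₚ.lookup∘tabulate (lc (lookup (ψ d)) M) i)
        (trans (lc-cong (Vecₚ.lookup∘tabulate (proj₁ (solution (lookup d)))) (λ _ _ → refl) i) (proj₂ (solution (lookup d)) i))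
      φ-injective : ∀ c d → φ c ≡ φ d → c ≡ d
      φ-injective c d e = lookup-injective λ i → xor≡false⇒≡ (independent (λ k → lookup c k xor lookup d k)
        (λ j → trans (lc-+ (lookup c) (lookup d) M j) (trans (cong (_xor lc (lookup d) M j)
          (trans (sym (Vecₚ.lookup∘tabulate (lc (lookup c) M) j)) (trans (cong (λ v → lookup v j) e) (Vecₚ.lookup∘tabulate (lc (lookup d) M) j))))
          (Boolₚ.xor-same (lc (lookup d) M j)))) i)
      -- Spanning provides ψ only as a right inverse; injectivity of φ makes it two-sided.
      ψφ : ∀ c → ψ (φ c) ≡ c
      ψφ c = φ-injective (ψ (φ c)) c (φψ (φ c))
      -- A vector and the combination of B with the same coordinates differ by a radical vector, on
      -- which q vanishes.
      reduce : ∀ c → q (lc c y) ≡ q (lc (lc c M) B)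
      reduce c = Q.q-mod-radical vanish (lc c y) (lc (lc c M) B) (Q.DualPair.complete D _ λ j →
        trans (Q.Ω-+ (lc c y) (lc (lc c M) B) (B* j)) (trans (cong₂ _xor_ (coordinates-lc B* c y j)
          (trans (Q.Ω-lc (lc c M) B (B* j)) (trans (∑₂-cong λ k → cong (lc c M k ∧_) (Q.DualPair.dual D k j)) (∑₂-δ (lc c M) j))))
          (Boolₚ.xor-same (lc c M j))))

hyperbolic-sum : ∀ {n} {q : V̄ n → F₂} {Ω} (Q : IsQuadratic q Ω) {a} (e f : Fin a → V̄ n) → IsQuadratic.Hyperbolic Q e f →
  ∑ⱽ (a ℕ.+ a) (λ c → sg (q (lc (lookup c) (e ⧺ f)))) ≡ + (2 ℕ.^ a) * sg (∑₂ λ i → q (e i) ∧ q (f i))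
hyperbolic-sum {q = q} Q {a} e f h = trans (∑ⱽ-++ a a _) (trans
  (∑ⱽ-cong a λ α → ∑ⱽ-cong a λ β → cong sg (trans
    (IsQuadratic.q-cong Q (λ i → trans (lc-⧺ (lookup (α Vec.++ β)) e f i) (cong₂ _xor_
      (lc-cong (Vecₚ.lookup-++ˡ α β) (λ _ _ → refl) i) (lc-cong (Vecₚ.lookup-++ʳ α β) (λ _ _ → refl) i))))
    (IsQuadratic.hyperbolic-value Q e f h (lookup α) (lookup β))))
  (gauss-sum a (q ∘ e) (q ∘ f)))

arf-cancel : ∀ a x y → + (2 ℕ.^ a) * sg x ≡ + (2 ℕ.^ a) * sg y → x ≡ y
arf-cancel a x y e = sg-injective x y (ℤₚ.*-cancelˡ-≡ (+ (2 ℕ.^ a)) (sg x) (sg y) {{ℕₚ.m^n≢0 2 a}} e)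
  where
  sg-injective : ∀ x y → sg x ≡ sg y → x ≡ y
  sg-injective false false _ = refl
  sg-injective true  true  _ = refl

-- The quadratic form of A on classes mod 2

half-+₄ : ∀ {a b} → IsEven a → IsEven b → half (a +₄ b) ≡ half a xor half b
half-+₄ {k0} {b} _ _ = refl
half-+₄ {k2} {k0} _ _ = refl
half-+₄ {k2} {k2} _ _ = refl
half-+₄ {k2} {k1} _ ()
half-+₄ {k2} {k3} _ ()
half-+₄ {k1} ()
half-+₄ {k3} ()

par-double : ∀ x → par (k2 *₄ x) ≡ false
par-double x = par-*₄ k2 x

half-double : ∀ x → half (k2 *₄ x) ≡ par x
half-double k0 = refl
half-double k1 = refl
half-double k2 = refl
half-double k3 = refl

module Reduced {n} (A : Mat n) (A-sym : Symmetric A) (A-even : EvenDiagonal A) where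

  open Form A A-sym A-even

  red-lift : ∀ (x : V̄ n) → red (lift x) ≈ x
  red-lift x i = parity-bit (x i)

  par-∙-cong : ∀ {v u} → red v ≈ red u → ∀ z → par (v ∙ z) ≡ par (u ∙ z)
  par-∙-cong {v} {u} e z with halve v u e
  ... | w , f = begin
    par (v ∙ z)                             ≡⟨ cong par (trans (∙-cong f (λ _ → refl)) (∙-linearˡ u (+ 2) w z)) ⟩
    par (u ∙ z +₄ k2 *₄ (w ∙ z))            ≡⟨ par-+₄ (u ∙ z) (k2 *₄ (w ∙ z)) ⟩
    (par (u ∙ z) xor par (k2 *₄ (w ∙ z)))   ≡⟨ cong (par (u ∙ z) xor_) (par-double (w ∙ z)) ⟩
    (par (u ∙ z) xor false)                 ≡⟨ Boolₚ.xor-identityʳ _ ⟩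
    par (u ∙ z)                             ∎
    where open ≡-Reasoning

  -- (u + 2w, u + 2w) = (u,u) + 4(u,w) + 4(w,w), so even mod 4 the square depends only on the class
  -- mod 2. This makes q independent of the lift.
  self-∙-cong : ∀ {v u} → red v ≈ red u → v ∙ v ≡ u ∙ u
  self-∙-cong {v} {u} e with halve v u e
  ... | w , f = begin
    v ∙ v                                                          ≡⟨ ∙-cong f f ⟩
    (u ⊞ + 2 · w) ∙ (u ⊞ + 2 · w)                                  ≡⟨ ∙-linearˡ u (+ 2) w (u ⊞ + 2 · w) ⟩
    u ∙ (u ⊞ + 2 · w) +₄ k2 *₄ (w ∙ (u ⊞ + 2 · w))                 ≡⟨ cong₂ (λ a b → a +₄ k2 *₄ b) (∙-linearʳ u u (+ 2) w) (trans (∙-linearʳ w u (+ 2) w) (cong (_+₄ k2 *₄ (w ∙ w)) (∙-sym w u))) ⟩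
    u ∙ u +₄ k2 *₄ (u ∙ w) +₄ k2 *₄ (u ∙ w +₄ k2 *₄ (w ∙ w))       ≡⟨ cancel (u ∙ u) (u ∙ w) (w ∙ w) ⟩
    u ∙ u                                                          ∎
    where
    open ≡-Reasoning
    four : ∀ b c → k2 *₄ b +₄ k2 *₄ (b +₄ k2 *₄ c) ≡ k0
    four = identity₂ (λ b c → k2 *₄ b +₄ k2 *₄ (b +₄ k2 *₄ c)) (λ _ _ → k0)
    cancel : ∀ a b c → a +₄ k2 *₄ b +₄ k2 *₄ (b +₄ k2 *₄ c) ≡ a
    cancel a b c = trans (+₄-assoc a (k2 *₄ b) (k2 *₄ (b +₄ k2 *₄ c))) (trans (cong (a +₄_) (four b c)) (+₄-identityʳ a))

  -- The canonical lift used by `Ω` and `q` is not additive; this lemma and `q-red` admit any lift,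
  -- in particular a sum of lifts.
  Ω-red : ∀ {x y} v w → x ≈ red v → y ≈ red w → Ω A x y ≡ par (v ∙ w)
  Ω-red {x} {y} v w e f = begin
    Ω A x y                  ≡⟨ parity≡par (⟨ A ⟩ (lift x) (lift y)) ⟩
    par (res (⟨ A ⟩ (lift x) (lift y))) ≡⟨ cong par (γ-def A (lift x) (lift y)) ⟨
    par (lift x ∙ lift y)    ≡⟨ par-∙-cong (λ i → trans (red-lift x i) (e i)) (lift y) ⟩
    par (v ∙ lift y)         ≡⟨ cong par (∙-sym v (lift y)) ⟩
    par (lift y ∙ v)         ≡⟨ par-∙-cong (λ i → trans (red-lift y i) (f i)) v ⟩
    par (w ∙ v)              ≡⟨ cong par (∙-sym w v) ⟩
    par (v ∙ w)              ∎
    where open ≡-Reasoning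

  q-red : ∀ {x} v → x ≈ red v → q A x ≡ half (v ∙ v)
  q-red {x} v e = trans (parity-/2 (⟨ A ⟩ (lift x) (lift x)) (trans (cong par (sym (γ-def A (lift x) (lift x)))) (∙-even (lift x))))
    (cong half (trans (sym (γ-def A (lift x) (lift x))) (self-∙-cong λ i → trans (red-lift x i) (e i))))

  red-lift′ : ∀ (x : V̄ n) → x ≈ red (lift x)
  red-lift′ x i = sym (red-lift x i)

  Ω-lift : ∀ x y → Ω A x y ≡ par (lift x ∙ lift y)
  Ω-lift x y = Ω-red (lift x) (lift y) (red-lift′ x) (red-lift′ y)

  q-lift : ∀ x → q A x ≡ half (lift x ∙ lift x)
  q-lift x = q-red (lift x) (red-lift′ x)

  lift-+ : ∀ x y → (x +̄ y) ≈ red (lift x ⊞ + 1 · lift y)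
  lift-+ x y i = trans (cong₂ _xor_ (red-lift′ x i) (red-lift′ y i)) (sym (red-⊞ (lift x) (+ 1) (lift y) i))

  ∙-one : ∀ x y z → (x ⊞ + 1 · y) ∙ z ≡ x ∙ z +₄ y ∙ z
  ∙-one x y z = ∙-linearˡ x (+ 1) y z

  isQuadratic : IsQuadratic (q A) (Ω A)
  isQuadratic = record
    { q-cong = λ {x} {y} e → trans (q-lift x) (sym (q-red (lift x) λ i → trans (sym (e i)) (red-lift′ x i)))
    ; q-zero = trans (q-red null (λ _ → refl)) (cong half (∙-zeroˡ null))
    ; Ω-cong = λ {x} {x′} {y} {y′} e f → trans (Ω-lift x y)
        (sym (Ω-red (lift x) (lift y) (λ i → trans (sym (e i)) (red-lift′ x i)) (λ i → trans (sym (f i)) (red-lift′ y i))))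
    ; Ω-+    = λ x y z → trans (Ω-red (lift x ⊞ + 1 · lift y) (lift z) (lift-+ x y) (red-lift′ z))
        (trans (cong par (∙-one (lift x) (lift y) (lift z))) (trans (par-+₄ (lift x ∙ lift z) (lift y ∙ lift z))
          (sym (cong₂ _xor_ (Ω-lift x z) (Ω-lift y z)))))
    ; Ω-sym  = λ x y → trans (Ω-lift x y) (trans (cong par (∙-sym (lift x) (lift y))) (sym (Ω-lift y x)))
    ; polar  = λ x y → trans (q-red (lift x ⊞ + 1 · lift y) (lift-+ x y)) (trans (square (lift x) (lift y))
        (sym (cong₂ _xor_ (cong₂ _xor_ (q-lift x) (q-lift y)) (Ω-lift x y))))
    }
    where
    null : Vecℤ n
    null _ = + 0
    -- The cross term is 2(v,w), whose half is the parity of (v,w); `half` is additive here because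
    -- all the terms are even.
    square : ∀ v w → half ((v ⊞ + 1 · w) ∙ (v ⊞ + 1 · w)) ≡ (half (v ∙ v) xor half (w ∙ w)) xor par (v ∙ w)
    square v w = trans (cong half (trans (∙-linearˡ v (+ 1) w (v ⊞ + 1 · w)) (cong₂ _+₄_ (∙-linearʳ v v (+ 1) w)
      (trans (∙-linearʳ w v (+ 1) w) (cong (_+₄ w ∙ w) (∙-sym w v))))))
      (expand₄ (v ∙ v) (w ∙ w) (v ∙ w) (∙-even v) (∙-even w))
      where
      rearrange : ∀ a c b → (a +₄ b) +₄ (b +₄ c) ≡ (a +₄ c) +₄ k2 *₄ b
      rearrange a c b = trans (+₄-assoc a b (b +₄ c)) (trans (cong (a +₄_) (inner b c)) (sym (+₄-assoc a c (k2 *₄ b))))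
        where
        inner : ∀ b c → b +₄ (b +₄ c) ≡ c +₄ k2 *₄ b
        inner = identity₂ (λ b c → b +₄ (b +₄ c)) (λ b c → c +₄ k2 *₄ b)
      expand₄ : ∀ a c b → IsEven a → IsEven c → half ((a +₄ b) +₄ (b +₄ c)) ≡ (half a xor half c) xor par b
      expand₄ a c b e f = trans (cong half (rearrange a c b)) (trans
        (half-+₄ {a +₄ c} {k2 *₄ b} (trans (par-+₄ a c) (cong₂ _xor_ e f)) (par-double b))
        (cong₂ _xor_ (half-+₄ e f) (half-double b)))

  open IsQuadratic isQuadratic using (Radical)

  V̄₀⇒radical : ∀ {x} → V̄₀ A x → Radical x
  V̄₀⇒radical (v , v₀ , e) y = trans (Ω-red v (lift y) (λ i → sym (e i)) (red-lift′ y))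
    (trans (cong par (γ-def A v (lift y))) (2∣⇒par {⟨ A ⟩ v (lift y)} (v₀ (lift y))))

  radical⇒V̄₀ : ∀ {x} → Radical x → V̄₀ A x
  radical⇒V̄₀ {x} rad = lift x , (λ w → par⇒2∣ (⟨ A ⟩ (lift x) w)
    (trans (cong par (sym (γ-def A (lift x) w))) (trans (sym (Ω-red (lift x) w (red-lift′ x) (λ _ → refl))) (rad (red w))))) , red-lift x

-- Radical, dimensions and Arf invariant read off from a split basis

module Structure {n} (A : Mat n) (A-sym : Symmetric A) (A-even : EvenDiagonal A) where

  open Form A A-sym A-even
  open Reduced A A-sym A-even
  open Splitting A A-sym A-even
  open IsQuadratic isQuadratic

  private
    Null : X → Set
    Null v = ∀ w → v ∙ w ≡ k0

  Null⇒V₀₀₀ : ∀ {v} → Null v → V₀₀₀ A v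
  Null⇒V₀₀₀ {v} null = (λ w → par⇒2∣ (⟨ A ⟩ v w) (cong par (zero-value w))) , λ w → res⇒4∣ (⟨ A ⟩ v w) (zero-value w)
    where
    zero-value : ∀ w → res (⟨ A ⟩ v w) ≡ k0
    zero-value w = trans (sym (γ-def A v w)) (null w)

  V₀₀₀⇒Null : ∀ {v} → V₀₀₀ A v → Null v
  V₀₀₀⇒Null {v} (_ , d) w = trans (γ-def A v w) (4∣⇒res {⟨ A ⟩ v w} (d w))

  comb-zero : ∀ {k} c (E : Vec X k) z → (∀ i → lookup E i ∙ z ≡ k0) → comb c E ∙ z ≡ k0
  comb-zero c []      z o = ∙-zeroˡ z
  comb-zero c (x ∷ E) z o = trans (∙-linearˡ (comb (c ∘ suc) E) (bit (c zero)) x z)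
    (trans (cong₂ (λ a b → a +₄ res (bit (c zero)) *₄ b) (comb-zero (c ∘ suc) E z (o ∘ suc)) (o zero))
      (*₄-zeroʳ (res (bit (c zero)))))

  -- `half` is additive on even residues, so pairing with z and dividing by 2 is linear over F₂ in
  -- the coefficients.
  comb-half : ∀ {k} c (E : Vec X k) z → (∀ i → par (lookup E i ∙ z) ≡ false) →
    par (comb c E ∙ z) ≡ false × half (comb c E ∙ z) ≡ ∑₂ (λ i → c i ∧ half (lookup E i ∙ z))
  comb-half c []      z o = cong par e , cong half e
    where
    e : comb c [] ∙ z ≡ k0
    e = comb-zero c [] z λ ()
  comb-half c (x ∷ E) z o with comb-half (c ∘ suc) E z (o ∘ suc)
  ... | even , halved rewrite ∙-linearˡ (comb (c ∘ suc) E) (bit (c zero)) x z =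
    trans (par-+₄ (comb (c ∘ suc) E ∙ z) (res (bit (c zero)) *₄ (x ∙ z))) (cong₂ _xor_ even term-even) ,
    trans (half-+₄ even term-even) (trans (cong₂ _xor_ halved (term-half (c zero)))
      (Boolₚ.xor-comm (∑₂ λ i → c (suc i) ∧ half (lookup E i ∙ z)) _))
    where
    term-even : par (res (bit (c zero)) *₄ (x ∙ z)) ≡ false
    term-even = trans (par-*₄ (res (bit (c zero))) (x ∙ z)) (trans (cong (par (res (bit (c zero))) ∧_) (o zero)) (Boolₚ.∧-zeroʳ _))
    term-half : ∀ b → half (res (bit b) *₄ (x ∙ z)) ≡ b ∧ half (x ∙ z)
    term-half false = refl
    term-half true  = refl

  ≈⇒IsZero : ∀ {x y : V̄ n} → x ≈ y → IsZero (x +̄ y)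
  ≈⇒IsZero {x} {y} e i = trans (cong (_xor y i) (e i)) (Boolₚ.xor-same (y i))

  module _ (L : Vec X n) (basis : IsBasis (redL L)) {a d m ρ p} (S : Split L a d m ρ p) where

    open Split S
    open IsBasis basis

    coordinates₄ : ∀ x → ∃[ α ] ∃[ β ] ∃[ g ] ∃[ h ] x ≈ combine α β g h
    coordinates₄ x with spanning x
    ... | c , e with decompose c
    ...   | α , β , g , h , f = α , β , g , h , λ i → trans (sym (e i)) (f i)

    Ω-redL : ∀ {k l} (U : Vec X k) (W : Vec X l) i j → Ω A (redL U i) (redL W j) ≡ par (lookup U i ∙ lookup W j)
    Ω-redL U W i j = Ω-red (lookup U i) (lookup W j) (λ _ → refl) (λ _ → refl)

    Ω-orth : ∀ {k l} (U : Vec X k) (W : Vec X l) → (∀ i j → lookup U i ∙ lookup W j ≡ k0) →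
      ∀ i j → Ω A (redL U i) (redL W j) ≡ false
    Ω-orth U W o i j = trans (Ω-redL U W i j) (cong par (o i j))

    hyperbolic-EF : Hyperbolic (redL E) (redL F)
    hyperbolic-EF = (λ i j → trans (Ω-redL E F i j) (EF i j)) , (λ i j → trans (Ω-redL E E i j) (EE i j)) ,
      λ i j → trans (Ω-redL F F i j) (FF i j)

    lc-annihilates : ∀ {k} c (U : Fin k → V̄ n) z → (∀ i → Ω A (U i) z ≡ false) → Ω A (lc c U) z ≡ false
    lc-annihilates c U z o = trans (Ω-lc c U z) (∑₂-zero λ k → trans (cong (c k ∧_) (o k)) (Boolₚ.∧-zeroʳ (c k)))

    combine-Ω : ∀ α β g h z → Ω A (combine α β g h) z ≡
      Ω A (lc α (redL E)) z xor (Ω A (lc β (redL F)) z xor (Ω A (lc g (redL G)) z xor Ω A (lc h (redL H)) z))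
    combine-Ω α β g h z = trans (Ω-+ (lc α (redL E)) _ z) (cong (Ω A (lc α (redL E)) z xor_)
      (trans (Ω-+ (lc β (redL F)) _ z) (cong (Ω A (lc β (redL F)) z xor_) (Ω-+ (lc g (redL G)) (lc h (redL H)) z))))

    orthogonal-to-all : ∀ z → (∀ i → Ω A (redL E i) z ≡ false) → (∀ i → Ω A (redL F i) z ≡ false) →
      (∀ i → Ω A (redL G i) z ≡ false) → (∀ i → Ω A (redL H i) z ≡ false) → Radical z
    orthogonal-to-all z e f g h y with coordinates₄ y
    ... | α , β , γ , η , eq = trans (Ω-sym z y) (trans (Ω-cong eq (λ _ → refl)) (trans (combine-Ω α β γ η z)
      (cong₂ _xor_ (lc-annihilates α (redL E) z e) (cong₂ _xor_ (lc-annihilates β (redL F) z f)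
        (cong₂ _xor_ (lc-annihilates γ (redL G) z g) (lc-annihilates η (redL H) z h))))))

    G-radical : ∀ i → Radical (redL G i)
    G-radical i = orthogonal-to-all (redL G i) (λ k → Ω-orth E G EG k i) (λ k → Ω-orth F G FG k i)
      (λ k → trans (Ω-redL G G k i) (GG k i)) (λ k → trans (Ω-sym (redL H k) (redL G i)) (Ω-orth G H GH i k))

    H-radical : ∀ i → Radical (redL H i)
    H-radical i = orthogonal-to-all (redL H i) (λ k → Ω-orth E H EH k i) (λ k → Ω-orth F H FH k i)
      (λ k → Ω-orth G H GH k i) (λ k → Ω-orth H H HH k i)

    radical-even : ∀ {v} → Radical (red v) → ∀ w → par (v ∙ w) ≡ false
    radical-even {v} r w = trans (sym (Ω-red v w (λ _ → refl) (λ _ → refl))) (r (red w))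

    -- G and H already lie in the radical, so pairing to 0 with E and F is enough to lie in it as
    -- well.
    dualPair : DualPair (redL E ⧺ redL F) (redL F ⧺ redL E)
    dualPair = record { dual = hyperbolic-dual (redL E) (redL F) hyperbolic-EF ; complete = complete }
      where
      complete : ∀ x → (∀ j → Ω A x ((redL F ⧺ redL E) j) ≡ false) → Radical x
      complete x o = orthogonal-to-all x
        (λ i → trans (Ω-sym (redL E i) x) (trans (cong (Ω A x) (sym (⧺-↑ʳ (redL F) (redL E) i))) (o (a ↑ʳ i))))
        (λ i → trans (Ω-sym (redL F i) x) (trans (cong (Ω A x) (sym (⧺-↑ˡ (redL F) (redL E) i))) (o (i ↑ˡ a))))
        (λ i → trans (Ω-sym (redL G i) x) (trans (Ω-sym x (redL G i)) (G-radical i x)))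
        (λ i → H-radical i x)

    -- Pairing with F reads off the coordinates along E and conversely; for a radical vector all of
    -- these are 0.
    radical-coordinates : ∀ x → Radical x → ∃[ g ] ∃[ h ] x ≈ (lc g (redL G) +̄ lc h (redL H))
    radical-coordinates x r with coordinates₄ x
    ... | α , β , g , h , e = g , h , λ i → trans (e i) (cong₂ (λ u v → u xor (v xor _))
      (lc-zero (redL E) α-zero i) (lc-zero (redL F) β-zero i))
      where
      pairing : ∀ z → Ω A (lc α (redL E)) z xor (Ω A (lc β (redL F)) z xor (Ω A (lc g (redL G)) z xor Ω A (lc h (redL H)) z)) ≡ false
      pairing z = trans (sym (combine-Ω α β g h z)) (trans (Ω-cong (λ i → sym (e i)) (λ _ → refl)) (r z))
      GH-vanish : ∀ z → Ω A (lc g (redL G)) z xor Ω A (lc h (redL H)) z ≡ false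
      GH-vanish z = cong₂ _xor_ (lc-annihilates g (redL G) z (λ i → G-radical i z)) (lc-annihilates h (redL H) z (λ i → H-radical i z))
      α-zero : ∀ j → α j ≡ false
      α-zero j = begin
        α j                                       ≡⟨ ∑₂-δ α j ⟨
        ∑₂ (λ k → α k ∧ δ k j)                    ≡⟨ ∑₂-cong (λ k → cong (α k ∧_) (proj₁ hyperbolic-EF k j)) ⟨
        ∑₂ (λ k → α k ∧ Ω A (redL E k) (redL F j)) ≡⟨ Ω-lc α (redL E) (redL F j) ⟨
        Ω A (lc α (redL E)) (redL F j)            ≡⟨ xor≡false⇒≡ (pairing (redL F j)) ⟩
        (Ω A (lc β (redL F)) (redL F j) xor (Ω A (lc g (redL G)) (redL F j) xor Ω A (lc h (redL H)) (redL F j)))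
          ≡⟨ cong₂ _xor_ (lc-annihilates β (redL F) (redL F j) (λ i → proj₂ (proj₂ hyperbolic-EF) i j)) (GH-vanish (redL F j)) ⟩
        false ∎
        where open ≡-Reasoning
      β-zero : ∀ j → β j ≡ false
      β-zero j = begin
        β j                                       ≡⟨ ∑₂-δ β j ⟨
        ∑₂ (λ k → β k ∧ δ k j)                    ≡⟨ ∑₂-cong (λ k → cong (β k ∧_) (trans (Ω-sym (redL F k) (redL E j)) (trans (proj₁ hyperbolic-EF j k) (δ-sym j k)))) ⟨
        ∑₂ (λ k → β k ∧ Ω A (redL F k) (redL E j)) ≡⟨ Ω-lc β (redL F) (redL E j) ⟨
        Ω A (lc β (redL F)) (redL E j)            ≡⟨ Boolₚ.xor-identityʳ _ ⟨
        (Ω A (lc β (redL F)) (redL E j) xor false) ≡⟨ cong (Ω A (lc β (redL F)) (redL E j) xor_) (GH-vanish (redL E j)) ⟨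
        (Ω A (lc β (redL F)) (redL E j) xor (Ω A (lc g (redL G)) (redL E j) xor Ω A (lc h (redL H)) (redL E j)))
          ≡⟨ xor≡false⇒≡ (trans (Boolₚ.xor-comm _ (Ω A (lc α (redL E)) (redL E j))) (pairing (redL E j))) ⟩
        Ω A (lc α (redL E)) (redL E j)            ≡⟨ lc-annihilates α (redL E) (redL E j) (λ i → proj₁ (proj₂ hyperbolic-EF) i j) ⟩
        false ∎
        where open ≡-Reasoning

    red-⊞₁ : ∀ (u v : X) → red (u ⊞ + 1 · v) ≈ (red u +̄ red v)
    red-⊞₁ u v = red-⊞ u (+ 1) v

    -- A vector of the radical pairs to zero mod 4 with 2V.
    ∙-mod-2V : ∀ {v u} → red v ≈ red u → ∀ z → (∀ w → par (z ∙ w) ≡ false) → v ∙ z ≡ u ∙ z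
    ∙-mod-2V {v} {u} e z even with halve v u e
    ... | w , f = trans (∙-cong f (λ _ → refl)) (trans (∙-linearˡ u (+ 2) w z)
      (trans (cong (u ∙ z +₄_) (trans (cong (k2 *₄_) (∙-sym w z)) (k2*₄-even (even w)))) (+₄-identityʳ (u ∙ z))))

    -- An integer lift of `combine`, required because pairings mod 4 are not functions of the
    -- classes mod 2.
    total : (Fin a → F₂) → (Fin a → F₂) → (Fin d → F₂) → (Fin m → F₂) → X
    total α β g h = comb α E ⊞ + 1 · (comb β F ⊞ + 1 · (comb g G ⊞ + 1 · comb h H))

    red-total : ∀ α β g h → red (total α β g h) ≈ combine α β g h
    red-total α β g h k = trans (red-⊞₁ (comb α E) (comb β F ⊞ + 1 · (comb g G ⊞ + 1 · comb h H)) k) (cong₂ _xor_ (red-comb α E k)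
      (trans (red-⊞₁ (comb β F) (comb g G ⊞ + 1 · comb h H) k) (cong₂ _xor_ (red-comb β F k)
        (trans (red-⊞₁ (comb g G) (comb h H) k) (cong₂ _xor_ (red-comb g G k) (red-comb h H k))))))

    total-∙ : ∀ α β g h z → total α β g h ∙ z ≡ comb α E ∙ z +₄ (comb β F ∙ z +₄ (comb g G ∙ z +₄ comb h H ∙ z))
    total-∙ α β g h z = trans (∙-one (comb α E) (comb β F ⊞ + 1 · (comb g G ⊞ + 1 · comb h H)) z) (cong (comb α E ∙ z +₄_)
      (trans (∙-one (comb β F) (comb g G ⊞ + 1 · comb h H) z) (cong (comb β F ∙ z +₄_) (∙-one (comb g G) (comb h H) z))))

    -- Any w is a combination of the basis plus an element of 2V. The combination pairs to 0 block
    -- by block, and 2V pairs to 0 mod 4 because a radical vector has even pairings.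
    H-null : ∀ i → Null (lookup H i)
    H-null i w with coordinates₄ (red w)
    ... | α , β , g , h , e = trans (∙-sym (lookup H i) w) (trans
      (∙-mod-2V {w} {total α β g h} (λ k → trans (e k) (sym (red-total α β g h k))) (lookup H i) (radical-even (H-radical i)))
      (trans (total-∙ α β g h (lookup H i)) (cong₂ _+₄_ (comb-zero α E (lookup H i) (λ r → EH r i))
        (cong₂ _+₄_ (comb-zero β F (lookup H i) (λ r → FH r i))
          (cong₂ _+₄_ (comb-zero g G (lookup H i) (λ r → GH r i)) (comb-zero h H (lookup H i) (λ r → HH r i)))))))

    comb-H-null : ∀ h → Null (comb h H)
    comb-H-null h z = comb-zero h H z (λ i → H-null i z)

    -- Half the pairing with the dual vector `G (σ j)` is the j-th coordinate along G. That vector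
    -- is radical, so v may be replaced by the lift of its coordinates.
    G-coordinates-zero : ∀ {v} → Null v → ∀ g h → red v ≈ (lc g (redL G) +̄ lc h (redL H)) → ∀ j → g j ≡ false
    G-coordinates-zero {v} null g h e j = begin
      g j                                     ≡⟨ ∑₂-δ g j ⟨
      ∑₂ (λ k → g k ∧ δ k j)                  ≡⟨ ∑₂-cong (λ k → cong (g k ∧_) (dual k j)) ⟨
      ∑₂ (λ k → g k ∧ half (lookup G k ∙ z))  ≡⟨ proj₂ (comb-half g G z (λ k → GG k (σ j))) ⟨
      half (comb g G ∙ z)                     ≡⟨ cong half (+₄-identityʳ (comb g G ∙ z)) ⟨
      half (comb g G ∙ z +₄ k0)               ≡⟨ cong (λ b → half (comb g G ∙ z +₄ b)) (comb-H-null h z) ⟨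
      half (comb g G ∙ z +₄ comb h H ∙ z)     ≡⟨ cong half (∙-one (comb g G) (comb h H) z) ⟨
      half ((comb g G ⊞ + 1 · comb h H) ∙ z)  ≡⟨ cong half (∙-mod-2V {v} {comb g G ⊞ + 1 · comb h H} (λ k → trans (e k) (sym (red-GH k))) z (radical-even (G-radical (σ j)))) ⟨
      half (v ∙ z)                            ≡⟨ cong half (null z) ⟩
      false                                   ∎
      where
      open ≡-Reasoning
      z : X
      z = lookup G (σ j)
      red-GH : red (comb g G ⊞ + 1 · comb h H) ≈ (lc g (redL G) +̄ lc h (redL H))
      red-GH k = trans (red-⊞₁ (comb g G) (comb h H) k) (cong₂ _xor_ (red-comb g G k) (red-comb h H k))

    compose-zero : ∀ α β g h → IsZero (combine α β g h) →
      (∀ i → α i ≡ false) × (∀ i → β i ≡ false) × (∀ i → g i ≡ false) × (∀ i → h i ≡ false)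
    compose-zero α β g h z with compose α β g h
    ... | c , e , f = f (independent c λ i → trans (e i) (z i))

    null-radical : ∀ {v} → Null v → Radical (red v)
    null-radical {v} null y = trans (Ω-red v (lift y) (λ _ → refl) (red-lift′ y)) (cong par (null (lift y)))

    none : ∀ {k} → Fin k → F₂
    none _ = false

    lc-none : ∀ {k} (U : Fin k → V̄ n) → IsZero (lc none U)
    lc-none U = lc-zero {c = none} U (λ _ → refl)

    null-coordinates : ∀ v → Null v → ∃[ h ] red v ≈ lc h (redL H)
    null-coordinates v null = reduce (radical-coordinates (red v) (null-radical {v} null))
      where
      reduce : (∃[ g ] ∃[ h ] red v ≈ (lc g (redL G) +̄ lc h (redL H))) → ∃[ h ] red v ≈ lc h (redL H)
      reduce (g , h , e) = h , λ i → trans (e i) (cong (_xor lc h (redL H) i)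
        (lc-zero {c = g} (redL G) (G-coordinates-zero {v} null g h e) i))

    H-independent : ∀ c → IsZero (lc c (redL H)) → ∀ k → c k ≡ false
    H-independent c z = proj₂ (proj₂ (proj₂ (compose-zero none none none c λ i →
      trans (cong₂ _xor_ (lc-none (redL E) i) (cong₂ _xor_ (lc-none (redL F) i)
        (cong (_xor lc c (redL H) i) (lc-none (redL G) i)))) (z i))))

    dim-V̄₀₀₀ : HasDim (V̄₀₀₀ A) m
    dim-V̄₀₀₀ = redL H , (λ k → lookup H k , Null⇒V₀₀₀ (H-null k) , λ _ → refl) , H-independent , span
      where
      span : ∀ x → V̄₀₀₀ A x → ∃[ c ] IsZero (x +̄ lc c (redL H))
      span x (v , v₀ , e) = proj₁ coords , ≈⇒IsZero {x} λ i → trans (sym (e i)) (proj₂ coords i)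
        where
        coords = null-coordinates v (V₀₀₀⇒Null {v} v₀)

    dim-V̄₀/V̄₀₀₀ : HasDimMod (V̄₀ A) (V̄₀₀₀ A) d
    dim-V̄₀/V̄₀₀₀ = redL G , (λ k → radical⇒V̄₀ (G-radical k)) , indep , span
      where
      indep : ∀ c → V̄₀₀₀ A (lc c (redL G)) → ∀ k → c k ≡ false
      indep c (v , v₀ , e) = G-coordinates-zero {v} (V₀₀₀⇒Null {v} v₀) c none λ i → trans (e i)
        (sym (trans (cong (lc c (redL G) i xor_) (lc-none (redL H) i)) (Boolₚ.xor-identityʳ _)))
      span : ∀ x → V̄₀ A x → ∃[ c ] V̄₀₀₀ A (x +̄ lc c (redL G))
      span x x₀ = reduce (radical-coordinates x (V̄₀⇒radical x₀))
        where
        cancel : ∀ u v → v ≡ (u xor v) xor u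
        cancel false false = refl
        cancel false true  = refl
        cancel true  false = refl
        cancel true  true  = refl
        reduce : (∃[ g ] ∃[ h ] x ≈ (lc g (redL G) +̄ lc h (redL H))) → ∃[ c ] V̄₀₀₀ A (x +̄ lc c (redL G))
        reduce (g , h , e) = g , comb h H , Null⇒V₀₀₀ {comb h H} (comb-H-null h) , λ i → trans (red-comb h H i)
          (trans (cancel (lc g (redL G) i) (lc h (redL H) i)) (cong (_xor lc g (redL G) i) (sym (e i))))

    q-redL : ∀ {k} (U : Vec X k) i → q A (redL U i) ≡ half (lookup U i ∙ lookup U i)
    q-redL U i = q-red (lookup U i) (λ _ → refl)

    arf-sum : ∑₂ (λ i → q A (redL E i) ∧ q A (redL F i)) ≡ ρ
    arf-sum = trans (∑₂-cong λ i → cong₂ _∧_ (q-redL E i) (q-redL F i)) arf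

    -- G and H together serve as the vectors h of a symplectic basis, since both lie in the radical.
    arf-is : ArfIs A ρ
    arf-is = a , d ℕ.+ m , redL E , redL F , GH′ ,
      (indep , span , proj₁ hyperbolic-EF , proj₁ (proj₂ hyperbolic-EF) , proj₂ (proj₂ hyperbolic-EF) ,
       (λ i j → trans (Ω-sym (redL E i) (GH′ j)) (rest-radical j (redL E i))) ,
       (λ i j → trans (Ω-sym (redL F i) (GH′ j)) (rest-radical j (redL F i))) ,
       (λ i j → rest-radical i (GH′ j))) , arf-sum
      where
      GH′ : Fin (d ℕ.+ m) → V̄ n
      GH′ = redL G ⧺ redL H
      rest-radical : ∀ k → Radical (GH′ k)
      rest-radical = ⧺-elim {P = Radical} (redL G) (redL H) G-radical H-radical
      to-combine : ∀ α β c → (lc α (redL E) +̄ (lc β (redL F) +̄ lc c GH′)) ≈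
        combine α β (λ i → c (i ↑ˡ m)) (λ j → c (d ↑ʳ j))
      to-combine α β c i = cong (λ r → lc α (redL E) i xor (lc β (redL F) i xor r)) (lc-⧺ c (redL G) (redL H) i)
      indep : ∀ α β c → IsZero (lc α (redL E) +̄ (lc β (redL F) +̄ lc c GH′)) →
        (∀ i → α i ≡ false) × (∀ i → β i ≡ false) × (∀ j → c j ≡ false)
      indep α β c z with compose-zero α β (λ i → c (i ↑ˡ m)) (λ j → c (d ↑ʳ j)) (λ i → trans (sym (to-combine α β c i)) (z i))
      ... | p , q , r , s = p , q , ↑-elim d {P = λ k → c k ≡ false} r s
      span : ∀ x → ∃[ α ] ∃[ β ] ∃[ c ] (lc α (redL E) +̄ (lc β (redL F) +̄ lc c GH′)) ≈ x
      span x with coordinates₄ x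
      ... | α , β , g , h , e = α , β , (g ⧺ h) , λ i → trans (to-combine α β (g ⧺ h) i) (trans
        (cong (λ r → lc α (redL E) i xor (lc β (redL F) i xor r))
          (cong₂ _xor_ (lc-cong (⧺-↑ˡ g h) (λ _ _ → refl) i) (lc-cong (⧺-↑ʳ g h) (λ _ _ → refl) i))) (sym (e i)))

    D-vector : p ≢ 0 → ∃[ x ] V̄₀ A x × q A x ≡ true
    D-vector p≢0 = let (i , e) = diagonal₁ p≢0 in
      redL G i , radical⇒V̄₀ (G-radical i) , trans (q-redL G i) (cong half e)

    -- On the radical q is additive, and it is 0 on the generators: without blocks (2), all of G and
    -- H have square 0 mod 4.
    q-vanishes : p ≡ 0 → qVanishesOnV̄₀ A
    q-vanishes p≡0 x x₀ = reduce (radical-coordinates x (V̄₀⇒radical x₀))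
      where
      q-lc : ∀ {k} c (U : Vec X k) → (∀ i → q A (redL U i) ≡ false) → (∀ i → Radical (redL U i)) → q A (lc c (redL U)) ≡ false
      q-lc c []      z r = q-zero
      q-lc c (u ∷ U) z r = trans (polar (λ i → c zero ∧ red u i) (lc (c ∘ suc) (redL U))) (cong₂ _xor_
        (cong₂ _xor_ (trans (q-scale (c zero) (red u)) (trans (cong (c zero ∧_) (z zero)) (Boolₚ.∧-zeroʳ (c zero))))
          (q-lc (c ∘ suc) U (z ∘ suc) (r ∘ suc)))
        (trans (Ω-scale (c zero) (red u) _) (trans (cong (c zero ∧_) (r zero (lc (c ∘ suc) (redL U)))) (Boolₚ.∧-zeroʳ (c zero)))))
      reduce : (∃[ g ] ∃[ h ] x ≈ (lc g (redL G) +̄ lc h (redL H))) → q A x ≡ false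
      reduce (g , h , e) = trans (q-cong e) (trans (polar (lc g (redL G)) (lc h (redL H)))
        (cong₂ _xor_ (cong₂ _xor_ (q-lc g G (λ i → trans (q-redL G i) (cong half (diagonal₀ p≡0 i))) G-radical)
            (q-lc h H (λ i → trans (q-redL H i) (cong half (HH i i))) H-radical))
          (lc-annihilates g (redL G) (lc h (redL H)) (λ i → G-radical i (lc h (redL H))))))

-- Invariance and uniqueness of the parameters

nfSize-rank : ∀ r s t p m → nfSize r s t p m ≡ (r ℕ.+ s) ℕ.* 2 ℕ.+ ((t ℕ.* 2 ℕ.+ p) ℕ.+ m)
nfSize-rank r s t p m = regroup r s t p m
  where
  regroup : ∀ r s t p m → r ℕ.* 2 ℕ.+ (s ℕ.* 2 ℕ.+ (t ℕ.* 2 ℕ.+ (p ℕ.* 1 ℕ.+ m ℕ.* 1))) ≡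
    (r ℕ.+ s) ℕ.* 2 ℕ.+ ((t ℕ.* 2 ℕ.+ p) ℕ.+ m)
  regroup = ℕSolver.solve-∀

double-injective : ∀ a b → a ℕ.+ a ≡ b ℕ.+ b → a ≡ b
double-injective a b e = ℕₚ.*-cancelʳ-≡ a b 2 (trans (double a) (trans e (sym (double b))))
  where
  double : ∀ a → a ℕ.* 2 ≡ a ℕ.+ a
  double = ℕSolver.solve-∀

[t*2+p]%2 : ∀ t p → (t ℕ.* 2 ℕ.+ p) % 2 ≡ p % 2
[t*2+p]%2 t p = trans (cong (_% 2) (ℕₚ.+-comm (t ℕ.* 2) p)) (ℕDM.[m+kn]%n≡m%n p t 2)

module NormalForm {n} (A : Mat n) (A-sym : Symmetric A) (A-even : EvenDiagonal A)
  (r s t p m : ℕ) (nf : IsNormalForm A r s t p m) where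

  open Form A A-sym A-even using (IsNormalForm⇒Nf)
  open Splitting A A-sym A-even
  open Structure A A-sym A-even
  open Reduced A A-sym A-even using (isQuadratic)
  open IsQuadratic isQuadratic using (Hyperbolic; DualPair)

  private
    normal = IsNormalForm⇒Nf {r} {s} {t} {p} {m} nf
    L     = proj₁ normal
    basis = unimodular-basis L (proj₁ (proj₂ normal))
    S     = split (proj₂ (proj₂ normal))

  e f : Fin (r ℕ.+ s) → V̄ n
  e = redL (Split.E S)
  f = redL (Split.F S)

  hyperbolic-ef : Hyperbolic e f
  hyperbolic-ef = hyperbolic-EF L basis S

  dual-ef : DualPair (e ⧺ f) (f ⧺ e)
  dual-ef = dualPair L basis S

  arf-ef : ∑₂ (λ i → q A (e i) ∧ q A (f i)) ≡ parity (+ r)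
  arf-ef = arf-sum L basis S

  arfIs : ArfIs A (parity (+ r))
  arfIs = arf-is L basis S

  dim₀₀₀ : HasDim (V̄₀₀₀ A) m
  dim₀₀₀ = dim-V̄₀₀₀ L basis S

  dim₀ : HasDimMod (V̄₀ A) (V̄₀₀₀ A) (t ℕ.* 2 ℕ.+ p)
  dim₀ = dim-V̄₀/V̄₀₀₀ L basis S

  p≢0⇒q≢0 : p ≢ 0 → ∃[ x ] V̄₀ A x × q A x ≡ true
  p≢0⇒q≢0 = D-vector L basis S

  p≡0⇒q≡0 : p ≡ 0 → qVanishesOnV̄₀ A
  p≡0⇒q≡0 = q-vanishes L basis S

  size : (r ℕ.+ s) ℕ.* 2 ℕ.+ ((t ℕ.* 2 ℕ.+ p) ℕ.+ m) ≡ n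
  size = trans (sym (nfSize-rank r s t p m)) (proj₁ nf)

  q≡0⇒p≡0 : qVanishesOnV̄₀ A → p ≡ 0
  q≡0⇒p≡0 vanish with p ℕₚ.≟ 0
  ... | yes e = e
  ... | no ne = let (x , x₀ , e) = p≢0⇒q≢0 ne in contradiction (trans (sym e) (vanish x x₀)) λ ()

module Isometry {n} (A A′ : Mat n) (A-sym : Symmetric A) (A-even : EvenDiagonal A)
  (A′-sym : Symmetric A′) (A′-even : EvenDiagonal A′) (iso : q A ≅q q A′) where

  private
    module R  = Reduced A A-sym A-even
    module R′ = Reduced A′ A′-sym A′-even
    module C  = Comparison R.isQuadratic R′.isQuadratic
    module C′ = Comparison R′.isQuadratic R.isQuadratic

    T T⁻¹ : V̄ n → V̄ n
    T   = proj₁ iso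
    T⁻¹ = proj₁ (proj₂ (proj₁ (proj₂ iso)))

    T-+ : ∀ x y → T (x +̄ y) ≈ (T x +̄ T y)
    T-+ = proj₁ (proj₁ (proj₂ iso))

    TT⁻¹ : ∀ x → T (T⁻¹ x) ≈ x
    TT⁻¹ = proj₁ (proj₂ (proj₂ (proj₁ (proj₂ iso))))

    qT : ∀ x → q A (T x) ≡ q A′ x
    qT = proj₂ (proj₂ iso)

    ΩT : ∀ x y → Ω A (T x) (T y) ≡ Ω A′ x y
    ΩT = C.additive-polar T T-+ qT

    -- Derived from `ΩT` at the preimages, since additivity is given for T and not for its inverse.
    ΩT⁻¹ : ∀ x y → Ω A′ (T⁻¹ x) (T⁻¹ y) ≡ Ω A x y
    ΩT⁻¹ x y = trans (sym (ΩT (T⁻¹ x) (T⁻¹ y))) (IsQuadratic.Ω-cong R.isQuadratic (TT⁻¹ x) (TT⁻¹ y))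

  rank-invariant : ∀ {k l} {B B* : Fin k → V̄ n} {B′ B′* : Fin l → V̄ n} →
    IsQuadratic.DualPair R.isQuadratic B B* → IsQuadratic.DualPair R′.isQuadratic B′ B′* → k ≡ l
  rank-invariant D D′ = ℕₚ.≤-antisym (C′.rank-mono T⁻¹ ΩT⁻¹ D′ D) (C.rank-mono T ΩT D D′)

  -- T carries radical vectors to radical vectors because every y is the image of T⁻¹ y.
  vanishing-invariant : qVanishesOnV̄₀ A → qVanishesOnV̄₀ A′
  vanishing-invariant vanish x x₀ = trans (sym (qT x)) (vanish (T x) (R.radical⇒V̄₀ radical))
    where
    radical : IsQuadratic.Radical R.isQuadratic (T x)
    radical y = trans (IsQuadratic.Ω-cong R.isQuadratic {T x} (λ _ → refl) (λ i → sym (TT⁻¹ y i)))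
      (trans (ΩT x (T⁻¹ y)) (R′.V̄₀⇒radical x₀ (T⁻¹ y)))

  -- Each Gauss sum is 2^a times the sign of its Arf sum, `value-sum` identifies the two, and the
  -- factor 2^a cancels.
  arf-invariant : qVanishesOnV̄₀ A → ∀ {a a′} → a ≡ a′ →
    (e f : Fin a → V̄ n) → IsQuadratic.Hyperbolic R.isQuadratic e f → IsQuadratic.DualPair R.isQuadratic (e ⧺ f) (f ⧺ e) →
    (e′ f′ : Fin a′ → V̄ n) → IsQuadratic.Hyperbolic R′.isQuadratic e′ f′ → IsQuadratic.DualPair R′.isQuadratic (e′ ⧺ f′) (f′ ⧺ e′) →
    ∑₂ (λ i → q A (e i) ∧ q A (f i)) ≡ ∑₂ (λ i → q A′ (e′ i) ∧ q A′ (f′ i))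
  arf-invariant vanish {a} refl e f h D e′ f′ h′ D′ = arf-cancel a _ _ (trans
    (sym (hyperbolic-sum R.isQuadratic e f h)) (trans
      (sym (C.value-sum T T-+ qT (λ x r → vanish x (R.radical⇒V̄₀ r)) D D′))
      (hyperbolic-sum R′.isQuadratic e′ f′ h′)))

  module Parameters (r s t p m r′ s′ t′ p′ m′ : ℕ) (nf : IsNormalForm A r s t p m) (nf′ : IsNormalForm A′ r′ s′ t′ p′ m′) where

    private
      module NF  = NormalForm A A-sym A-even r s t p m nf
      module NF′ = NormalForm A′ A′-sym A′-even r′ s′ t′ p′ m′ nf′

    rank-≡ : r ℕ.+ s ≡ r′ ℕ.+ s′
    rank-≡ = double-injective (r ℕ.+ s) (r′ ℕ.+ s′) (rank-invariant NF.dual-ef NF′.dual-ef)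

    m-≡ : ∀ {d} → HasDim (V̄₀₀₀ A) d → HasDim (V̄₀₀₀ A′) d → m ≡ m′
    m-≡ D D′ = trans (HasDim-unique (λ _ h → h) (λ _ h → h) NF.dim₀₀₀ D)
      (sym (HasDim-unique (λ _ h → h) (λ _ h → h) NF′.dim₀₀₀ D′))

    -- Both sides are n minus the rank of Ω minus m.
    radical-≡ : m ≡ m′ → t ℕ.* 2 ℕ.+ p ≡ t′ ℕ.* 2 ℕ.+ p′
    radical-≡ refl = ℕₚ.+-cancelʳ-≡ m (t ℕ.* 2 ℕ.+ p) (t′ ℕ.* 2 ℕ.+ p′)
      (ℕₚ.+-cancelˡ-≡ ((r ℕ.+ s) ℕ.* 2) _ _ (trans NF.size (trans (sym NF′.size)
        (cong (λ a → a ℕ.* 2 ℕ.+ ((t′ ℕ.* 2 ℕ.+ p′) ℕ.+ m)) (sym rank-≡)))))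

    arf-≡ : qVanishesOnV̄₀ A → parity (+ r) ≡ parity (+ r′)
    arf-≡ vanish = trans (sym NF.arf-ef) (trans (arf-invariant vanish rank-≡ NF.e NF.f NF.hyperbolic-ef NF.dual-ef
      NF′.e NF′.f NF′.hyperbolic-ef NF′.dual-ef) NF′.arf-ef)

parameters-≡ : ∀ {r s t p m r′ s′ t′ p′ m′} → r ≡ r′ → r ℕ.+ s ≡ r′ ℕ.+ s′ → p ≡ p′ →
  t ℕ.* 2 ℕ.+ p ≡ t′ ℕ.* 2 ℕ.+ p′ → m ≡ m′ → _≡_ {A = NFParams} (r , s , t , p , m) (r′ , s′ , t′ , p′ , m′)
parameters-≡ {r} {s} {t} {p} {m} {s′ = s′} {t′} refl rank refl radical refl =
  cong₂ (λ s t → r , s , t , p , m) (ℕₚ.+-cancelˡ-≡ r s s′ rank)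
    (ℕₚ.*-cancelʳ-≡ t t′ 2 (ℕₚ.+-cancelʳ-≡ p (t ℕ.* 2) (t′ ℕ.* 2) radical))

parity-≤1 : ∀ {r r′} → r ≤ 1 → r′ ≤ 1 → parity (+ r) ≡ parity (+ r′) → r ≡ r′
parity-≤1 z≤n       z≤n       _ = refl
parity-≤1 z≤n       (s≤s z≤n) ()
parity-≤1 (s≤s z≤n) z≤n       ()
parity-≤1 (s≤s z≤n) (s≤s z≤n) _ = refl

mod2-1-2 : ∀ {p p′} → (p ≡ 1 ⊎ p ≡ 2) → (p′ ≡ 1 ⊎ p′ ≡ 2) → p % 2 ≡ p′ % 2 → p ≡ p′
mod2-1-2 (inj₁ refl) (inj₁ refl) _ = refl
mod2-1-2 (inj₂ refl) (inj₂ refl) _ = refl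
mod2-1-2 (inj₁ refl) (inj₂ refl) ()
mod2-1-2 (inj₂ refl) (inj₁ refl) ()

module _ {n} (A : Mat n) (A-sym : Symmetric A) (A-even : EvenDiagonal A) where

  open Reduction A A-sym A-even using (exists-minimal)

  -- A minimal form with p = 0 would make q vanish on V̄₀, against the vector of value 1; for p = 1
  -- or 2 minimality leaves r = 0.
  exists-surjective : qSurjOnV̄₀ A → ∃[ s ] ∃[ t ] ∃[ p ] ∃[ m ] IsNormalForm A 0 s t p m × (p ≡ 1 ⊎ p ≡ 2)
  exists-surjective surj with exists-minimal
  ... | r , s , t , zero , m , nf , _ , _ , _ = let (x , x₀ , e) = surj true in
    contradiction (trans (sym e) (NormalForm.p≡0⇒q≡0 A A-sym A-even r s t zero m nf refl x x₀)) λ ()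
  ... | _ , s , t , 1 , m , nf , _ , _ , inj₂ refl = s , t , 1 , m , nf , inj₁ refl
  ... | _ , s , t , 2 , m , nf , _ , _ , inj₂ refl = s , t , 2 , m , nf , inj₂ refl
  ... | _ , _ , _ , suc (suc (suc _)) , _ , _ , _ , s≤s (s≤s ()) , _

  module _ (A′ : Mat n) (A′-sym : Symmetric A′) (A′-even : EvenDiagonal A′) {d}
    (D : HasDim (V̄₀₀₀ A) d) (D′ : HasDim (V̄₀₀₀ A′) d) (iso : q A ≅q q A′) where

    private
      module I = Isometry A A′ A-sym A-even A′-sym A′-even iso

    -- The Arf invariant fixes r within {0,1} and p is 0 on both sides; then the rank gives s, and
    -- the dimension count gives t.
    unique-vanishing : qVanishesOnV̄₀ A → ∀ r s t p m r′ s′ t′ p′ m′ →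
      IsNormalForm A r s t p m → r ≤ 1 → IsNormalForm A′ r′ s′ t′ p′ m′ → r′ ≤ 1 →
      (r , s , t , p , m) ≡ (r′ , s′ , t′ , p′ , m′)
    unique-vanishing vanish r s t p m r′ s′ t′ p′ m′ nf r≤1 nf′ r′≤1 = parameters-≡
      (parity-≤1 r≤1 r′≤1 (arf-≡ vanish)) rank-≡
      (trans (NormalForm.q≡0⇒p≡0 A A-sym A-even r s t p m nf vanish)
        (sym (NormalForm.q≡0⇒p≡0 A′ A′-sym A′-even r′ s′ t′ p′ m′ nf′ (I.vanishing-invariant vanish))))
      (radical-≡ (m-≡ {d} D D′)) (m-≡ {d} D D′)
      where open I.Parameters r s t p m r′ s′ t′ p′ m′ nf nf′

    -- With r = 0 the rank gives s. The number 2t + p fixes the parity of p, hence p within {1,2},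
    -- and then t.
    unique-surjective : ∀ s t p m s′ t′ p′ m′ →
      IsNormalForm A 0 s t p m → (p ≡ 1 ⊎ p ≡ 2) → IsNormalForm A′ 0 s′ t′ p′ m′ → (p′ ≡ 1 ⊎ p′ ≡ 2) →
      (s , t , p , m) ≡ (s′ , t′ , p′ , m′)
    unique-surjective s t p m s′ t′ p′ m′ nf c nf′ c′ = cong proj₂ (parameters-≡ {0} {s} {t} {p} {m} {0} {s′} {t′} {p′} {m′}
      refl rank-≡
      (mod2-1-2 c c′ (trans (sym ([t*2+p]%2 t p)) (trans (cong (_% 2) (radical-≡ (m-≡ {d} D D′))) ([t*2+p]%2 t′ p′))))
      (radical-≡ (m-≡ {d} D D′)) (m-≡ {d} D D′))
      where open I.Parameters 0 s t p m 0 s′ t′ p′ m′ nf nf′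

theorem1p2 : ∀ {n} (A : Mat n) → Symmetric A → EvenDiagonal A →
  -- (a)
  (∀ r s t p m → IsNormalForm A r s t p m →
      HasDim (V̄₀₀₀ A) m
    × (∃[ d ] HasDimMod (V̄₀ A) (V̄₀₀₀ A) d × p % 2 ≡ d % 2)
    × (qVanishesOnV̄₀ A → ArfIs A (parity (+ r))))
  -- (b), case q(V̄₀) = {0}: a normal form with r ∈ {0,1} exists, and it is
  -- determined by n, dim V̄₀₀₀ and the isomorphism class of q
  × (qVanishesOnV̄₀ A →
        (∃[ r ] ∃[ s ] ∃[ t ] ∃[ p ] ∃[ m ] IsNormalForm A r s t p m × r ≤ 1)
      × (∀ (A′ : Mat n) → Symmetric A′ → EvenDiagonal A′ →
         ∀ d → HasDim (V̄₀₀₀ A) d → HasDim (V̄₀₀₀ A′) d → q A ≅q q A′ →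
         ∀ r s t p m r′ s′ t′ p′ m′ →
         IsNormalForm A r s t p m → r ≤ 1 →
         IsNormalForm A′ r′ s′ t′ p′ m′ → r′ ≤ 1 →
         (r , s , t , p , m) ≡ (r′ , s′ , t′ , p′ , m′)))
  -- (b), case q(V̄₀) = F₂: a normal form with p ∈ {1,2} and r = 0 exists,
  -- and it is determined by n, dim V̄₀₀₀ and the isomorphism class of q
  × (qSurjOnV̄₀ A →
        (∃[ s ] ∃[ t ] ∃[ p ] ∃[ m ] IsNormalForm A 0 s t p m × (p ≡ 1 ⊎ p ≡ 2))
      × (∀ (A′ : Mat n) → Symmetric A′ → EvenDiagonal A′ →
         ∀ d → HasDim (V̄₀₀₀ A) d → HasDim (V̄₀₀₀ A′) d → q A ≅q q A′ →
         ∀ s t p m s′ t′ p′ m′ →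
         IsNormalForm A 0 s t p m → (p ≡ 1 ⊎ p ≡ 2) →
         IsNormalForm A′ 0 s′ t′ p′ m′ → (p′ ≡ 1 ⊎ p′ ≡ 2) →
         (s , t , p , m) ≡ (s′ , t′ , p′ , m′)))
theorem1p2 A A-sym A-even =
  (λ r s t p m nf → let open NormalForm A A-sym A-even r s t p m nf in
     dim₀₀₀ , (t ℕ.* 2 ℕ.+ p , dim₀ , sym ([t*2+p]%2 t p)) , λ _ → arfIs) ,
  (λ vanish →
     (let (r , s , t , p , m , nf , r≤1 , _) = Reduction.exists-minimal A A-sym A-even in r , s , t , p , m , nf , r≤1) ,
     λ A′ A′-sym A′-even d D D′ iso → unique-vanishing A A-sym A-even A′ A′-sym A′-even D D′ iso vanish) ,
  (λ surj →
     exists-surjective A A-sym A-even surj ,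
     λ A′ A′-sym A′-even d D D′ iso → unique-surjective A A-sym A-even A′ A′-sym A′-even D D′ iso)
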